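{- Let $\alpha^*\approx 0.357403$ be the unique solution in $[0,1]$ of $\frac{4}{e}\,\alpha\, e^{1-\alpha}=1$. For every $\alpha$ with $0\le\alpha<\alpha^*$ there is a constant $p=p(\alpha)\in(0,1]$ such that the following holds. For every positive integer $n$ for which $m=\alpha n$ is an integer, and every permutation $(r_0,r_1,\ldots,r_{n-1})$ of $\{0,1,\ldots,n-1\}$, if $m+1$ distinct keys are inserted one after another into an initially empty table with $n$ slots by fixed-offset probing with offset sequence $(r_0,\ldots,r_{n-1})$ and a uniformly random hash function, then the cost $X$ of the $(m+1)$th insertion is stochastically dominated by a geometric random variable with mean $1/p$; that is, $\Pr[X>k]\le(1-p)^k$ for every integer $k\ge 0$.
   Context: Fixed-offset probing: the table is an array $A[0],\ldots,A[n-1]$, every slot of which is initially empty. The hash function $h$ maps keys to $\{0,1,\ldots,n-1\}$; it is uniformly random, i.e. the hash values of distinct keys are independent and uniform, and the sequence of keys inserted is fixed independently of $h$. To insert a key $x$, find the minimum $i\ge 0$ such that slot $A[(h(x)+r_i)\bmod n]$ is empty and store $x$ there; the cost of the insertion is $i+1$ (the number of slots probed). Keys are never moved after insertion. The load factor is $\alpha=m/n$, where $m$ is the number of keys inserted before the insertion being analyzed. -}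

module Defs where

open import Data.Fin using (Fin; toℕ; finToFun)
open import Data.Fin.Permutation using (Permutation′; _⟨$⟩ʳ_)
open import Data.Integer as ℤ using (+_; -[1+_])
import Data.Integer.Properties as ℤₚ
open import Data.List as List using (List; filter; findᵇ; length)
open import Data.Maybe using (Maybe; just; nothing; maybe; is-nothing)
open import Data.Nat as ℕ using (ℕ; zero; suc; NonZero)
import Data.Nat.Properties as ℕₚ
open import Data.Nat.DivMod using (_mod_)
open import Data.Product using (∃; _×_; _,_; proj₁; proj₂)
open import Data.Rational as ℚ
  using (ℚ; mkℚ; 0ℚ; 1ℚ; _+_; _*_; _-_; -_; ∣_∣; _≤_; _<_; _/_; 1/_)
open import Data.Rational.Properties
import Data.Rational.Unnormalised as ℚᵘ
import Data.Rational.Unnormalised.Properties as ℚᵘₚ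
open import Data.Rational.Solver using (module +-*-Solver)
open import Data.Sum using (inj₁; inj₂)
open import Data.Vec using (Vec; lookup; _[_]≔_; replicate; foldl′)
open import Relation.Binary.PropositionalEquality
  using (_≡_; refl; sym; trans; cong; cong₂; subst)
open import Relation.Unary using (Decidable)

-- Real numbers are Cauchy sequences of rationals; equality of reals is _≈_.

IsCauchy : (ℕ → ℚ) → Set
IsCauchy s = ∀ ε → 0ℚ < ε →
  ∃ λ N → ∀ i j → N ℕ.≤ i → N ℕ.≤ j → ∣ s i - s j ∣ ≤ ε

record ℝ : Set where
  constructor mkℝ
  field
    seq    : ℕ → ℚ
    cauchy : IsCauchy seq

open ℝ public

infix 4 _≈_ _≤ℝ_ _<ℝ_

_≈_ : ℝ → ℝ → Set
x ≈ y = ∀ ε → 0ℚ < ε → ∃ λ N → ∀ i → N ℕ.≤ i → ∣ seq x i - seq y i ∣ ≤ ε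

_≤ℝ_ : ℝ → ℝ → Set
x ≤ℝ y = ∀ ε → 0ℚ < ε → ∃ λ N → ∀ i → N ℕ.≤ i → seq x i ≤ seq y i + ε

_<ℝ_ : ℝ → ℝ → Set
x <ℝ y = ∃ λ ε → 0ℚ < ε × ∃ λ N → ∀ i → N ℕ.≤ i → seq x i + ε ≤ seq y i

module RationalLemmas where

  0≤1 : 0ℚ ≤ 1ℚ
  0≤1 = nonNegative⁻¹ 1ℚ

  0<1 : 0ℚ < 1ℚ
  0<1 = positive⁻¹ 1ℚ

  *-mono : ∀ {a b c d} → 0ℚ ≤ b → 0ℚ ≤ c → a ≤ b → c ≤ d → a * c ≤ b * d
  *-mono {b = b} {c} 0≤b 0≤c a≤b c≤d = ≤-trans
    (*-monoʳ-≤-nonNeg c {{ℚ.nonNegative 0≤c}} a≤b)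
    (*-monoˡ-≤-nonNeg b {{ℚ.nonNegative 0≤b}} c≤d)

  0≤* : ∀ {a b} → 0ℚ ≤ a → 0ℚ ≤ b → 0ℚ ≤ a * b
  0≤* {a} {b} 0≤a 0≤b = subst (_≤ a * b) (*-zeroˡ b)
    (*-monoʳ-≤-nonNeg b {{ℚ.nonNegative 0≤b}} 0≤a)

  0≤+ : ∀ {a b} → 0ℚ ≤ a → 0ℚ ≤ b → 0ℚ ≤ a + b
  0≤+ {a} {b} 0≤a 0≤b = subst (_≤ a + b) (+-identityˡ 0ℚ) (+-mono-≤ 0≤a 0≤b)

  0<+ : ∀ {a b} → 0ℚ ≤ a → 0ℚ < b → 0ℚ < a + b
  0<+ {a} {b} 0≤a 0<b = subst (_< a + b) (+-identityˡ 0ℚ) (+-mono-≤-< 0≤a 0<b)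

  0<* : ∀ {a b} → 0ℚ < a → 0ℚ < b → 0ℚ < a * b
  0<* {a} {b} 0<a 0<b = subst (_< a * b) (*-zeroˡ b)
    (*-monoˡ-<-pos b {{ℚ.positive 0<b}} 0<a)

  p≤p+q : ∀ p {q} → 0ℚ ≤ q → p ≤ p + q
  p≤p+q p {q} 0≤q = subst (_≤ p + q) (+-identityʳ p) (+-monoʳ-≤ p 0≤q)

  inv : ∀ {a} → 0ℚ < a → ℚ
  inv {a} 0<a = (1/ a) {{ℚ.>-nonZero 0<a}}

  inv-pos : ∀ {a} (0<a : 0ℚ < a) → 0ℚ < inv 0<a
  inv-pos {a} 0<a = positive⁻¹ (inv 0<a) {{1/pos⇒pos a {{ℚ.positive 0<a}}}}

  inv-r : ∀ {a} (0<a : 0ℚ < a) → a * inv 0<a ≡ 1ℚ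
  inv-r {a} 0<a = *-inverseʳ a {{ℚ.>-nonZero 0<a}}

  ∣x-x∣ : ∀ a → ∣ a - a ∣ ≡ 0ℚ
  ∣x-x∣ a = cong ∣_∣ (+-inverseʳ a)

  ∣-∣-swap : ∀ a b → ∣ a - b ∣ ≡ ∣ b - a ∣
  ∣-∣-swap a b = trans (sym (∣-p∣≡∣p∣ (a - b))) (cong ∣_∣
    (solve 2 (λ a b → :- (a :- b) := b :- a) refl a b))
    where open +-*-Solver

  cauchy-scaled : ∀ (s : ℕ → ℚ) K → 0ℚ < K →
    (∀ ε → 0ℚ < ε →
      ∃ λ N → ∀ i j → N ℕ.≤ i → N ℕ.≤ j → ∣ s i - s j ∣ ≤ K * ε) →
    IsCauchy s
  cauchy-scaled s K 0<K f ε 0<ε =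
    let N , g = f (inv 0<K * ε) 0<δ
    in N , λ i j N≤i N≤j → subst (∣ s i - s j ∣ ≤_) eq (g i j N≤i N≤j)
    where
    0<δ : 0ℚ < inv 0<K * ε
    0<δ = 0<* (inv-pos 0<K) 0<ε
    eq : K * (inv 0<K * ε) ≡ ε
    eq = trans (sym (*-assoc K _ ε))
        (trans (cong (_* ε) (inv-r 0<K)) (*-identityˡ ε))

  eventually-bounded : ∀ x → ∃ λ B → 0ℚ ≤ B ×
    ∃ λ N → ∀ i → N ℕ.≤ i → ∣ seq x i ∣ ≤ B
  eventually-bounded x =
    let N , f = cauchy x 1ℚ 0<1
        a = seq x N
    in 1ℚ + ∣ a ∣ , 0≤+ 0≤1 (0≤∣p∣ a) , N , λ i N≤i →
       ≤-trans
         (subst (_≤ ∣ seq x i - a ∣ + ∣ a ∣)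
           (cong ∣_∣ (solve 2 (λ b a → (b :- a) :+ a := b) refl (seq x i) a))
           (∣p+q∣≤∣p∣+∣q∣ (seq x i - a) a))
         (+-monoˡ-≤ ∣ a ∣ (f i N N≤i ℕₚ.≤-refl))
    where open +-*-Solver

  ⊔-l : ∀ a b {i} → a ℕ.⊔ b ℕ.≤ i → a ℕ.≤ i
  ⊔-l a b = ℕₚ.≤-trans (ℕₚ.m≤m⊔n a b)

  ⊔-r : ∀ a b {i} → a ℕ.⊔ b ℕ.≤ i → b ℕ.≤ i
  ⊔-r a b = ℕₚ.≤-trans (ℕₚ.m≤n⊔m a b)

  ∣+∣-cong : ∀ {a} b c → a ≡ b + c → ∣ a ∣ ≤ ∣ b ∣ + ∣ c ∣
  ∣+∣-cong b c refl = ∣p+q∣≤∣p∣+∣q∣ b c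

open RationalLemmas

fromℚ : ℚ → ℝ
fromℚ q = mkℝ (λ _ → q) λ ε 0<ε → 0 , λ _ _ _ _ →
  subst (_≤ ε) (sym (∣x-x∣ q)) (<⇒≤ 0<ε)

fromℕ : ℕ → ℝ
fromℕ n = fromℚ (+ n / 1)

0ℝ 1ℝ : ℝ
0ℝ = fromℕ 0
1ℝ = fromℕ 1

infix  8 -ℝ_
infixr 8 _^ℝ_
infixl 7 _*ℝ_
infixl 6 _+ℝ_ _-ℝ_

-ℝ_ : ℝ → ℝ
-ℝ x = mkℝ (λ i → - seq x i) λ ε 0<ε →
  let N , f = cauchy x ε 0<ε
  in N , λ i j N≤i N≤j → subst (_≤ ε)
       (trans (∣-∣-swap (seq x i) (seq x j)) (cong ∣_∣
         (solve 2 (λ a b → b :- a := :- a :- :- b) refl (seq x i) (seq x j))))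
       (f i j N≤i N≤j)
  where open +-*-Solver

_+ℝ_ : ℝ → ℝ → ℝ
x +ℝ y = mkℝ s (cauchy-scaled s (1ℚ + 1ℚ) (0<+ 0≤1 0<1) est)
  where
  s : ℕ → ℚ
  s i = seq x i + seq y i
  open +-*-Solver
  est : ∀ ε → 0ℚ < ε → ∃ λ N → ∀ i j → N ℕ.≤ i → N ℕ.≤ j →
        ∣ s i - s j ∣ ≤ (1ℚ + 1ℚ) * ε
  est ε 0<ε =
    let N , f = cauchy x ε 0<ε
        M , g = cauchy y ε 0<ε
    in N ℕ.⊔ M , λ i j p q →
      subst (∣ s i - s j ∣ ≤_)
        (solve 1 (λ e → e :+ e := (con 1ℚ :+ con 1ℚ) :* e) refl ε)
        (≤-trans
          (∣+∣-cong (seq x i - seq x j) (seq y i - seq y j)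
            (solve 4 (λ a b c d → (a :+ b) :- (c :+ d) := (a :- c) :+ (b :- d))
              refl (seq x i) (seq y i) (seq x j) (seq y j)))
          (+-mono-≤ (f i j (⊔-l N M p) (⊔-l N M q))
                    (g i j (⊔-r N M p) (⊔-r N M q))))

_-ℝ_ : ℝ → ℝ → ℝ
x -ℝ y = x +ℝ (-ℝ y)

_*ℝ_ : ℝ → ℝ → ℝ
x *ℝ y = mkℝ s (cauchy-scaled s (1ℚ + (A + B)) 0<K est)
  where
  s : ℕ → ℚ
  s i = seq x i * seq y i
  open +-*-Solver
  bx = eventually-bounded x
  by = eventually-bounded y
  A = proj₁ bx
  B = proj₁ by
  0≤A = proj₁ (proj₂ bx)
  0≤B = proj₁ (proj₂ by)
  Nx = proj₁ (proj₂ (proj₂ bx))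
  Ny = proj₁ (proj₂ (proj₂ by))
  0<K : 0ℚ < 1ℚ + (A + B)
  0<K = subst (0ℚ <_) (+-comm (A + B) 1ℚ) (0<+ (0≤+ 0≤A 0≤B) 0<1)
  est : ∀ ε → 0ℚ < ε → ∃ λ N → ∀ i j → N ℕ.≤ i → N ℕ.≤ j →
        ∣ s i - s j ∣ ≤ (1ℚ + (A + B)) * ε
  est ε 0<ε =
    let N , f = cauchy x ε 0<ε
        M , g = cauchy y ε 0<ε
        a = N ℕ.⊔ M
        b = Nx ℕ.⊔ Ny
        0≤ε = <⇒≤ 0<ε
    in a ℕ.⊔ b , λ i j p q →
      let dx = seq x i - seq x j
          dy = seq y i - seq y j
          bound-x : ∣ seq x i * dy ∣ ≤ A * ε
          bound-x = subst (_≤ A * ε) (sym (∣p*q∣≡∣p∣*∣q∣ (seq x i) dy))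
            (*-mono 0≤A (0≤∣p∣ dy)
              (proj₂ (proj₂ (proj₂ bx)) i (⊔-l Nx Ny (⊔-r a b p)))
              (g i j (⊔-r N M (⊔-l a b p)) (⊔-r N M (⊔-l a b q))))
          bound-y : ∣ dx * seq y j ∣ ≤ ε * B
          bound-y = subst (_≤ ε * B) (sym (∣p*q∣≡∣p∣*∣q∣ dx (seq y j)))
            (*-mono 0≤ε (0≤∣p∣ (seq y j))
              (f i j (⊔-l N M (⊔-l a b p)) (⊔-l N M (⊔-l a b q)))
              (proj₂ (proj₂ (proj₂ by)) j (⊔-r Nx Ny (⊔-r a b q))))
      in ≤-trans
          (∣+∣-cong (seq x i * dy) (dx * seq y j)
            (solve 4 (λ a b c d →
              a :* b :- c :* d := a :* (b :- d) :+ (a :- c) :* d)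
              refl (seq x i) (seq y i) (seq x j) (seq y j)))
          (≤-trans (+-mono-≤ bound-x bound-y)
            (subst (A * ε + ε * B ≤_)
              (solve 3 (λ A B e →
                (A :* e :+ e :* B) :+ e := (con 1ℚ :+ (A :+ B)) :* e)
                refl A B ε)
              (p≤p+q (A * ε + ε * B) 0≤ε)))

_^ℝ_ : ℝ → ℕ → ℝ
x ^ℝ zero  = 1ℝ
x ^ℝ suc k = x *ℝ x ^ℝ k

-- Reciprocal of a positive real.  The index is shifted so that every term of
-- the sequence being inverted is bounded below by the witness of positivity.
recip : (x : ℝ) → 0ℝ <ℝ x → ℝ
recip x (δ , 0<δ , N , δ≤) = mkℝ s (cauchy-scaled s (c * c) 0<K est)
  where
  open +-*-Solver
  a : ℕ → ℚ
  a i = seq x (N ℕ.+ i)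
  δ≤a : ∀ i → δ ≤ a i
  δ≤a i = subst (_≤ a i) (+-identityˡ δ) (δ≤ (N ℕ.+ i) (ℕₚ.m≤m+n N i))
  0<a : ∀ i → 0ℚ < a i
  0<a i = <-≤-trans 0<δ (δ≤a i)
  s : ℕ → ℚ
  s i = (1/ a i) {{ℚ.>-nonZero (0<a i)}}
  c : ℚ
  c = inv 0<δ
  0≤c = <⇒≤ (inv-pos 0<δ)
  0<K : 0ℚ < c * c
  0<K = 0<* (inv-pos 0<δ) (inv-pos 0<δ)
  0≤s : ∀ i → 0ℚ ≤ s i
  0≤s i = <⇒≤ (inv-pos (0<a i))
  s≤c : ∀ i → s i ≤ c
  s≤c i = subst₂′ eq₁ eq₂
    (*-monoʳ-≤-nonNeg (c * s i) {{ℚ.nonNegative (0≤* 0≤c (0≤s i))}} (δ≤a i))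
    where
    subst₂′ : ∀ {p q p′ q′} → p ≡ p′ → q ≡ q′ → p ≤ q → p′ ≤ q′
    subst₂′ refl refl h = h
    eq₁ : δ * (c * s i) ≡ s i
    eq₁ = trans (sym (*-assoc δ c (s i)))
      (trans (cong (_* s i) (inv-r 0<δ)) (*-identityˡ (s i)))
    eq₂ : a i * (c * s i) ≡ c
    eq₂ = trans (solve 3 (λ x c y → x :* (c :* y) := (x :* y) :* c)
                  refl (a i) c (s i))
      (trans (cong (_* c) (inv-r (0<a i))) (*-identityˡ c))
  diff : ∀ i j → s i - s j ≡ (s i * s j) * (a j - a i)
  diff i j = sym (trans
    (solve 4 (λ p q x y → (p :* q) :* (y :- x) := p :* (y :* q) :- q :* (x :* p))
      refl (s i) (s j) (a i) (a j))
    (cong₂ _-_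
      (trans (cong (s i *_) (inv-r (0<a j))) (*-identityʳ (s i)))
      (trans (cong (s j *_) (inv-r (0<a i))) (*-identityʳ (s j)))))
  est : ∀ ε → 0ℚ < ε → ∃ λ M → ∀ i j → M ℕ.≤ i → M ℕ.≤ j →
        ∣ s i - s j ∣ ≤ (c * c) * ε
  est ε 0<ε =
    let M , f = cauchy x ε 0<ε
    in M , λ i j p q →
      subst (_≤ (c * c) * ε)
        (sym (trans (cong ∣_∣ (diff i j))
          (trans (∣p*q∣≡∣p∣*∣q∣ (s i * s j) (a j - a i))
            (cong (_* ∣ a j - a i ∣) (0≤p⇒∣p∣≡p (0≤* (0≤s i) (0≤s j)))))))
        (*-mono (0≤* 0≤c 0≤c) (0≤∣p∣ (a j - a i))
          (*-mono 0≤c (0≤s j) (s≤c i) (s≤c j))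
          (f (N ℕ.+ j) (N ℕ.+ i)
            (ℕₚ.≤-trans q (ℕₚ.m≤n+m j N)) (ℕₚ.≤-trans p (ℕₚ.m≤n+m i N))))

-- expTerm k x = xᵏ / k!
expTerm : ℕ → ℚ → ℚ
expTerm zero    x = 1ℚ
expTerm (suc k) x = expTerm k x * x * (+ 1 / suc k)

-- expSum n x = Σ_{k ≤ n} xᵏ / k!
expSum : ℕ → ℚ → ℚ
expSum zero    x = expTerm zero x
expSum (suc n) x = expSum n x + expTerm (suc n) x

module ExpLemmas where

  ν : ℕ → ℚ
  ν n = + n / 1

  ν-suc : ∀ n → ν (suc n) ≡ 1ℚ + ν n
  ν-suc n = toℚᵘ-injective (ℚᵘₚ.≃-trans
    (toℚᵘ-fromℚᵘ (ℚᵘ.mkℚᵘ (+ suc n) 0))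
    (ℚᵘₚ.≃-trans
      (ℚᵘ.*≡* (cong (ℤ._* + 1) (sym (cong₂ ℤ._+_ (ℤₚ.*-identityʳ (+ 1)) (ℤₚ.*-identityʳ (+ n))))))
      (ℚᵘₚ.≃-sym (ℚᵘₚ.≃-trans (toℚᵘ-homo-+ 1ℚ (ν n))
        (ℚᵘₚ.+-congʳ (ℚ.toℚᵘ 1ℚ) (toℚᵘ-fromℚᵘ (ℚᵘ.mkℚᵘ (+ n) 0)))))))

  0≤ν : ∀ n → 0ℚ ≤ ν n
  0≤ν n = nonNegative⁻¹ (ν n) {{normalize-nonNeg n 1}}

  ν-mono : ∀ m {n} → m ℕ.≤ n → ν m ≤ ν n
  ν-mono zero    {n} _ = 0≤ν n
  ν-mono (suc m) {suc n} (ℕ.s≤s m≤n) rewrite ν-suc m | ν-suc n =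
    +-monoʳ-≤ 1ℚ (ν-mono m m≤n)

  c : ℕ → ℚ
  c k = + 1 / suc k

  0≤c : ∀ k → 0ℚ ≤ c k
  0≤c k = nonNegative⁻¹ (c k) {{normalize-nonNeg 1 (suc k)}}

  ν*c : ∀ k → ν (suc k) * c k ≡ 1ℚ
  ν*c k = toℚᵘ-injective (ℚᵘₚ.≃-trans (toℚᵘ-homo-* (ν (suc k)) (c k))
    (ℚᵘₚ.≃-trans
      (ℚᵘₚ.*-cong (toℚᵘ-fromℚᵘ (ℚᵘ.mkℚᵘ (+ suc k) 0)) (toℚᵘ-fromℚᵘ (ℚᵘ.mkℚᵘ (+ 1) k)))
      (ℚᵘ.*≡* (trans (ℤₚ.*-identityʳ _) (trans (ℤₚ.*-identityʳ (+ suc k))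
        (sym (trans (ℤₚ.*-identityˡ _) (ℤₚ.*-identityˡ (+ suc k)))))))))

  archimedean : ∀ q → ∃ λ n → q ≤ ν n
  archimedean (mkℚ (+ n) d co) = n , toℚᵘ-cancel-≤ (ℚᵘₚ.≤-respʳ-≃
    (ℚᵘₚ.≃-sym (toℚᵘ-fromℚᵘ (ℚᵘ.mkℚᵘ (+ n) 0)))
    (ℚᵘ.*≤* (ℤₚ.*-monoˡ-≤-nonNeg (+ n) (ℤ.+≤+ (ℕ.s≤s ℕ.z≤n)))))
  archimedean q@(mkℚ -[1+ n ] d co) = 0 , <⇒≤ (negative⁻¹ q)

  module Estimates (B : ℚ) (0≤B : 0ℚ ≤ B) where

    open +-*-Solver

    t : ℕ → ℚ
    t k = expTerm k B

    0≤t : ∀ k → 0ℚ ≤ t k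
    0≤t zero    = 0≤1
    0≤t (suc k) = 0≤* (0≤* (0≤t k) 0≤B) (0≤c k)

    B*t : ∀ k → t k * B ≡ ν (suc k) * t (suc k)
    B*t k = sym (trans
      (solve 3 (λ n u v → n :* (u :* v) := u :* (n :* v)) refl (ν (suc k)) (t k * B) (c k))
      (trans (cong (t k * B *_) (ν*c k)) (*-identityʳ (t k * B))))

    ∣term∣≤ : ∀ k x → ∣ x ∣ ≤ B → ∣ expTerm k x ∣ ≤ t k
    ∣term∣≤ zero    x _ = ≤-refl
    ∣term∣≤ (suc k) x b = subst (_≤ t (suc k))
      (sym (trans (∣p*q∣≡∣p∣*∣q∣ (expTerm k x * x) (c k))
        (cong₂ _*_ (∣p*q∣≡∣p∣*∣q∣ (expTerm k x) x) (0≤p⇒∣p∣≡p (0≤c k)))))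
      (*-monoʳ-≤-nonNeg (c k) {{ℚ.nonNegative (0≤c k)}}
        (*-mono (0≤t k) (0≤∣p∣ x) (∣term∣≤ k x b) b))

    module _ (x y : ℚ) (bx : ∣ x ∣ ≤ B) (by : ∣ y ∣ ≤ B) where

      D : ℚ
      D = ∣ x - y ∣

      0≤D : 0ℚ ≤ D
      0≤D = 0≤∣p∣ (x - y)

      d : ℕ → ℚ
      d k = expTerm k x - expTerm k y

      d-suc : ∀ k → ∣ d k ∣ * B ≤ D * (ν k * t k) → ∣ d (suc k) ∣ ≤ D * t k
      d-suc k h = subst (∣ d (suc k) ∣ ≤_) eq
        (subst (_≤ (t k * D + D * (ν k * t k)) * c k)
          (sym (trans (cong ∣_∣ split) (trans (∣p*q∣≡∣p∣*∣q∣ num (c k))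
            (cong (∣ num ∣ *_) (0≤p⇒∣p∣≡p (0≤c k))))))
          (*-monoʳ-≤-nonNeg (c k) {{ℚ.nonNegative (0≤c k)}}
            (≤-trans (∣p+q∣≤∣p∣+∣q∣ (expTerm k x * (x - y)) (d k * y))
              (+-mono-≤
                (subst (_≤ t k * D) (sym (∣p*q∣≡∣p∣*∣q∣ (expTerm k x) (x - y)))
                  (*-monoʳ-≤-nonNeg D {{ℚ.nonNegative 0≤D}} (∣term∣≤ k x bx)))
                (≤-trans
                  (subst (_≤ ∣ d k ∣ * B) (sym (∣p*q∣≡∣p∣*∣q∣ (d k) y))
                    (*-monoˡ-≤-nonNeg ∣ d k ∣ {{∣-∣-nonNeg (d k)}} by))
                  h)))))
        where
        num : ℚ
        num = expTerm k x * (x - y) + d k * y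
        split : d (suc k) ≡ num * c k
        split = solve 5 (λ u v x y c →
          u :* x :* c :- v :* y :* c := (u :* (x :- y) :+ (u :- v) :* y) :* c)
          refl (expTerm k x) (expTerm k y) x y (c k)
        eq : (t k * D + D * (ν k * t k)) * c k ≡ D * t k
        eq = trans
          (solve 4 (λ t D n c →
            (t :* D :+ D :* (n :* t)) :* c := (D :* t) :* ((con 1ℚ :+ n) :* c))
            refl (t k) D (ν k) (c k))
          (trans (cong (λ z → D * t k * (z * c k)) (sym (ν-suc k)))
            (trans (cong (D * t k *_) (ν*c k)) (*-identityʳ (D * t k))))

      d-bound : ∀ k → ∣ d k ∣ * B ≤ D * (ν k * t k)
      d-bound zero    = ≤-reflexive (trans (*-zeroˡ B)
        (sym (trans (cong (D *_) (*-zeroˡ (t 0))) (*-zeroʳ D))))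
      d-bound (suc k) = ≤-trans
        (*-monoʳ-≤-nonNeg B {{ℚ.nonNegative 0≤B}} (d-suc k (d-bound k)))
        (≤-reflexive (trans (*-assoc D (t k) B) (cong (D *_) (B*t k))))

      sum-lipschitz : ∀ n →
        ∣ expSum (suc n) x - expSum (suc n) y ∣ ≤ D * expSum n B
      sum-lipschitz n = ≤-trans
        (∣+∣-cong (expSum n x - expSum n y) (d (suc n))
          (solve 4 (λ a b c d → (a :+ b) :- (c :+ d) := (a :- c) :+ (b :- d)) refl
            (expSum n x) (expTerm (suc n) x) (expSum n y) (expTerm (suc n) y)))
        (≤-trans (+-mono-≤ (prev n) (d-suc n (d-bound n)))
          (≤-reflexive (last n)))
        where
        S′ : ℕ → ℚ
        S′ zero    = 0ℚ
        S′ (suc n) = expSum n B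
        prev : ∀ n → ∣ expSum n x - expSum n y ∣ ≤ D * S′ n
        prev zero    = ≤-reflexive (sym (*-zeroʳ D))
        prev (suc n) = sum-lipschitz n
        last : ∀ n → D * S′ n + D * t n ≡ D * expSum n B
        last zero    = solve 2 (λ D t → D :* con 0ℚ :+ D :* t := D :* t) refl D (t 0)
        last (suc n) = sym (*-distribˡ-+ D (expSum n B) (t (suc n)))

    K : ℕ
    K = proj₁ (archimedean (B + B))

    halving : ∀ k → K ℕ.≤ k → t (suc k) + t (suc k) ≤ t k
    halving k K≤k = subst (_≤ t k)
      (solve 3 (λ u b c → u :* ((b :+ b) :* c) := u :* b :* c :+ u :* b :* c)
        refl (t k) B (c k))
      (subst (t k * ((B + B) * c k) ≤_) (*-identityʳ (t k))
        (*-monoˡ-≤-nonNeg (t k) {{ℚ.nonNegative (0≤t k)}}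
          (subst ((B + B) * c k ≤_) (ν*c k)
            (*-monoʳ-≤-nonNeg (c k) {{ℚ.nonNegative (0≤c k)}}
              (≤-trans (proj₂ (archimedean (B + B)))
                (ν-mono K (ℕₚ.≤-trans K≤k (ℕₚ.n≤1+n k))))))))

    tail : ∀ x → ∣ x ∣ ≤ B → ∀ m → K ℕ.≤ m → ∀ j →
           ∣ expSum (j ℕ.+ m) x - expSum m x ∣ + t (j ℕ.+ m) ≤ t m
    tail x b m K≤m zero = ≤-reflexive
      (trans (cong (_+ t m) (∣x-x∣ (expSum m x))) (+-identityˡ (t m)))
    tail x b m K≤m (suc j) = begin
      ∣ expSum (suc n) x - S ∣ + t (suc n)
        ≤⟨ +-monoˡ-≤ (t (suc n)) (∣+∣-cong (expSum n x - S) T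
             (solve 3 (λ a b c → (a :+ b) :- c := (a :- c) :+ b) refl (expSum n x) T S)) ⟩
      δ + ∣ T ∣ + t (suc n)
        ≤⟨ +-monoˡ-≤ (t (suc n)) (+-monoʳ-≤ δ (∣term∣≤ (suc n) x b)) ⟩
      δ + t (suc n) + t (suc n)
        ≡⟨ +-assoc δ (t (suc n)) (t (suc n)) ⟩
      δ + (t (suc n) + t (suc n))
        ≤⟨ +-monoʳ-≤ δ (halving n (ℕₚ.≤-trans K≤m (ℕₚ.m≤n+m m j))) ⟩
      δ + t n
        ≤⟨ tail x b m K≤m j ⟩
      t m ∎
      where
      open ≤-Reasoning
      n = j ℕ.+ m
      S = expSum m x
      T = expTerm (suc n) x
      δ = ∣ expSum n x - S ∣

    tail′ : ∀ x → ∣ x ∣ ≤ B → ∀ m → K ℕ.≤ m → ∀ i → m ℕ.≤ i →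
            ∣ expSum i x - expSum m x ∣ ≤ t m
    tail′ x b m K≤m i m≤i = ≤-trans
      (p≤p+q ∣ expSum i x - expSum m x ∣ (0≤t i))
      (subst (λ z → ∣ expSum z x - expSum m x ∣ + t z ≤ t m)
        (ℕₚ.m∸n+n≡m m≤i) (tail x b m K≤m (i ℕ.∸ m)))

    C : ℚ
    C = t K + expSum K B

    0≤expSum : ∀ n → 0ℚ ≤ expSum n B
    0≤expSum zero    = 0≤1
    0≤expSum (suc n) = 0≤+ (0≤expSum n) (0≤t (suc n))

    0≤C : 0ℚ ≤ C
    0≤C = 0≤+ (0≤t K) (0≤expSum K)

    sum-bounded : ∀ n → K ℕ.≤ n → expSum n B ≤ C
    sum-bounded n K≤n = ≤-trans
      (≤-reflexive (solve 2 (λ a b → a := (a :- b) :+ b) refl (expSum n B) (expSum K B)))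
      (+-monoˡ-≤ (expSum K B)
        (≤-trans (p≤∣p∣ (expSum n B - expSum K B))
          (tail′ B (≤-reflexive (0≤p⇒∣p∣≡p 0≤B)) K ℕₚ.≤-refl n K≤n)))
      where
      p≤∣p∣ : ∀ p → p ≤ ∣ p ∣
      p≤∣p∣ p with ≤-total 0ℚ p
      ... | inj₁ 0≤p = ≤-reflexive (sym (0≤p⇒∣p∣≡p 0≤p))
      ... | inj₂ p≤0 = ≤-trans p≤0 (0≤∣p∣ p)

    decay : ∀ j → ν (suc j) * t (j ℕ.+ K) ≤ t K
    decay zero    = ≤-reflexive (*-identityˡ (t K))
    decay (suc j) = begin
      ν (2 ℕ.+ j) * u              ≤⟨ p≤p+q (ν (2 ℕ.+ j) * u) (0≤* (0≤ν j) (0≤t (suc j ℕ.+ K))) ⟩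
      ν (2 ℕ.+ j) * u + ν j * u    ≡⟨ eq ⟩
      ν (suc j) * (u + u)          ≤⟨ *-monoˡ-≤-nonNeg (ν (suc j)) {{ℚ.nonNegative (0≤ν (suc j))}}
                                        (halving (j ℕ.+ K) (ℕₚ.m≤n+m K j)) ⟩
      ν (suc j) * t (j ℕ.+ K)      ≤⟨ decay j ⟩
      t K                          ∎
      where
      open ≤-Reasoning
      u = t (suc j ℕ.+ K)
      eq : ν (2 ℕ.+ j) * u + ν j * u ≡ ν (suc j) * (u + u)
      eq = trans
        (cong (λ z → z * u + ν j * u) (trans (ν-suc (suc j)) (cong (_+_ 1ℚ) (ν-suc j))))
        (trans (solve 2 (λ n u → (con 1ℚ :+ (con 1ℚ :+ n)) :* u :+ n :* u
                           := (con 1ℚ :+ n) :* (u :+ u)) refl (ν j) u)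
          (cong (_* (u + u)) (sym (ν-suc j))))

    small : ∀ ε → 0ℚ < ε → ∃ λ n → K ℕ.≤ n × t (suc n) ≤ ε
    small ε 0<ε = J ℕ.+ K , ℕₚ.m≤n+m K J ,
      *-cancelˡ-≤-pos (ν (suc (suc J)))
        {{normalize-pos (suc (suc J)) 1}}
        (≤-trans (decay (suc J)) t≤)
      where
      q = t K * inv 0<ε
      J = proj₁ (archimedean q)
      t≤ : t K ≤ ν (suc (suc J)) * ε
      t≤ = subst (_≤ ν (suc (suc J)) * ε)
        (trans (solve 3 (λ t v e → (t :* v) :* e := t :* (e :* v)) refl (t K) (inv 0<ε) ε)
          (trans (cong (t K *_) (inv-r 0<ε)) (*-identityʳ (t K))))
        (*-monoʳ-≤-nonNeg ε {{ℚ.nonNegative (<⇒≤ 0<ε)}}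
          (≤-trans (proj₂ (archimedean q))
            (ν-mono J (ℕₚ.≤-trans (ℕₚ.n≤1+n J) (ℕₚ.n≤1+n (suc J))))))

open ExpLemmas

exp : ℝ → ℝ
exp x = mkℝ s (cauchy-scaled s κ 0<κ est)
  where
  s : ℕ → ℚ
  s i = expSum i (seq x i)
  open +-*-Solver
  bx = eventually-bounded x
  B = proj₁ bx
  N₀ = proj₁ (proj₂ (proj₂ bx))
  bounded = proj₂ (proj₂ (proj₂ bx))
  open Estimates B (proj₁ (proj₂ bx))
  κ = (1ℚ + C) + 1ℚ
  0<κ : 0ℚ < κ
  0<κ = 0<+ (0≤+ 0≤1 0≤C) 0<1
  est : ∀ ε → 0ℚ < ε → ∃ λ N → ∀ i j → N ℕ.≤ i → N ℕ.≤ j →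
        ∣ s i - s j ∣ ≤ κ * ε
  est ε 0<ε =
    let N , f = cauchy x ε 0<ε
        n , K≤n , tn≤ε = small ε 0<ε
        m = suc n
        K≤m = ℕₚ.≤-trans K≤n (ℕₚ.n≤1+n n)
        L = N ℕ.⊔ N₀
    in L ℕ.⊔ m , λ i j p q →
      let xi = seq x i
          xj = seq x j
          bi = bounded i (⊔-r N N₀ (⊔-l L m p))
          bj = bounded j (⊔-r N N₀ (⊔-l L m q))
          a₁ : ∣ s i - expSum m xi ∣ ≤ ε
          a₁ = ≤-trans (tail′ xi bi m K≤m i (⊔-r L m p)) tn≤ε
          a₂ : ∣ expSum m xi - expSum m xj ∣ ≤ ε * C
          a₂ = ≤-trans (sum-lipschitz xi xj bi bj n)
            (*-mono (<⇒≤ 0<ε) (0≤expSum n)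
              (f i j (⊔-l N N₀ (⊔-l L m p)) (⊔-l N N₀ (⊔-l L m q)))
              (sum-bounded n K≤n))
          a₃ : ∣ expSum m xj - s j ∣ ≤ ε
          a₃ = subst (_≤ ε) (∣-∣-swap (s j) (expSum m xj))
            (≤-trans (tail′ xj bj m K≤m j (⊔-r L m q)) tn≤ε)
      in ≤-trans
        (∣+∣-cong (s i - expSum m xj) (expSum m xj - s j)
          (solve 3 (λ a b c → a :- c := (a :- b) :+ (b :- c)) refl
            (s i) (expSum m xj) (s j)))
        (≤-trans
          (+-mono-≤
            (≤-trans
              (∣+∣-cong (s i - expSum m xi) (expSum m xi - expSum m xj)
                (solve 3 (λ a b c → a :- c := (a :- b) :+ (b :- c)) refl
                  (s i) (expSum m xi) (expSum m xj)))
              (+-mono-≤ a₁ a₂))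
            a₃)
          (≤-reflexive
            (solve 2 (λ e C → (e :+ e :* C) :+ e := ((con 1ℚ :+ C) :+ con 1ℚ) :* e)
              refl ε C)))

e : ℝ
e = exp 1ℝ

0<e : 0ℝ <ℝ e
0<e = 1ℚ , 0<1 , 0 , λ i _ → subst (_≤ seq e i) (sym (+-identityˡ 1ℚ)) (1≤ i)
  where
  open Estimates 1ℚ 0≤1 using (0≤t)
  1≤ : ∀ n → 1ℚ ≤ expSum n 1ℚ
  1≤ zero    = ≤-refl
  1≤ (suc n) = ≤-trans (1≤ n) (p≤p+q (expSum n 1ℚ) (0≤t (suc n)))

-- The equation (4/e) a e^(1-a) = 1.  It has exactly one root in [0,1], since the
-- left-hand side increases strictly from 0 to 4/e > 1 there.
IsCriticalLoad : ℝ → Set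
IsCriticalLoad a = 0ℝ ≤ℝ a × a ≤ℝ 1ℝ ×
  fromℕ 4 *ℝ recip e 0<e *ℝ a *ℝ exp (1ℝ -ℝ a) ≈ 1ℝ

-- A table with n slots for keys from the universe Fin u; nothing marks an
-- empty slot, r is the offset sequence and h the hash function.
module Probing {n u : ℕ} .{{_ : NonZero n}}
               (r : Permutation′ n) (h : Fin u → Fin n) where

  Table : Set
  Table = Vec (Maybe (Fin u)) n

  slot : Fin u → Fin n → Fin n
  slot x i = (toℕ (h x) ℕ.+ toℕ (r ⟨$⟩ʳ i)) mod n

  -- The least i such that the i-th probe of x hits an empty slot.
  firstEmpty : Table → Fin u → Maybe (Fin n)
  firstEmpty A x = findᵇ (λ i → is-nothing (lookup A (slot x i))) (List.allFin n)

  -- Insertion into a full table leaves it unchanged.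
  insert : Table → Fin u → Table
  insert A x = maybe (λ i → A [ slot x i ]≔ just x) A (firstEmpty A x)

  -- The value suc n is only taken on a full table, which never occurs
  -- when fewer than n keys have been inserted.
  cost : Table → Fin u → ℕ
  cost A x = maybe (λ i → suc (toℕ i)) (suc n) (firstEmpty A x)

  tableAfter : ∀ {m} → Vec (Fin u) m → Table
  tableAfter = foldl′ insert (replicate n nothing)

insertionCost : ∀ {n u m} .{{_ : NonZero n}} → Permutation′ n →
  Vec (Fin u) m → Fin u → (Fin u → Fin n) → ℕ
insertionCost r xs x h = cost (tableAfter xs) x
  where open Probing r h

-- Every function Fin u → Fin n occurs exactly once, as finToFun is a bijection.
hashFunctions : ∀ u n → List (Fin u → Fin n)
hashFunctions u n = List.map finToFun (List.allFin (n ℕ.^ u))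

-- Probability of an event under a uniformly random h : Fin u → Fin n, which
-- amounts to independent uniform hash values of distinct keys.
Pr : ∀ {u n} .{{_ : NonZero n}} {P : (Fin u → Fin n) → Set} → Decidable P → ℚ
Pr {u} {n} P? = (+ length (filter P? (hashFunctions u n)) / (n ℕ.^ u))
  {{ℕₚ.m^n≢0 n u}}

{-# OPTIONS --safe #-}

-- The keys are grouped into clusters: a new key merges the clusters that its
-- probe path visits, together with the slot that it fills.  Let D_t be the number
-- of hash sequences of t keys all of which lie in clusters met by one given path.
-- Splitting off the first cluster met, which has 1 + i keys, and translating it
-- so that its last key hashes to 0 (this loses a factor 1 + i, as any of its
-- slots may be the one met first), gives
--   D_(t+1) ≤ Σ_{i+j=t} binom(t+1, i+1) (i+1) D_i D_j,
-- so D_t ≤ t! C_t with C_t the Catalan number.  If an insertion costs more than k,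
-- its path meets clusters with a total of t ≥ k keys, and the other m - t keys hash
-- outside these t slots; so, with α = m/n, the probability is at most
--   Σ_{t≥k} C_t m(m-1)⋯(m-t+1) (n-t)^(m-t) / n^m ≤ Σ_{t≥k} 4 (4α(1-1/n)^m)^t
-- as soon as α ≤ 1/2.  Since (1-1/n)^m ≤ e^(-α), this is a geometric tail with
-- ratio 4αe^(-α) < 1.  For small k the bound Pr[X > k] ≤ α ≤ 1/2, k ≥ 1, is used.

module Submission where

-- Insertion depends on the order of the keys, and deleting a key can redirect every later one.
-- Clusters are the parts that can be detached safely: `Separated` ensures that each part behaves in
-- the merged table as it would alone, so that the counts for the clusters and for the remaining
-- keys multiply.
--
-- Outside keys are counted by their home slots alone, which gives (n-t)^(m-t). Bounding
-- m(m-1)⋯(m-t+1) by m^t would then leave (1-t/n)^(m-t), whereas the ratio 4αe^(-α) requires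
-- (1-t/n)^m. The missing t factors come from the decay of the falling factorial itself, by AM-GM,
-- and this step relies on α ≤ 1/2.
--
-- Real numbers enter only at the two ends: α and α* are replaced by rational approximations, and
-- the margin must not depend on n. Instead of the monotonicity of αe^(-α), the proof compares
-- slopes: 4x grows at rate 4, while e^x grows at rate below 3 on the relevant interval.

open import Defs

-- Covering lists, interleavings and Catalan numbers.

module Counting where

  open import Data.Empty using (⊥-elim)
  open import Data.List using (List; []; _∷_; _++_; length; map; concatMap)
  open import Data.List.Properties using (length-++; length-map)
  open import Data.List.Membership.Propositional using (_∈_)
  open import Data.List.Membership.Propositional.Properties
    using (∈-∃++; ∈-++⁺ˡ; ∈-++⁺ʳ; ∈-++⁻; ∈-map⁺; ∈-concatMap⁺)
  open import Data.List.Relation.Ternary.Interleaving.Propositional using (Interleaving; []; consˡ; consʳ)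
  open import Data.List.Relation.Unary.All as All using (All)
  open import Data.List.Relation.Unary.AllPairs using ([]; _∷_)
  open import Data.List.Relation.Unary.Any as Any using (here; there)
  open import Data.List.Relation.Unary.Unique.Propositional using (Unique)
  open import Data.Nat using (ℕ; zero; suc; _+_; _*_; _^_; _!; _≤_; z≤n; s≤s)
  open import Data.Nat.Properties hiding (_≟_)
  open import Data.Nat.Solver using (module +-*-Solver)
  open import Data.Product using (Σ; ∃; ∃₂; _×_; _,_; proj₁; proj₂)
  open import Data.Sum using (_⊎_; inj₁; inj₂)
  open import Function using (_∘_)
  open import Relation.Binary.PropositionalEquality
  open import Relation.Nullary using (¬_; Dec; yes; no)

  unique-⊆-length : {A : Set} {xs ys : List A} → Unique xs → (∀ {x} → x ∈ xs → x ∈ ys) →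
                    length xs ≤ length ys
  unique-⊆-length {xs = []} _ _ = z≤n
  unique-⊆-length {xs = x ∷ xs} (x∉xs ∷ uniq) sub with ∈-∃++ (sub (here refl))
  ... | as , bs , refl = subst (suc (length xs) ≤_) (sym shift)
          (s≤s (unique-⊆-length {ys = as ++ bs} uniq sub′))
    where
    shift : length (as ++ x ∷ bs) ≡ suc (length (as ++ bs))
    shift = trans (length-++ as) (trans (+-suc (length as) (length bs)) (cong suc (sym (length-++ as))))
    sub′ : ∀ {y} → y ∈ xs → y ∈ as ++ bs
    sub′ y∈xs with ∈-++⁻ as (sub (there y∈xs))
    ... | inj₁ y∈as         = ∈-++⁺ˡ y∈as
    ... | inj₂ (here refl)  = ⊥-elim (All.lookup x∉xs y∈xs refl)
    ... | inj₂ (there y∈bs) = ∈-++⁺ʳ as y∈bs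

  AtMost : {X : Set} → (X → Set) → ℕ → Set
  AtMost {X} P c = Σ (List X) λ L → (∀ {x} → P x → x ∈ L) × length L ≤ c

  module _ {X : Set} where

    atMost-≤ : {P : X → Set} {c d : ℕ} → c ≤ d → AtMost P c → AtMost P d
    atMost-≤ c≤d (L , cov , len) = L , cov , ≤-trans len c≤d

    atMost-∅ : {P : X → Set} {c : ℕ} → (∀ {x} → ¬ P x) → AtMost P c
    atMost-∅ ¬P = [] , (λ Px → ⊥-elim (¬P Px)) , z≤n

    atMost-⊎ : {P Q : X → Set} {c d : ℕ} → AtMost P c → AtMost Q d →
               AtMost (λ x → P x ⊎ Q x) (c + d)
    atMost-⊎ (L , covL , lenL) (M , covM , lenM) =
      L ++ M , (λ { (inj₁ p) → ∈-++⁺ˡ (covL p) ; (inj₂ q) → ∈-++⁺ʳ L (covM q) }) ,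
      subst (_≤ _) (sym (length-++ L)) (+-mono-≤ lenL lenM)

    -- `atMost-Σ` asks for one bound on the fibres over all first components. A bound that holds
    -- only for words of the right length becomes uniform when the length condition is moved into
    -- the fibre as `B`.
    atMost-guard : {B : Set} {P : X → Set} {c : ℕ} → Dec B → (B → AtMost P c) →
                   AtMost (λ x → B × P x) c
    atMost-guard (yes b) f = let L , cov , len = f b in L , (λ (_ , p) → cov p) , len
    atMost-guard (no ¬b) f = atMost-∅ (¬b ∘ proj₁)

    atMost-image : {Y : Set} {P : X → Set} {Q : Y → Set} {c : ℕ} (f : X → Y) →
                   (∀ {y} → Q y → ∃ λ x → P x × f x ≡ y) → AtMost P c → AtMost Q c
    atMost-image f pre (L , cov , len) =
      map f L ,
      (λ Qy → let x , Px , eq = pre Qy in subst (_∈ map f L) eq (∈-map⁺ f (cov Px))) ,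
      subst (_≤ _) (sym (length-map f L)) len

    atMost-⊆ : {P Q : X → Set} {c : ℕ} → (∀ {x} → Q x → P x) → AtMost P c → AtMost Q c
    atMost-⊆ Q⊆P = atMost-image (λ x → x) (λ Qx → _ , Q⊆P Qx , refl)

    atMost-∈ : (xs : List X) → AtMost (_∈ xs) (length xs)
    atMost-∈ xs = xs , (λ p → p) , ≤-refl

    atMost-Σ : {Y : Set} {P : X → Set} {Q : X → Y → Set} {c d : ℕ} → AtMost P c →
               (∀ x → AtMost (Q x) d) → AtMost (λ (xy : X × Y) → P (proj₁ xy) × Q (proj₁ xy) (proj₂ xy)) (c * d)
    atMost-Σ {Y} {P} {Q} {c} {d} (L , cov , len) AQ =
      concatMap row L ,
      (λ { {x , y} (Px , Qxy) → ∈-concatMap⁺ row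
             (Any.map (λ { refl → ∈-map⁺ (x ,_) (proj₁ (proj₂ (AQ x)) Qxy) }) (cov Px)) }) ,
      ≤-trans (rows L) (*-monoˡ-≤ d len)
      where
      row : X → List (X × Y)
      row x = map (x ,_) (proj₁ (AQ x))
      rows : ∀ L → length (concatMap row L) ≤ length L * d
      rows []      = z≤n
      rows (x ∷ L) = subst (_≤ d + length L * d) (sym (length-++ (row x)))
        (+-mono-≤ (subst (_≤ d) (sym (length-map (x ,_) (proj₁ (AQ x)))) (proj₂ (proj₂ (AQ x)))) (rows L))

  -- Σ_{i+j=t} F i j
  splitSum : (ℕ → ℕ → ℕ) → ℕ → ℕ
  splitSum F zero    = F 0 0
  splitSum F (suc t) = F 0 (suc t) + splitSum (F ∘ suc) t

  splitSum-cong : ∀ t {F G : ℕ → ℕ → ℕ} → (∀ i j → i + j ≡ t → F i j ≡ G i j) → splitSum F t ≡ splitSum G t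
  splitSum-cong zero    eq = eq 0 0 refl
  splitSum-cong (suc t) eq = cong₂ _+_ (eq 0 (suc t) refl)
    (splitSum-cong t (λ i j i+j≡t → eq (suc i) j (cong suc i+j≡t)))

  splitSum-*ˡ : ∀ a F t → splitSum (λ i j → a * F i j) t ≡ a * splitSum F t
  splitSum-*ˡ a F zero    = refl
  splitSum-*ˡ a F (suc t) = trans (cong (a * F 0 (suc t) +_) (splitSum-*ˡ a (F ∘ suc) t))
    (sym (*-distribˡ-+ a (F 0 (suc t)) (splitSum (F ∘ suc) t)))

  atMost-splitSum : {X : Set} → ∀ t {P : ℕ → ℕ → X → Set} {F : ℕ → ℕ → ℕ} →
    (∀ i j → i + j ≡ t → AtMost (P i j) (F i j)) →
    AtMost (λ x → ∃₂ λ i j → i + j ≡ t × P i j x) (splitSum F t)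
  atMost-splitSum zero    A = atMost-⊆ (λ { (zero , zero , refl , p) → p }) (A 0 0 refl)
  atMost-splitSum (suc t) A = atMost-⊆
    (λ { (zero , j , refl , p) → inj₁ p ; (suc i , j , eq , p) → inj₂ (i , j , suc-injective eq , p) })
    (atMost-⊎ (A 0 (suc t) refl) (atMost-splitSum t (λ i j eq → A (suc i) j (cong suc eq))))

  -- The binomial coefficient binom(a+b, a); the recursion is Pascal's, by the origin of the first
  -- letter.
  interleavings : ℕ → ℕ → ℕ
  interleavings zero    b       = 1
  interleavings (suc a) zero    = 1
  interleavings (suc a) (suc b) = interleavings a (suc b) + interleavings (suc a) b

  interleavings-! : ∀ a b → interleavings a b * (a ! * b !) ≡ (a + b) !
  interleavings-! zero    b       = trans (+-identityʳ _) (+-identityʳ _)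
  interleavings-! (suc a) zero    = trans (+-identityʳ _) (trans (*-identityʳ _) (cong _! (sym (+-identityʳ (suc a)))))
  interleavings-! (suc a) (suc b) = begin
    (x + y) * ((suc a * a !) * (suc b * b !))
      ≡⟨ solve 6 (λ x y a p b q →
           (x :+ y) :* (((con 1 :+ a) :* p) :* ((con 1 :+ b) :* q)) :=
           (con 1 :+ a) :* (x :* (p :* ((con 1 :+ b) :* q))) :+ (con 1 :+ b) :* (y :* (((con 1 :+ a) :* p) :* q)))
           refl x y a (a !) b (b !) ⟩
    suc a * (x * (a ! * suc b !)) + suc b * (y * (suc a ! * b !))
      ≡⟨ cong₂ (λ p q → suc a * p + suc b * q) (interleavings-! a (suc b)) (interleavings-! (suc a) b) ⟩
    suc a * (a + suc b) ! + suc b * (suc a + b) !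
      ≡⟨ cong (λ z → suc a * z ! + suc b * (suc a + b) !) (+-suc a b) ⟩
    suc a * (suc a + b) ! + suc b * (suc a + b) !
      ≡⟨ sym (*-distribʳ-+ ((suc a + b) !) (suc a) (suc b)) ⟩
    (suc a + suc b) * (suc a + b) !
      ≡⟨ cong (λ z → (suc a + suc b) * z !) (sym (+-suc a b)) ⟩
    (suc a + suc b) ! ∎
    where
    open ≡-Reasoning
    open +-*-Solver
    x = interleavings a (suc b)
    y = interleavings (suc a) b

  atMost-interleaving : {A : Set} (l r : List A) →
    AtMost (λ w → Interleaving l r w) (interleavings (length l) (length r))
  atMost-interleaving [] r = r ∷ [] , (λ {w} i → here (only i)) , s≤s z≤n
    where
    only : ∀ {r w} → Interleaving [] r w → w ≡ r
    only []        = refl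
    only (consʳ i) = cong (_ ∷_) (only i)
  atMost-interleaving l@(_ ∷ _) [] = l ∷ [] , (λ {w} i → here (only i)) , s≤s z≤n
    where
    only : ∀ {l w} → Interleaving l [] w → w ≡ l
    only []        = refl
    only (consˡ i) = cong (_ ∷_) (only i)
  atMost-interleaving (x ∷ l) (y ∷ r) = atMost-⊆
    (λ { (consˡ i) → inj₁ (_ , i , refl) ; (consʳ i) → inj₂ (_ , i , refl) })
    (atMost-⊎ (atMost-image (x ∷_) (λ p → p) (atMost-interleaving l (y ∷ r)))
              (atMost-image (y ∷_) (λ p → p) (atMost-interleaving (x ∷ l) r)))

  -- catalan N t is the t-th Catalan number for t ≤ N: the index N only makes the
  -- convolution recursion structural.
  catalan : ℕ → ℕ → ℕ
  catalan zero    zero    = 1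
  catalan zero    (suc t) = 0
  catalan (suc N) zero    = 1
  catalan (suc N) (suc t) = splitSum (λ i j → catalan N i * catalan N j) t

  -- Σ_{i ≤ T} f i 4^(T-i)
  quarterSum : (ℕ → ℕ) → ℕ → ℕ
  quarterSum f zero    = f 0
  quarterSum f (suc T) = f 0 * 4 ^ suc T + quarterSum (f ∘ suc) T

  quarterSum-last : ∀ f T → quarterSum f (suc T) ≡ 4 * quarterSum f T + f (suc T)
  quarterSum-last f zero    = cong (_+ f 1) (*-comm (f 0) 4)
  quarterSum-last f (suc T) = trans
    (cong (f 0 * 4 ^ suc (suc T) +_) (quarterSum-last (f ∘ suc) T))
    (solve 4 (λ a p s l → a :* (con 4 :* p) :+ (con 4 :* s :+ l) := con 4 :* (a :* p :+ s) :+ l) refl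
      (f 0) (4 ^ suc T) (quarterSum (f ∘ suc) T) (f (suc (suc T))))
    where open +-*-Solver

  quarterSum-+ : ∀ f g T → quarterSum (λ t → f t + g t) T ≡ quarterSum f T + quarterSum g T
  quarterSum-+ f g zero    = refl
  quarterSum-+ f g (suc T) = trans (cong ((f 0 + g 0) * 4 ^ suc T +_) (quarterSum-+ (f ∘ suc) (g ∘ suc) T))
    (solve 5 (λ a b p s t → (a :+ b) :* p :+ (s :+ t) := (a :* p :+ s) :+ (b :* p :+ t)) refl
      (f 0) (g 0) (4 ^ suc T) (quarterSum (f ∘ suc) T) (quarterSum (g ∘ suc) T))
    where open +-*-Solver

  quarterSum-*ˡ : ∀ a g T → quarterSum (λ t → a * g t) T ≡ a * quarterSum g T
  quarterSum-*ˡ a g zero    = refl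
  quarterSum-*ˡ a g (suc T) = trans (cong (a * g 0 * 4 ^ suc T +_) (quarterSum-*ˡ a (g ∘ suc) T))
    (solve 4 (λ a b p s → a :* b :* p :+ a :* s := a :* (b :* p :+ s)) refl
      a (g 0) (4 ^ suc T) (quarterSum (g ∘ suc) T))
    where open +-*-Solver

  -- These are truncated generating functions at z = 1/4, scaled by powers of 4 to stay in ℕ. The
  -- product of two truncations contains every term of the truncated convolution and further
  -- nonnegative ones.
  quarterSum-conv : ∀ f g T →
    4 ^ T * quarterSum (splitSum (λ i j → f i * g j)) T ≤ quarterSum f T * quarterSum g T
  quarterSum-conv f g zero    = ≤-reflexive (*-identityˡ _)
  quarterSum-conv f g (suc T) = begin
    P * quarterSum (splitSum (λ i j → f i * g j)) (suc T)
      ≡⟨ cong (λ z → P * (f 0 * g 0 * P + z))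
           (trans (quarterSum-+ (λ t → f 0 * g (suc t)) c′ T)
                  (cong (_+ C′) (quarterSum-*ˡ (f 0) (g ∘ suc) T))) ⟩
    P * (f 0 * g 0 * P + (f 0 * quarterSum (g ∘ suc) T + C′))
      ≡⟨ solve 6 (λ p q a b s c → p :* (a :* b :* p :+ (a :* s :+ c)) := a :* p :* (b :* p :+ s) :+ p :* c)
           refl P (4 ^ T) (f 0) (g 0) (quarterSum (g ∘ suc) T) C′ ⟩
    f 0 * P * quarterSum g (suc T) + P * C′
      ≡⟨ cong (f 0 * P * quarterSum g (suc T) +_) (*-assoc 4 (4 ^ T) C′) ⟩
    f 0 * P * quarterSum g (suc T) + 4 * (4 ^ T * C′)
      ≤⟨ +-monoʳ-≤ (f 0 * P * quarterSum g (suc T)) (*-monoʳ-≤ 4 (quarterSum-conv (f ∘ suc) g T)) ⟩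
    f 0 * P * quarterSum g (suc T) + 4 * (F′ * quarterSum g T)
      ≡⟨ cong (f 0 * P * quarterSum g (suc T) +_)
           (solve 2 (λ x y → con 4 :* (x :* y) := x :* (con 4 :* y)) refl F′ (quarterSum g T)) ⟩
    f 0 * P * quarterSum g (suc T) + F′ * (4 * quarterSum g T)
      ≤⟨ +-monoʳ-≤ (f 0 * P * quarterSum g (suc T)) (*-monoʳ-≤ F′
           (subst (4 * quarterSum g T ≤_) (sym (quarterSum-last g T)) (m≤m+n _ _))) ⟩
    f 0 * P * quarterSum g (suc T) + F′ * quarterSum g (suc T)
      ≡⟨ sym (*-distribʳ-+ (quarterSum g (suc T)) (f 0 * P) F′) ⟩
    quarterSum f (suc T) * quarterSum g (suc T) ∎
    where
    open ≤-Reasoning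
    open +-*-Solver
    P = 4 ^ suc T
    c′ = splitSum (λ i j → f (suc i) * g j)
    C′ = quarterSum c′ T
    F′ = quarterSum (f ∘ suc) T

  -- The generating function C of the Catalan numbers satisfies C = 1 + zC², and
  -- C(1/4) ≤ 2 because 1 + 2²/4 = 2.
  quarterSum-catalan : ∀ N T → quarterSum (catalan N) T ≤ 2 * 4 ^ T
  quarterSum-catalan zero    zero    = s≤s z≤n
  quarterSum-catalan zero    (suc T) = subst₂ _≤_
    (sym (trans (cong (1 * 4 ^ suc T +_) (zeros T)) (trans (+-identityʳ _) (*-identityˡ (4 ^ suc T))))) refl
    (m≤m+n (4 ^ suc T) _)
    where
    zeros : ∀ T → quarterSum (λ _ → 0) T ≡ 0
    zeros zero    = refl
    zeros (suc T) = zeros T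
  quarterSum-catalan (suc N) zero    = s≤s z≤n
  quarterSum-catalan (suc N) (suc T) = begin
    1 * 4 ^ suc T + Q    ≤⟨ +-monoʳ-≤ (1 * 4 ^ suc T) Q≤ ⟩
    1 * 4 ^ suc T + 4 ^ suc T ≡⟨ solve 1 (λ p → con 1 :* p :+ p := con 2 :* p) refl (4 ^ suc T) ⟩
    2 * 4 ^ suc T        ∎
    where
    open ≤-Reasoning
    open +-*-Solver
    Q = quarterSum (splitSum (λ i j → catalan N i * catalan N j)) T
    Q≤ : Q ≤ 4 ^ suc T
    Q≤ = *-cancelˡ-≤ (4 ^ T) {{m^n≢0 4 T}} (begin
      4 ^ T * Q                                          ≤⟨ quarterSum-conv (catalan N) (catalan N) T ⟩
      quarterSum (catalan N) T * quarterSum (catalan N) T ≤⟨ *-mono-≤ (quarterSum-catalan N T) (quarterSum-catalan N T) ⟩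
      2 * 4 ^ T * (2 * 4 ^ T)                            ≡⟨ solve 1 (λ p → con 2 :* p :* (con 2 :* p) := p :* (con 4 :* p)) refl (4 ^ T) ⟩
      4 ^ T * 4 ^ suc T                                  ∎)

  -- A coefficient is at most the partial sum that ends with it, in which its weight is 1.
  catalan-bound : ∀ N t → catalan N t ≤ 2 * 4 ^ t
  catalan-bound N t = ≤-trans (last≤ (catalan N) t) (quarterSum-catalan N t)
    where
    last≤ : ∀ f t → f t ≤ quarterSum f t
    last≤ f zero    = ≤-refl
    last≤ f (suc t) = ≤-trans (last≤ (f ∘ suc) t) (m≤n+m _ _)

-- Clusters of the probing process.

module Clusters where

  open Counting
  open import Data.Fin using (Fin; toℕ)
  import Data.Fin.Properties as Finₚ
  open import Data.List using (List; []; _∷_; _++_; length; map; filter; allFin)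
  open import Data.List.Properties using (length-++; length-map; length-tabulate; map-∘; map-cong)
  open import Data.List.Membership.Propositional using (_∈_; _∉_)
  open import Data.List.Membership.Propositional.Properties
    using (∈-map⁺; ∈-map⁻; ∈-filter⁺; ∈-filter⁻; ∈-allFin)
  open import Data.List.Relation.Ternary.Interleaving.Propositional using (Interleaving; []; consˡ; consʳ)
  open import Data.List.Relation.Unary.All as All using (All; []; _∷_)
  open import Data.List.Relation.Unary.All.Properties using (¬Any⇒All¬)
  open import Data.List.Relation.Unary.AllPairs using ([]; _∷_)
  open import Data.List.Relation.Unary.Any as Any using (here; there)
  open import Data.List.Relation.Unary.Unique.Propositional using (Unique)
  import Data.List.Relation.Unary.Unique.Propositional.Properties as Uniqueₚ
  open import Data.Maybe as Maybe using (Maybe; just; nothing; maybe)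
  open import Data.Nat using (ℕ; zero; suc; _+_; _*_; _∸_; _^_; _!; _≤_; _<_; z≤n; s≤s; NonZero)
  import Data.Nat as ℕ
  open import Data.Nat.DivMod using (_mod_; _%_; m%n<n; %-distribˡ-+; m%n%n≡m%n; m<n⇒m%n≡m; n%n≡0)
  open import Data.Nat.Properties hiding (_≟_)
  open import Data.Nat.Solver using (module +-*-Solver)
  open import Data.Product using (Σ; ∃; ∃₂; _×_; _,_; proj₂)
  open import Data.Sum using (_⊎_; inj₁; inj₂; [_,_]′)
  open import Function using (_∘_; id)
  open import Relation.Binary.PropositionalEquality
  open import Relation.Nullary.Decidable using (_×-dec_)
  open import Relation.Nullary using (yes; no; ¬?; contradiction)

  module Cyclic (n : ℕ) .{{_ : NonZero n}} where

    infixl 6 _⊕_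
    _⊕_ : Fin n → Fin n → Fin n
    x ⊕ y = (toℕ x + toℕ y) mod n

    ⊖_ : Fin n → Fin n
    ⊖ x = (n ∸ toℕ x) mod n

    𝟘 : Fin n
    𝟘 = 0 mod n

    toℕ-mod : ∀ a → toℕ (a mod n) ≡ a % n
    toℕ-mod a = Finₚ.toℕ-fromℕ< (m%n<n a n)

    %-absorbˡ : ∀ a b → (a % n + b) % n ≡ (a + b) % n
    %-absorbˡ a b = trans (%-distribˡ-+ (a % n) b n)
      (trans (cong (λ z → (z + b % n) % n) (m%n%n≡m%n a n)) (sym (%-distribˡ-+ a b n)))

    mod-⊕ : ∀ a y → (a mod n) ⊕ y ≡ (a + toℕ y) mod n
    mod-⊕ a y = Finₚ.toℕ-injective (trans (toℕ-mod (toℕ (a mod n) + toℕ y))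
      (trans (cong (λ z → (z + toℕ y) % n) (toℕ-mod a))
        (trans (%-absorbˡ a (toℕ y)) (sym (toℕ-mod (a + toℕ y))))))

    toℕ-mod-id : ∀ (x : Fin n) → toℕ x mod n ≡ x
    toℕ-mod-id x = Finₚ.toℕ-injective (trans (toℕ-mod (toℕ x)) (m<n⇒m%n≡m (Finₚ.toℕ<n x)))

    ⊕-comm : ∀ x y → x ⊕ y ≡ y ⊕ x
    ⊕-comm x y = cong (λ z → z mod n) (+-comm (toℕ x) (toℕ y))

    ⊕-assoc : ∀ x y z → (x ⊕ y) ⊕ z ≡ x ⊕ (y ⊕ z)
    ⊕-assoc x y z = trans (mod-⊕ (toℕ x + toℕ y) z)
      (trans (cong (λ z → z mod n) (trans (+-assoc (toℕ x) (toℕ y) (toℕ z)) (+-comm (toℕ x) (toℕ y + toℕ z))))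
        (trans (sym (mod-⊕ (toℕ y + toℕ z) x)) (⊕-comm (y ⊕ z) x)))

    ⊕-identityʳ : ∀ x → x ⊕ 𝟘 ≡ x
    ⊕-identityʳ x = trans (⊕-comm x 𝟘) (trans (mod-⊕ 0 x) (toℕ-mod-id x))

    ⊖-inverseˡ : ∀ x → ⊖ x ⊕ x ≡ 𝟘
    ⊖-inverseˡ x = trans (mod-⊕ (n ∸ toℕ x) x)
      (Finₚ.toℕ-injective (trans (toℕ-mod (n ∸ toℕ x + toℕ x))
        (trans (cong (_% n) (m∸n+n≡m (<⇒≤ (Finₚ.toℕ<n x))))
          (trans (n%n≡0 n) (sym (trans (toℕ-mod 0) 0%n≡0))))))
      where
      0%n≡0 : 0 % n ≡ 0
      0%n≡0 = m<n⇒m%n≡m (≤-trans (s≤s z≤n) (Finₚ.toℕ<n x))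

    cancelˡ : ∀ c x → ⊖ c ⊕ (c ⊕ x) ≡ x
    cancelˡ c x = trans (sym (⊕-assoc (⊖ c) c x))
      (trans (cong (_⊕ x) (⊖-inverseˡ c)) (trans (⊕-comm 𝟘 x) (⊕-identityʳ x)))

    ⊖-cancelˡ : ∀ c x → c ⊕ (⊖ c ⊕ x) ≡ x
    ⊖-cancelˡ c x = trans (sym (⊕-assoc c (⊖ c) x))
      (trans (cong (_⊕ x) (trans (⊕-comm c (⊖ c)) (⊖-inverseˡ c))) (trans (⊕-comm 𝟘 x) (⊕-identityʳ x)))

    ⊕-injective : ∀ c {x y} → c ⊕ x ≡ c ⊕ y → x ≡ y
    ⊕-injective c {x} {y} eq = trans (sym (cancelˡ c x)) (trans (cong (⊖ c ⊕_) eq) (cancelˡ c y))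

    infixl 6 _⊝_
    _⊝_ : Fin n → Fin n → Fin n
    p ⊝ q = ⊖ q ⊕ p

    ⊝-unique : ∀ {c q p} → c ⊕ q ≡ p → p ⊝ q ≡ c
    ⊝-unique {c} {q} refl = trans (cong (⊖ q ⊕_) (⊕-comm c q)) (cancelˡ q c)

  atMost-words : {A : Set} {P : A → Set} {c : ℕ} → AtMost P c → ∀ j →
                 AtMost (λ w → length w ≡ j × All P w) (c ^ j)
  atMost-words A zero    = ([] ∷ []) , (λ { {[]} _ → here refl }) , s≤s z≤n
  atMost-words A (suc j) = atMost-image (λ (v , w) → v ∷ w)
    (λ { {v ∷ w} (len , Pv ∷ Pw) → (v , w) , (Pv , suc-injective len , Pw) , refl })
    (atMost-Σ A (λ _ → atMost-words A j))

  length-interleaving : {A : Set} {l r w : List A} → Interleaving l r w → length w ≡ length l + length r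
  length-interleaving []                   = refl
  length-interleaving (consˡ i)            = cong suc (length-interleaving i)
  length-interleaving {l = l} {_ ∷ r} (consʳ i) = trans (cong suc (length-interleaving i)) (sym (+-suc (length l) (length r)))

  map-interleaving : {A B : Set} (f : A → B) {l r w : List A} → Interleaving l r w →
                     Interleaving (map f l) (map f r) (map f w)
  map-interleaving f []        = []
  map-interleaving f (consˡ i) = consˡ (map-interleaving f i)
  map-interleaving f (consʳ i) = consʳ (map-interleaving f i)

  -- Bounds the number of words of length i + j of which i keys form the clusters
  -- met by a further key with a given hash value, in a table with n slots.
  clusterBound : ℕ → ℕ → ℕ → ℕ
  clusterBound n i j = i ! * catalan i i * (n ∸ i) ^ j * interleavings i j

  -- A word lists the hash values of the inserted keys, the latest key first.
  module Words {n : ℕ} .{{_ : NonZero n}} (r₀ : Fin n) (rs : List (Fin n))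
               (offsets-unique : Unique (r₀ ∷ rs)) (offsets-length : length (r₀ ∷ rs) ≡ n) where

    open Cyclic n
    open import Data.List.Membership.DecPropositional (Finₚ._≟_ {n}) using (_∈?_)

    Pos : Set
    Pos = Fin n

    path : Pos → List Pos
    path v = map (v ⊕_) (r₀ ∷ rs)

    home : Pos → Pos
    home v = v ⊕ r₀

    length-path : ∀ v → length (path v) ≡ n
    length-path v = trans (length-map (v ⊕_) (r₀ ∷ rs)) offsets-length

    path-unique : ∀ v → Unique (path v)
    path-unique v = Uniqueₚ.map⁺ (⊕-injective v) offsets-unique

    path-⊕ : ∀ c v → path (c ⊕ v) ≡ map (c ⊕_) (path v)
    path-⊕ c v = trans (map-cong (⊕-assoc c v) (r₀ ∷ rs)) (map-∘ (r₀ ∷ rs))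

    firstFree : List Pos → List Pos → Maybe Pos
    firstFree X []      = nothing
    firstFree X (p ∷ σ) with p ∈? X
    ... | yes _ = firstFree X σ
    ... | no  _ = just p

    -- Only occupancy influences later insertions, so the table is reduced to the list of its
    -- occupied slots.
    run : List Pos → List Pos
    run []      = []
    run (v ∷ w) = maybe (_∷ run w) (run w) (firstFree (run w) (path v))

    data FirstFree (X : List Pos) : List Pos → Pos → Set where
      here  : ∀ {s σ} → s ∉ X → FirstFree X (s ∷ σ) s
      there : ∀ {p s σ} → p ∈ X → FirstFree X σ s → FirstFree X (p ∷ σ) s

    firstFree-complete : ∀ {X σ s} → FirstFree X σ s → firstFree X σ ≡ just s
    firstFree-complete {X} {p ∷ _} (here s∉X) with p ∈? X
    ... | yes p∈X = contradiction p∈X s∉X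
    ... | no  _   = refl
    firstFree-complete {X} {p ∷ _} (there p∈X f) with p ∈? X
    ... | yes _   = firstFree-complete f
    ... | no  p∉X = contradiction p∈X p∉X

    firstFree-sound : ∀ X σ → (∃ λ s → firstFree X σ ≡ just s × FirstFree X σ s) ⊎
                              (firstFree X σ ≡ nothing × (∀ {p} → p ∈ σ → p ∈ X))
    firstFree-sound X []      = inj₂ (refl , λ ())
    firstFree-sound X (p ∷ σ) with p ∈? X
    ... | no  p∉X = inj₁ (p , refl , here p∉X)
    ... | yes p∈X with firstFree-sound X σ
    ...   | inj₁ (s , eq , f) = inj₁ (s , eq , there p∈X f)
    ...   | inj₂ (eq , all)   = inj₂ (eq , λ { (here refl) → p∈X ; (there q) → all q })

    firstFree-∉ : ∀ {X σ s} → FirstFree X σ s → s ∉ X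
    firstFree-∉ (here s∉X)  = s∉X
    firstFree-∉ (there _ f) = firstFree-∉ f

    firstFree-⊆ : ∀ {X Y σ s} → (∀ {p} → p ∈ X → p ∈ Y) → s ∉ Y → FirstFree X σ s → FirstFree Y σ s
    firstFree-⊆ X⊆Y s∉Y (here _)      = here s∉Y
    firstFree-⊆ X⊆Y s∉Y (there p∈X f) = there (X⊆Y p∈X) (firstFree-⊆ X⊆Y s∉Y f)

    firstFree-exists : ∀ X v → length X < n → ∃ λ s → FirstFree X (path v) s
    firstFree-exists X v X<n with firstFree-sound X (path v)
    ... | inj₁ (s , _ , f) = s , f
    ... | inj₂ (_ , full)  = contradiction
      (subst (_≤ length X) (length-path v) (unique-⊆-length (path-unique v) full)) (<⇒≱ X<n)

    run-∷ : ∀ {v s} w → FirstFree (run w) (path v) s → run (v ∷ w) ≡ s ∷ run w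
    run-∷ w f = cong (maybe (_∷ run w) (run w)) (firstFree-complete f)

    length-run : ∀ w → length (run w) ≤ length w
    length-run []      = z≤n
    length-run (v ∷ w) with firstFree (run w) (path v)
    ... | just _  = s≤s (length-run w)
    ... | nothing = m≤n⇒m≤1+n (length-run w)

    run-unique : ∀ w → Unique (run w)
    run-unique []      = []
    run-unique (v ∷ w) with firstFree-sound (run w) (path v)
    ... | inj₁ (s , eq , f) rewrite eq = ¬Any⇒All¬ (run w) (firstFree-∉ f) ∷ run-unique w
    ... | inj₂ (eq , _)     rewrite eq = run-unique w

    -- The two subwords fill disjoint parts of the table without ever probing an
    -- occupied slot of the other part.
    data Separated : List Pos → List Pos → List Pos → Set where
      []    : Separated [] [] []
      left  : ∀ {v s w₁ w₂ w} → FirstFree (run w₁) (path v) s → s ∉ run w₂ →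
              Separated w₁ w₂ w → Separated (v ∷ w₁) w₂ (v ∷ w)
      right : ∀ {v s w₁ w₂ w} → FirstFree (run w₂) (path v) s → s ∉ run w₁ →
              Separated w₁ w₂ w → Separated w₁ (v ∷ w₂) (v ∷ w)

    separated-swap : ∀ {w₁ w₂ w} → Separated w₁ w₂ w → Separated w₂ w₁ w
    separated-swap []           = []
    separated-swap (left f n S)  = right f n (separated-swap S)
    separated-swap (right f n S) = left f n (separated-swap S)

    separated⇒interleaving : ∀ {w₁ w₂ w} → Separated w₁ w₂ w → Interleaving w₁ w₂ w
    separated⇒interleaving []            = []
    separated⇒interleaving (left _ _ S)  = consˡ (separated⇒interleaving S)
    separated⇒interleaving (right _ _ S) = consʳ (separated⇒interleaving S)

    ∈-∷-run : ∀ {v s p} w → FirstFree (run w) (path v) s → p ∈ run (v ∷ w) → p ≡ s ⊎ p ∈ run w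
    ∈-∷-run {p = p} w f p∈ with subst (p ∈_) (run-∷ w f) p∈
    ... | here p≡s   = inj₁ p≡s
    ... | there p∈w = inj₂ p∈w

    ∈-run-there : ∀ {v s p} w → FirstFree (run w) (path v) s → p ∈ run w → p ∈ run (v ∷ w)
    ∈-run-there {p = p} w f p∈ = subst (p ∈_) (sym (run-∷ w f)) (there p∈)

    ∈-run-here : ∀ {v s} w → FirstFree (run w) (path v) s → s ∈ run (v ∷ w)
    ∈-run-here {s = s} w f = subst (s ∈_) (sym (run-∷ w f)) (here refl)

    mutual

      -- The occupied set of `w` is the union of those of its parts, and hence a key finds the same
      -- slot in the merged table as in its own part. The two facts need each other: the union at
      -- `v ∷ w` uses the slot found in the shorter word `w`.
      ∈-left : ∀ {w₁ w₂ w p} → Separated w₁ w₂ w → p ∈ run w₁ → p ∈ run w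
      ∈-left S@(left {w₁ = w₁} {w = w} f s∉ S′) p∈ with ∈-∷-run w₁ f p∈
      ... | inj₁ refl = ∈-run-here w (free-left S′ f s∉)
      ... | inj₂ p∈₁  = ∈-run-there w (free-left S′ f s∉) (∈-left S′ p∈₁)
      ∈-left (right {w = w} f s∉ S) p∈ = ∈-run-there w (free-left (separated-swap S) f s∉) (∈-left S p∈)

      ∈-split : ∀ {w₁ w₂ w p} → Separated w₁ w₂ w → p ∈ run w → p ∈ run w₁ ⊎ p ∈ run w₂
      ∈-split (left {w₁ = w₁} {w = w} f s∉ S) p∈ with ∈-∷-run w (free-left S f s∉) p∈
      ... | inj₁ refl = inj₁ (∈-run-here w₁ f)
      ... | inj₂ p∈w  = [ inj₁ ∘ ∈-run-there w₁ f , inj₂ ]′ (∈-split S p∈w)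
      ∈-split (right {w₂ = w₂} {w = w} f s∉ S) p∈ with ∈-∷-run w (free-left (separated-swap S) f s∉) p∈
      ... | inj₁ refl = inj₂ (∈-run-here w₂ f)
      ... | inj₂ p∈w  = [ inj₁ , inj₂ ∘ ∈-run-there w₂ f ]′ (∈-split S p∈w)

      free-left : ∀ {v s w₁ w₂ w} → Separated w₁ w₂ w → FirstFree (run w₁) (path v) s → s ∉ run w₂ →
                  FirstFree (run w) (path v) s
      free-left S f s∉₂ = firstFree-⊆ (∈-left S) ([ firstFree-∉ f , s∉₂ ]′ ∘ ∈-split S) f

    ∈-right : ∀ {w₁ w₂ w p} → Separated w₁ w₂ w → p ∈ run w₂ → p ∈ run w
    ∈-right S = ∈-left (separated-swap S)

    separated-disjoint : ∀ {w₁ w₂ w p} → Separated w₁ w₂ w → p ∈ run w₁ → p ∉ run w₂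
    separated-disjoint (left {w₁ = w₁} f s∉ S) p∈₁ p∈₂ with ∈-∷-run w₁ f p∈₁
    ... | inj₁ refl = s∉ p∈₂
    ... | inj₂ p∈   = separated-disjoint S p∈ p∈₂
    separated-disjoint (right {w₂ = w₂} f s∉ S) p∈₁ p∈₂ with ∈-∷-run w₂ f p∈₂
    ... | inj₁ refl = s∉ p∈₁
    ... | inj₂ p∈   = separated-disjoint S p∈₁ p∈

    separated-length : ∀ {w₁ w₂ w} → Separated w₁ w₂ w → length (run w₁) ≡ length w₁
    separated-length []                          = refl
    separated-length (left {w₁ = w₁} f _ S)      = trans (cong length (run-∷ w₁ f)) (cong suc (separated-length S))
    separated-length (right _ _ S)               = separated-length S

    -- After a key of `w₂` is inserted, its home slot is occupied within `w₂`, by this key or an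
    -- earlier one, and the two runs are disjoint. This is the only constraint kept when the keys
    -- outside the clusters are counted.
    separated-avoids : ∀ {w₁ w₂ w} → Separated w₁ w₂ w → All (λ v → home v ∉ run w₁) w₂
    separated-avoids S = All.map (λ h∈₂ h∈₁ → separated-disjoint S h∈₁ h∈₂) (homes S)
      where
      home∈ : ∀ {v s} w → FirstFree (run w) (path v) s → home v ∈ run (v ∷ w)
      home∈ w f@(here _)     = ∈-run-here w f
      home∈ w f@(there h∈ _) = ∈-run-there w f h∈
      homes : ∀ {w₁ w₂ w} → Separated w₁ w₂ w → All (λ v → home v ∈ run w₂) w₂
      homes []                      = []
      homes (left _ _ S)            = homes S
      homes (right {w₂ = w₂} f _ S) = home∈ w₂ f ∷ All.map (∈-run-there w₂ f) (homes S)

    firstFree-unique : ∀ {X σ s t} → FirstFree X σ s → FirstFree X σ t → s ≡ t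
    firstFree-unique (here _)    (here _)    = refl
    firstFree-unique (here s∉)   (there s∈ _) = contradiction s∈ s∉
    firstFree-unique (there s∈ _) (here s∉)  = contradiction s∈ s∉
    firstFree-unique (there _ f) (there _ g) = firstFree-unique f g

    -- Separation amounts to a condition on each pair of parts, so three parts can be regrouped.
    -- Exploration uses this to join the cluster just found with those met later on the path.
    separated-assoc : ∀ {a b c bc w} → Separated a bc w → Separated b c bc →
                      ∃ λ ab → Separated ab c w × Separated a b ab
    separated-assoc [] [] = [] , [] , []
    separated-assoc (left f s∉ S) T =
      let ab , S′ , T′ = separated-assoc S T
          s∉b = λ s∈ → s∉ (∈-left T s∈)
          s∉c = λ s∈ → s∉ (∈-right T s∈)
      in _ , left (free-left T′ f s∉b) s∉c S′ , left f s∉b T′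
    -- The key belongs to `b`. Its slot within `bc` and its slot within `b` coincide, because `b`
    -- behaves in `bc` as it does alone.
    separated-assoc (right f s∉ S) (left {w₁ = b} g t∉ T)
      with refl ← firstFree-unique f (free-left T g t∉) =
      let ab , S′ , T′ = separated-assoc S T
      in _ , left (free-left (separated-swap T′) g s∉) t∉ S′ , right g s∉ T′
    separated-assoc (right f s∉ S) (right {w₂ = c} g t∉ T)
      with refl ← firstFree-unique f (free-left (separated-swap T) g t∉) =
      let ab , S′ , T′ = separated-assoc S T
      in ab , right g ([ s∉ , t∉ ]′ ∘ ∈-split T′) S′ , T′

    separated-[]ˡ : ∀ w → length w ≤ n → Separated [] w w
    separated-[]ˡ []      _   = []
    separated-[]ˡ (v ∷ w) w≤n = right (proj₂ (firstFree-exists (run w) v (≤-<-trans (length-run w) w≤n)))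
      (λ ()) (separated-[]ˡ w (<⇒≤ w≤n))

    -- Splitting a word into the clusters met by a path and the rest.

    infixl 5 _∖_
    _∖_ : List Pos → List Pos → List Pos
    σ ∖ X = filter (λ p → ¬? (p ∈? X)) σ

    -- Component w says that, inserted into an empty table, the keys of w fill a
    -- single cluster: the last key's path visits clusters until it has met all of
    -- them.  Explored w σ says that the clusters met along σ contain all keys of w.
    mutual

      data Component : List Pos → Set where
        root : ∀ {v w} → Explored w (path v) → Component (v ∷ w)

      data Explored : List Pos → List Pos → Set where
        none : ∀ {σ} → Explored [] σ
        next : ∀ {w₁ w₂ w p σ} → Component w₁ → p ∈ run w₁ → Explored w₂ (σ ∖ run w₁) →
               Interleaving w₁ w₂ w → Explored w (p ∷ σ)

    -- Every entry of σ before the first one outside Y lies in X.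
    data Exhausts (X Y : List Pos) : List Pos → Set where
      end  : Exhausts X Y []
      free : ∀ {s σ} → s ∉ Y → Exhausts X Y (s ∷ σ)
      skip : ∀ {p σ} → p ∈ X → Exhausts X Y σ → Exhausts X Y (p ∷ σ)

    -- A new key cannot distinguish the full table from the table that holds only the clusters on
    -- its path: both offer it the same first free slot.
    exhausts-free : ∀ {X Y σ s} → (∀ {p} → p ∈ X → p ∈ Y) → Exhausts X Y σ → FirstFree Y σ s → FirstFree X σ s
    exhausts-free X⊆Y (free s∉)   (here _)     = here (s∉ ∘ X⊆Y)
    exhausts-free X⊆Y (free s∉)   (there p∈ _) = contradiction p∈ s∉
    exhausts-free X⊆Y (skip p∈ _) (here s∉)    = contradiction (X⊆Y p∈) s∉
    exhausts-free X⊆Y (skip p∈ e) (there _ f)  = there p∈ (exhausts-free X⊆Y e f)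

    -- Carries the exploration of a path from which the slots `X` of the cluster just found were
    -- deleted back to the whole path: deleted entries lie in `X`, and the others are covered by
    -- `X′`.
    exhausts-∖ : ∀ {X X′ Y Y′ Z} σ → (∀ {p} → p ∈ X → p ∈ Z) → (∀ {p} → p ∈ X′ → p ∈ Z) →
                 (∀ {p} → p ∈ Y → p ∈ X ⊎ p ∈ Y′) →
                 Exhausts X′ Y′ (σ ∖ X) → Exhausts Z Y σ
    exhausts-∖ []      X⊆ X′⊆ Y⊆ e = end
    exhausts-∖ {X} (p ∷ σ) X⊆ X′⊆ Y⊆ e with p ∈? X
    ... | yes p∈X = skip (X⊆ p∈X) (exhausts-∖ σ X⊆ X′⊆ Y⊆ e)
    exhausts-∖ (p ∷ σ) X⊆ X′⊆ Y⊆ (free p∉)   | no p∉X = free ([ p∉X , p∉ ]′ ∘ Y⊆)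
    exhausts-∖ (p ∷ σ) X⊆ X′⊆ Y⊆ (skip p∈ e) | no p∉X = skip (X′⊆ p∈) (exhausts-∖ σ X⊆ X′⊆ Y⊆ e)

    mutual

      -- A greedy search: if the first slot of the path is occupied, its cluster is split off, and
      -- the other keys are explored along what remains of the path; a free slot ends the search.
      -- `N` bounds the number of keys and decreases around every cycle of the mutual recursion.
      explore : ∀ N w → length w ≤ N → length w ≤ n → ∀ σ → ∃₂ λ w₁ w₂ →
                Separated w₁ w₂ w × Explored w₁ σ × Exhausts (run w₁) (run w) σ
      explore N w w≤N w≤n [] = [] , w , separated-[]ˡ w w≤n , none , end
      explore N w w≤N w≤n (p ∷ σ) with p ∈? run w
      ... | no p∉ = [] , w , separated-[]ˡ w w≤n , none , free p∉
      explore zero    []      w≤N w≤n (p ∷ σ) | yes ()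
      explore (suc N) w       w≤N w≤n (p ∷ σ) | yes p∈ with component (suc N) w w≤N w≤n p∈
      ... | a , w′ , S , C@(root {w = a′} _) , p∈a =
        let w′<w : suc (length w′) ≤ length w
            w′<w = subst (suc (length w′) ≤_) (sym (length-interleaving (separated⇒interleaving S)))
                     (s≤s (m≤n+m (length w′) (length a′)))
            b , c , T , E , X = explore N w′ (≤-pred (≤-trans w′<w w≤N)) (<⇒≤ (≤-trans w′<w w≤n)) (σ ∖ run a)
            ab , S′ , T′ = separated-assoc S T
        in ab , c , S′ , next C p∈a E (separated⇒interleaving T′) ,
           skip (∈-left T′ p∈a) (exhausts-∖ σ (∈-left T′) (∈-right T′) (∈-split S) X)

      -- The last key `v` merges exactly the clusters met along its path. If `p` is not in the
      -- resulting cluster, it lies in the separated rest, where its cluster is sought recursively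
      -- and then regrouped against everything else.
      component : ∀ N w → length w ≤ N → length w ≤ n → ∀ {p} → p ∈ run w → ∃₂ λ w₁ w₂ →
                  Separated w₁ w₂ w × Component w₁ × p ∈ run w₁
      component (suc N) (v ∷ w) (s≤s w≤N) w<n {p} p∈ =
        let a , b , S , E , X = explore N w w≤N (<⇒≤ w<n) (path v)
            s , f = firstFree-exists (run w) v (≤-<-trans (length-run w) w<n)
            -- `v` takes the same slot when only the clusters `a` are present, so it can be added to
            -- the left part of the separation.
            g = exhausts-free (∈-left S) X f
            S⁺ = left g (firstFree-∉ f ∘ ∈-right S) S
            b≤w = subst (length b ≤_) (sym (length-interleaving (separated⇒interleaving S))) (m≤n+m (length b) (length a))
        in [ (λ p∈a → v ∷ a , b , S⁺ , root E , p∈a)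
           , (λ p∈b → let c , d , T , C , p∈c = component N b (≤-trans b≤w w≤N) (≤-trans b≤w (<⇒≤ w<n)) p∈b
                          d′ , U , _ = separated-assoc S⁺ (separated-swap T)
                      in c , d′ , separated-swap U , C , p∈c)
           ]′ (∈-split S⁺ p∈)

    -- Translation invariance of probing.

    firstFree-map : ∀ c X σ → firstFree (map (c ⊕_) X) (map (c ⊕_) σ) ≡ Maybe.map (c ⊕_) (firstFree X σ)
    firstFree-map c X σ with firstFree-sound X σ
    ... | inj₁ (s , eq , f) rewrite eq = firstFree-complete (shifted f)
      where
      shifted : ∀ {σ s} → FirstFree X σ s → FirstFree (map (c ⊕_) X) (map (c ⊕_) σ) (c ⊕ s)
      shifted (here s∉)    = here λ cs∈ → let x , x∈ , eq = ∈-map⁻ (c ⊕_) cs∈ in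
        s∉ (subst (_∈ X) (sym (⊕-injective c eq)) x∈)
      shifted (there p∈ f) = there (∈-map⁺ (c ⊕_) p∈) (shifted f)
    ... | inj₂ (eq , all) rewrite eq with firstFree-sound (map (c ⊕_) X) (map (c ⊕_) σ)
    ...   | inj₂ (eq′ , _)    = eq′
    ...   | inj₁ (s , _ , f)  = contradiction (full (firstFree-∈ f)) (firstFree-∉ f)
      where
      firstFree-∈ : ∀ {X σ s} → FirstFree X σ s → s ∈ σ
      firstFree-∈ (here _)    = here refl
      firstFree-∈ (there _ f) = there (firstFree-∈ f)
      full : s ∈ map (c ⊕_) σ → s ∈ map (c ⊕_) X
      full s∈ = let x , x∈ , eq = ∈-map⁻ (c ⊕_) s∈ in
        subst (_∈ map (c ⊕_) X) (sym eq) (∈-map⁺ (c ⊕_) (all x∈))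

    run-map : ∀ c w → run (map (c ⊕_) w) ≡ map (c ⊕_) (run w)
    run-map c []      = refl
    run-map c (v ∷ w) = trans
      (cong₂ (λ X σ → maybe (_∷ X) X (firstFree X σ)) (run-map c w) (path-⊕ c v))
      (trans (cong (maybe (_∷ map (c ⊕_) (run w)) (map (c ⊕_) (run w))) (firstFree-map c (run w) (path v)))
        (push (firstFree (run w) (path v))))
      where
      push : ∀ m → maybe (_∷ map (c ⊕_) (run w)) (map (c ⊕_) (run w)) (Maybe.map (c ⊕_) m) ≡
                   map (c ⊕_) (maybe (_∷ run w) (run w) m)
      push (just _) = refl
      push nothing  = refl

    ∖-map : ∀ c σ X → map (c ⊕_) (σ ∖ X) ≡ map (c ⊕_) σ ∖ map (c ⊕_) X
    ∖-map c []      X = refl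
    ∖-map c (p ∷ σ) X with p ∈? X | (c ⊕ p) ∈? map (c ⊕_) X
    ... | yes _  | yes _  = ∖-map c σ X
    ... | no  _  | no  _  = cong (c ⊕ p ∷_) (∖-map c σ X)
    ... | yes p∈ | no cp∉ = contradiction (∈-map⁺ (c ⊕_) p∈) cp∉
    ... | no  p∉ | yes cp∈ = let x , x∈ , eq = ∈-map⁻ (c ⊕_) cp∈ in
      contradiction (subst (_∈ X) (sym (⊕-injective c eq)) x∈) p∉

    mutual

      component-map : ∀ c {w} → Component w → Component (map (c ⊕_) w)
      component-map c (root {v} {w} E) = root (subst (Explored (map (c ⊕_) w)) (sym (path-⊕ c v)) (explored-map c E))

      explored-map : ∀ c {w σ} → Explored w σ → Explored (map (c ⊕_) w) (map (c ⊕_) σ)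
      explored-map c none = none
      explored-map c (next {w₁} {w₂} {p = p} {σ} C p∈ E i) = next (component-map c C)
        (subst (c ⊕ p ∈_) (sym (run-map c w₁)) (∈-map⁺ (c ⊕_) p∈))
        (subst (Explored (map (c ⊕_) w₂)) (trans (∖-map c σ (run w₁)) (cong (map (c ⊕_) σ ∖_) (sym (run-map c w₁)))) (explored-map c E))
        (map-interleaving (c ⊕_) i)

    map-cancel : ∀ c w → map (c ⊕_) (map (⊖ c ⊕_) w) ≡ w
    map-cancel c []      = refl
    map-cancel c (v ∷ w) = cong₂ _∷_ (⊖-cancelˡ c v) (map-cancel c w)

    -- Translate the component so that its last key hashes to 𝟘; the translation
    -- is recovered from the position of p among the occupied slots.
    atMost-component : ∀ {t g} p → AtMost (λ w → length w ≡ t × Explored w (path 𝟘)) g →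
      AtMost (λ w → length w ≡ suc t × Component w × p ∈ run w) (g * suc t)
    atMost-component {t} p A = atMost-image
      (λ (w , q) → (p ⊝ q) ∷ map ((p ⊝ q) ⊕_) w)
      (λ { {v ∷ w} (len , root E , p∈) →
        let len′ = suc-injective len
            w₀ = map (⊖ v ⊕_) w
            lenw₀ = trans (length-map (⊖ v ⊕_) w) len′
            q = ⊖ v ⊕ p
            p⊝q≡v = ⊝-unique (⊖-cancelˡ v p)
            v₀ = trans (cong (⊖ v ⊕_) (sym (⊕-identityʳ v))) (cancelˡ v 𝟘)
        in (w₀ , q) ,
           ((lenw₀ , subst (Explored w₀) (trans (sym (path-⊕ (⊖ v) v)) (cong path (⊖-inverseˡ v))) (explored-map (⊖ v) E)) ,
            (lenw₀ , subst (q ∈_) (trans (sym (run-map (⊖ v) (v ∷ w))) (cong (λ z → run (z ∷ w₀)) (⊖-inverseˡ v)))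
                       (∈-map⁺ (⊖ v ⊕_) p∈))) ,
           cong₂ _∷_ p⊝q≡v (trans (cong (λ z → map (z ⊕_) w₀) p⊝q≡v) (map-cancel v w)) })
      (atMost-Σ A (λ w → atMost-guard (length w ℕ.≟ t) (λ len →
        atMost-≤ (subst (λ z → length (run (𝟘 ∷ w)) ≤ suc z) len (length-run (𝟘 ∷ w))) (atMost-∈ (run (𝟘 ∷ w))))))

    -- Counting words by their clusters.

    catalan-0 : ∀ N → catalan N 0 ≡ 1
    catalan-0 zero    = refl
    catalan-0 (suc N) = refl

    -- The bound is uniform over arbitrary lists `σ`, because the induction must also cover
    -- `σ ∖ run w₁`, the path with the slots of its first cluster deleted, which in general is no
    -- longer the path of a key.
    atMost-explored : ∀ N t → t ≤ N → ∀ σ → AtMost (λ w → length w ≡ t × Explored w σ) (t ! * catalan N t)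
    atMost-explored N zero t≤N σ = subst (AtMost _) (sym (trans (+-identityʳ _) (catalan-0 N)))
      (([] ∷ []) , (λ { {[]} _ → here refl }) , ≤-refl)
    atMost-explored (suc N) (suc t) (s≤s t≤N) []      = atMost-∅ (λ { {[]} (() , _) })
    atMost-explored (suc N) (suc t) (s≤s t≤N) (p ∷ σ) =
      subst (AtMost _) total (atMost-⊆ decompose (atMost-splitSum t split))
      where
      c : ℕ → ℕ
      c = catalan N
      -- The lengths are repeated beside the interleaving so that `atMost-guard` can supply the
      -- bound `interleavings (suc i) j` over every pair of words.
      Parts : ℕ → ℕ → List Pos → Set
      Parts i j w = ∃ λ (ws : (List Pos × List Pos) × List Pos) → let ((w₁ , w₂) , w′) = ws in
        (((length w₁ ≡ suc i × Component w₁ × p ∈ run w₁) ×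
          (length w₂ ≡ j × Explored w₂ (σ ∖ run w₁))) ×
         ((length w₁ ≡ suc i × length w₂ ≡ j) × Interleaving w₁ w₂ w′)) × w′ ≡ w
      decompose : ∀ {w} → length w ≡ suc t × Explored w (p ∷ σ) → ∃₂ λ i j → i + j ≡ t × Parts i j w
      decompose {w} (len , next {v ∷ w₁} {w₂} C p∈ E i) = length w₁ , length w₂ ,
        suc-injective (trans (sym (length-interleaving i)) len) ,
        ((v ∷ w₁ , w₂) , w) , (((refl , C , p∈) , (refl , E)) , ((refl , refl) , i)) , refl
      F : ℕ → ℕ → ℕ
      F i j = i ! * c i * suc i * (j ! * c j) * interleavings (suc i) j
      split : ∀ i j → i + j ≡ t → AtMost (Parts i j) (F i j)
      split i j i+j≡t = atMost-image proj₂ id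
        (atMost-Σ (atMost-Σ (atMost-component p (atMost-explored N i (≤-trans (m+n≤o⇒m≤o i (≤-reflexive i+j≡t)) t≤N) (path 𝟘)))
                            (λ w₁ → atMost-explored N j (≤-trans (m+n≤o⇒n≤o i (≤-reflexive i+j≡t)) t≤N) (σ ∖ run w₁)))
                  (λ (w₁ , w₂) → atMost-guard ((length w₁ ℕ.≟ suc i) ×-dec (length w₂ ℕ.≟ j))
                    (λ { (eq₁ , eq₂) → subst₂ (λ a b → AtMost (Interleaving w₁ w₂) (interleavings a b)) eq₁ eq₂ (atMost-interleaving w₁ w₂) })))
      -- The factor `suc i` from the choice of a slot turns `i !` into `suc i !`; the binomial
      -- coefficient then merges both factorials into `suc t !`, and a Catalan convolution remains.
      total : splitSum F t ≡ suc t ! * splitSum (λ i j → c i * c j) t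
      total = trans (splitSum-cong t (λ i j i+j≡t → trans
        (solve 6 (λ a x s b y I → a :* x :* s :* (b :* y) :* I := I :* (s :* a :* b) :* (x :* y)) refl
          (i !) (c i) (suc i) (j !) (c j) (interleavings (suc i) j))
        (cong (_* (c i * c j)) (trans (interleavings-! (suc i) j) (cong (λ z → suc z !) i+j≡t)))))
        (splitSum-*ˡ (suc t !) (λ i j → c i * c j) t)
        where open +-*-Solver

    -- `home` is injective, so the homes of these hash values together with `X` are distinct slots,
    -- and there are only `n` slots.
    atMost-∉ : ∀ X → Unique X → AtMost (λ v → home v ∉ X) (n ∸ length X)
    atMost-∉ X X-unique = vs , (λ {v} v∉ → ∈-filter⁺ _ (∈-allFin v) v∉) ,
      m+n≤o⇒m≤o∸n (length vs) (subst₂ _≤_ lengths (length-tabulate {n = n} id) (unique-⊆-length all-unique (λ {x} _ → ∈-allFin x)))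
      where
      vs = filter (λ v → ¬? (home v ∈? X)) (allFin n)
      home-injective : ∀ {x y} → home x ≡ home y → x ≡ y
      home-injective {x} {y} eq = ⊕-injective r₀ (trans (⊕-comm r₀ x) (trans eq (⊕-comm y r₀)))
      all-unique : Unique (map home vs ++ X)
      all-unique = Uniqueₚ.++⁺ (Uniqueₚ.map⁺ home-injective (Uniqueₚ.filter⁺ _ (Uniqueₚ.allFin⁺ n))) X-unique
        (λ (p∈ , p∈X) → let v , v∈ , eq = ∈-map⁻ home p∈ in
          proj₂ (∈-filter⁻ _ {xs = allFin n} v∈) (subst (_∈ X) eq p∈X))
      lengths : length (map home vs ++ X) ≡ length vs + length X
      lengths = trans (length-++ (map home vs)) (cong (_+ length X) (length-map home vs))

    -- w₁ consists of the keys in the clusters met by a further key with hash value v.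
    record Cluster (v : Pos) (w₁ w : List Pos) : Set where
      field
        rest        : List Pos
        splits : Interleaving w₁ rest w
        explored    : Explored w₁ (path v)
        full        : length (run w₁) ≡ length w₁
        avoids      : All (λ v → home v ∉ run w₁) rest

    depth : ∀ {X σ s} → FirstFree X σ s → ℕ
    depth (here _)    = 0
    depth (there _ f) = suc (depth f)

    -- The slots probed before `s` are distinct members of `X`.
    depth≤length : ∀ {X σ s} → Unique σ → (f : FirstFree X σ s) → depth f ≤ length X
    depth≤length {X} σ-unique f = subst (_≤ length X) (length-prefix f)
      (unique-⊆-length (prefix-unique f σ-unique) (prefix⊆ f))
      where
      prefix : ∀ {σ s} → FirstFree X σ s → List Pos
      prefix (here _)            = []
      prefix (there {p = p} _ f) = p ∷ prefix f
      length-prefix : ∀ {σ s} (f : FirstFree X σ s) → length (prefix f) ≡ depth f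
      length-prefix (here _)    = refl
      length-prefix (there _ f) = cong suc (length-prefix f)
      prefix⊆ : ∀ {σ s p} (f : FirstFree X σ s) → p ∈ prefix f → p ∈ X
      prefix⊆ (there p∈ f) (here refl) = p∈
      prefix⊆ (there p∈ f) (there q∈)  = prefix⊆ f q∈
      All-prefix : ∀ {P : Pos → Set} {σ s} (f : FirstFree X σ s) → All P σ → All P (prefix f)
      All-prefix (here _)    _         = []
      All-prefix (there _ f) (px ∷ ps) = px ∷ All-prefix f ps
      prefix-unique : ∀ {σ s} (f : FirstFree X σ s) → Unique σ → Unique (prefix f)
      prefix-unique (here _)    _        = []
      prefix-unique (there _ f) (a ∷ as) = All-prefix f a ∷ prefix-unique f as

    -- Up to its free slot the key probes only slots of the clusters it meets, each holding one key.
    -- A long probe sequence therefore forces many keys into these clusters.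
    cluster : ∀ v w → length w < n → ∃ λ w₁ → Cluster v w₁ w ×
              ∃ λ s → s ∉ run w × Σ (FirstFree (run w₁) (path v) s) λ f → depth f ≤ length w₁
    cluster v w w<n =
      let w₁ , w₂ , S , E , X = explore (length w) w ≤-refl (<⇒≤ w<n) (path v)
          s , f = firstFree-exists (run w) v (≤-<-trans (length-run w) w<n)
          g = exhausts-free (∈-left S) X f
      in w₁ ,
         record { rest = w₂ ; splits = separated⇒interleaving S ; explored = E
                ; full = separated-length S ; avoids = separated-avoids S } ,
         s , firstFree-∉ f , g , ≤-trans (depth≤length (path-unique v) g) (length-run w₁)

    -- Here `k + i` keys lie in the clusters and `j` outside. By `full` the clusters occupy exactly
    -- `k + i` slots, which leaves each outside key `n ∸ (k + i)` admissible hash values.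
    atMost-cluster : ∀ v k m → AtMost (λ w → length w ≡ k + m × ∃ λ w₁ → Cluster v w₁ w × k ≤ length w₁)
                                      (splitSum (λ i j → clusterBound n (k + i) j) m)
    atMost-cluster v k m = atMost-⊆ decompose (atMost-splitSum m split)
      where
      Parts : ℕ → ℕ → List Pos → Set
      Parts i j w = ∃ λ (ws : (List Pos × List Pos) × List Pos) → let ((w₁ , w₂) , w′) = ws in
        (((length w₁ ≡ i × Explored w₁ (path v)) ×
          (length (run w₁) ≡ i × length w₂ ≡ j × All (λ v → home v ∉ run w₁) w₂)) ×
         ((length w₁ ≡ i × length w₂ ≡ j) × Interleaving w₁ w₂ w′)) × w′ ≡ w
      decompose : ∀ {w} → length w ≡ k + m × (∃ λ w₁ → Cluster v w₁ w × k ≤ length w₁) →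
                  ∃₂ λ i j → i + j ≡ m × Parts (k + i) j w
      decompose {w} (len , w₁ , C , k≤) = length w₁ ∸ k , length rest , sum ,
        ((w₁ , rest) , w) , (((k+ , explored) , (trans full k+ , refl , avoids)) , ((k+ , refl) , splits)) , refl
        where
        open Cluster C
        k+ : length w₁ ≡ k + (length w₁ ∸ k)
        k+ = sym (m+[n∸m]≡n k≤)
        sum : length w₁ ∸ k + length rest ≡ m
        sum = +-cancelˡ-≡ k _ _ (trans (sym (+-assoc k (length w₁ ∸ k) (length rest)))
          (trans (cong (_+ length rest) (sym k+)) (trans (sym (length-interleaving splits)) len)))
      split : ∀ i j → i + j ≡ m → AtMost (Parts (k + i) j) (clusterBound n (k + i) j)
      split i j _ = atMost-image proj₂ id
        (atMost-Σ (atMost-Σ (atMost-explored (k + i) (k + i) ≤-refl (path v))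
                            (λ w₁ → atMost-guard (length (run w₁) ℕ.≟ k + i) (λ eq →
                              atMost-words (subst (λ z → AtMost (λ v → home v ∉ run w₁) (n ∸ z)) eq (atMost-∉ (run w₁) (run-unique w₁))) j)))
                  (λ (w₁ , w₂) → atMost-guard ((length w₁ ℕ.≟ k + i) ×-dec (length w₂ ℕ.≟ j))
                    (λ { (eq₁ , eq₂) → subst₂ (λ a b → AtMost (Interleaving w₁ w₂) (interleavings a b)) eq₁ eq₂ (atMost-interleaving w₁ w₂) })))

    atMost-home∈ : ∀ X → AtMost (λ v → home v ∈ X) (length X)
    atMost-home∈ X = atMost-image (_⊝ r₀) (λ {v} h∈ → home v , h∈ , ⊝-unique refl) (atMost-∈ X)

-- Numerical bound for clusters of a given total size.

module ClusterDensity where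

  open Counting
  open Clusters using (clusterBound)
  open import Data.Nat using (ℕ; zero; suc; _+_; _*_; _∸_; _^_; _!; _≤_; z≤n; s≤s)
  open import Data.Nat.Properties
  open import Data.Nat.Solver using (module +-*-Solver)
  open import Relation.Binary.PropositionalEquality
  open +-*-Solver

  ^-distribʳ-* : ∀ a b k → (a * b) ^ k ≡ a ^ k * b ^ k
  ^-distribʳ-* a b zero    = refl
  ^-distribʳ-* a b (suc k) = trans (cong (a * b *_) (^-distribʳ-* a b k))
    (solve 4 (λ a b p q → a :* b :* (p :* q) := a :* p :* (b :* q)) refl a b (a ^ k) (b ^ k))

  -- (j + 1) ⋯ (j + t)
  rising : ℕ → ℕ → ℕ
  rising j zero    = 1
  rising j (suc t) = (j + suc t) * rising j t

  rising-suc : ∀ j t → rising j (suc t) ≡ suc j * rising (suc j) t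
  rising-suc j zero    = cong (_* 1) (+-comm j 1)
  rising-suc j (suc t) = trans (cong ((j + suc (suc t)) *_) (rising-suc j t))
    (solve 3 (λ j t r → (j :+ (con 2 :+ t)) :* ((con 1 :+ j) :* r) :=
                        (con 1 :+ j) :* ((con 1 :+ j :+ (con 1 :+ t)) :* r)) refl j t (rising (suc j) t))

  rising-! : ∀ j t → rising j t * j ! ≡ (t + j) !
  rising-! j zero    = +-identityʳ (j !)
  rising-! j (suc t) = trans (*-assoc (j + suc t) (rising j t) (j !))
    (cong₂ _*_ (trans (+-suc j t) (cong suc (+-comm j t))) (rising-! j t))

  interleavings-rising : ∀ i j → i ! * interleavings i j ≡ rising j i
  interleavings-rising i j = *-cancelʳ-≡ (i ! * interleavings i j) (rising j i) (j !) {{j !≢0}}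
    (trans (solve 3 (λ a I b → a :* I :* b := I :* (a :* b)) refl (i !) (interleavings i j) (j !))
      (trans (interleavings-! i j) (sym (rising-! j i))))

  -- AM-GM on pairs of factors symmetric about the middle (2j + t + 1)/2.
  rising-≤ : ∀ t j → 2 ^ t * rising j t ≤ (2 * j + suc t) ^ t
  rising-≤ zero          j = ≤-refl
  rising-≤ (suc zero)    j = ≤-reflexive
    (solve 1 (λ j → con 2 :* ((j :+ con 1) :* con 1) := (con 2 :* j :+ con 2) :* con 1) refl j)
  rising-≤ (suc (suc t)) j = begin
    2 * (2 * 2 ^ t) * rising j (suc (suc t))
      ≡⟨ cong (λ z → 2 * (2 * 2 ^ t) * ((j + suc (suc t)) * z)) (rising-suc j t) ⟩
    2 * (2 * 2 ^ t) * ((j + suc (suc t)) * (suc j * rising (suc j) t))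
      ≡⟨ solve 4 (λ p j t r → con 2 :* (con 2 :* p) :* ((j :+ (con 2 :+ t)) :* ((con 1 :+ j) :* r)) :=
           con 4 :* ((con 1 :+ j) :* (j :+ (con 2 :+ t))) :* (p :* r)) refl (2 ^ t) j t (rising (suc j) t) ⟩
    4 * (suc j * (j + suc (suc t))) * (2 ^ t * rising (suc j) t)
      ≤⟨ *-mono-≤ (≤-trans (m≤m+n _ (suc t * suc t)) (≤-reflexive
           (solve 2 (λ j t → con 4 :* ((con 1 :+ j) :* (j :+ (con 2 :+ t))) :+ (con 1 :+ t) :* (con 1 :+ t) :=
             (con 2 :* j :+ (con 3 :+ t)) :* (con 2 :* j :+ (con 3 :+ t))) refl j t)))
           (rising-≤ t (suc j)) ⟩
    s * s * (2 * suc j + suc t) ^ t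
      ≡⟨ cong (λ z → s * s * z ^ t) (solve 2 (λ j t → con 2 :* (con 1 :+ j) :+ (con 1 :+ t) := con 2 :* j :+ (con 3 :+ t)) refl j t) ⟩
    s * s * s ^ t
      ≡⟨ *-assoc s s (s ^ t) ⟩
    s ^ suc (suc t) ∎
    where
    open ≤-Reasoning
    s = 2 * j + suc (suc (suc t))

  -- With m = i + j, the product is m(m-1)⋯(j+1). Its top factor m is set aside; by AM-GM the others
  -- are bounded by powers of their mean m - i/2, and n(m - i/2) ≤ m(n - i) is equivalent to 2mi ≤
  -- ni. The factor set aside misses d/n ≥ 1/2, whence the constant 2. The gain `d ^ i` later
  -- completes `d ^ j` to `d ^ (i + j)`.
  rising-density : ∀ {n} i j d → i + d ≡ n → 2 * (i + j) ≤ n →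
                   n ^ i * rising j i ≤ 2 * ((i + j) * d) ^ i
  rising-density         zero    j d _    _    = s≤s z≤n
  rising-density {n} (suc t) j d refl 2m≤n = begin
    n * n ^ t * ((j + suc t) * rising j t)
      ≡⟨ solve 5 (λ n p j t r → n :* p :* ((j :+ (con 1 :+ t)) :* r) := n :* (((con 1 :+ t) :+ j) :* (p :* r)))
           refl n (n ^ t) j t (rising j t) ⟩
    n * (m * (n ^ t * rising j t))
      ≤⟨ *-mono-≤ n≤2d (*-monoʳ-≤ m core) ⟩
    2 * d * (m * (m * d) ^ t)
      ≡⟨ solve 3 (λ d m p → con 2 :* d :* (m :* p) := con 2 :* (m :* d :* p)) refl d m ((m * d) ^ t) ⟩
    2 * (m * d) ^ suc t ∎
    where
    open ≤-Reasoning
    i = suc t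
    m = i + j
    n≤2d : n ≤ 2 * d
    n≤2d = +-cancelˡ-≤ (2 * i) n (2 * d) (begin
      2 * i + n         ≤⟨ +-monoˡ-≤ n (≤-trans (*-monoʳ-≤ 2 (m≤m+n i j)) 2m≤n) ⟩
      n + n             ≡⟨ solve 2 (λ i d → (i :+ d) :+ (i :+ d) := con 2 :* i :+ con 2 :* d) refl i d ⟩
      2 * i + 2 * d     ∎)
    middle : n * (2 * j + suc t) ≤ 2 * (m * d)
    middle = +-cancelʳ-≤ (n * i) _ _ (begin
      n * (2 * j + i) + n * i  ≡⟨ solve 3 (λ i j d → (i :+ d) :* (con 2 :* j :+ i) :+ (i :+ d) :* i :=
                                     con 2 :* ((i :+ j) :* d) :+ con 2 :* (i :+ j) :* i) refl i j d ⟩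
      2 * (m * d) + 2 * m * i  ≤⟨ +-monoʳ-≤ (2 * (m * d)) (*-monoˡ-≤ i 2m≤n) ⟩
      2 * (m * d) + n * i      ∎)
    core : n ^ t * rising j t ≤ (m * d) ^ t
    core = *-cancelˡ-≤ (2 ^ t) {{m^n≢0 2 t}} (begin
      2 ^ t * (n ^ t * rising j t)       ≡⟨ solve 3 (λ a b c → a :* (b :* c) := b :* (a :* c)) refl (2 ^ t) (n ^ t) (rising j t) ⟩
      n ^ t * (2 ^ t * rising j t)       ≤⟨ *-monoʳ-≤ (n ^ t) (rising-≤ t j) ⟩
      n ^ t * (2 * j + suc t) ^ t        ≡⟨ sym (^-distribʳ-* n (2 * j + suc t) t) ⟩
      (n * (2 * j + suc t)) ^ t          ≤⟨ ^-monoˡ-≤ t middle ⟩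
      (2 * (m * d)) ^ t                  ≡⟨ ^-distribʳ-* 2 (m * d) t ⟩
      2 ^ t * (m * d) ^ t                ∎)

  -- Bernoulli's inequality 1 - i/n ≤ (1 - 1/n)^i for n = `suc l`, with denominators cleared.
  bernoulli : ∀ l i d → i + d ≡ suc l → d * suc l ^ i ≤ suc l * l ^ i
  bernoulli l zero    d refl = ≤-refl
  bernoulli l (suc i) d i+d≡ = begin
    d * (suc l * suc l ^ i)    ≡⟨ sym (*-assoc d (suc l) (suc l ^ i)) ⟩
    d * suc l * suc l ^ i      ≤⟨ *-monoˡ-≤ (suc l ^ i) step ⟩
    l * suc d * suc l ^ i      ≡⟨ *-assoc l (suc d) (suc l ^ i) ⟩
    l * (suc d * suc l ^ i)    ≤⟨ *-monoʳ-≤ l (bernoulli l i (suc d) (trans (+-suc i d) i+d≡)) ⟩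
    l * (suc l * l ^ i)        ≡⟨ solve 2 (λ l p → l :* ((con 1 :+ l) :* p) := (con 1 :+ l) :* (l :* p)) refl l (l ^ i) ⟩
    suc l * l ^ suc i          ∎
    where
    open ≤-Reasoning
    d≤l : d ≤ l
    d≤l = subst (d ≤_) (suc-injective i+d≡) (m≤n+m d i)
    step : d * suc l ≤ l * suc d
    step = begin
      d * suc l  ≡⟨ solve 2 (λ d l → d :* (con 1 :+ l) := l :* d :+ d) refl d l ⟩
      l * d + d  ≤⟨ +-monoʳ-≤ (l * d) d≤l ⟩
      l * d + l  ≡⟨ solve 2 (λ d l → l :* d :+ l := l :* (con 1 :+ d)) refl d l ⟩
      l * suc d  ∎

  module _ (l i j : ℕ) where

    private
      n = suc l
      m = i + j
      d = n ∸ i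

    -- Divided by the powers of n, the bound reads 4 (4 (m/n) (1-1/n)^m)^i n^m. `bernoulli` moves
    -- `i` from (1-i/n)^m into an exponent, which makes the terms geometric in `i`. The leading 4 is
    -- a factor 2 from `rising-density` times a factor 2 from `catalan-bound`.
    cluster-density : 2 * m ≤ n →
      clusterBound n i j * (n ^ i * (n ^ i) ^ m) ≤
      4 * 4 ^ i * m ^ i * (l ^ i) ^ m * n ^ m
    cluster-density 2m≤n = begin
      i ! * C * d ^ j * interleavings i j * (n ^ i * N)
        ≡⟨ solve 6 (λ a c x I y z → a :* c :* x :* I :* (y :* z) := y :* (a :* I) :* (c :* x :* z)) refl
             (i !) C (d ^ j) (interleavings i j) (n ^ i) N ⟩
      n ^ i * (i ! * interleavings i j) * (C * d ^ j * N)
        ≡⟨ cong (λ z → n ^ i * z * (C * d ^ j * N)) (interleavings-rising i j) ⟩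
      n ^ i * rising j i * (C * d ^ j * N)
        ≤⟨ *-mono-≤ (rising-density i j d i+d≡n 2m≤n) (*-monoˡ-≤ N (*-monoˡ-≤ (d ^ j) (catalan-bound i i))) ⟩
      2 * (m * d) ^ i * (2 * 4 ^ i * d ^ j * N)
        ≡⟨ cong (λ z → 2 * z * (2 * 4 ^ i * d ^ j * N)) (^-distribʳ-* m d i) ⟩
      2 * (m ^ i * d ^ i) * (2 * 4 ^ i * d ^ j * N)
        ≡⟨ solve 5 (λ a b p x y → con 2 :* (a :* b) :* (con 2 :* p :* x :* y) := con 4 :* p :* a :* (b :* x :* y)) refl
             (m ^ i) (d ^ i) (4 ^ i) (d ^ j) N ⟩
      4 * 4 ^ i * m ^ i * (d ^ i * d ^ j * N)
        ≡⟨ cong (λ z → 4 * 4 ^ i * m ^ i * (z * N)) (sym (^-distribˡ-+-* d i j)) ⟩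
      4 * 4 ^ i * m ^ i * (d ^ m * N)
        ≡⟨ cong (4 * 4 ^ i * m ^ i *_) (sym (^-distribʳ-* d (n ^ i) m)) ⟩
      4 * 4 ^ i * m ^ i * (d * n ^ i) ^ m
        ≤⟨ *-monoʳ-≤ (4 * 4 ^ i * m ^ i) (^-monoˡ-≤ m (bernoulli l i d i+d≡n)) ⟩
      4 * 4 ^ i * m ^ i * (n * l ^ i) ^ m
        ≡⟨ cong (4 * 4 ^ i * m ^ i *_) (trans (^-distribʳ-* n (l ^ i) m) (*-comm (n ^ m) _)) ⟩
      4 * 4 ^ i * m ^ i * ((l ^ i) ^ m * n ^ m)
        ≡⟨ sym (*-assoc (4 * 4 ^ i * m ^ i) _ _) ⟩
      4 * 4 ^ i * m ^ i * (l ^ i) ^ m * n ^ m ∎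
      where
      open ≤-Reasoning
      C = catalan i i
      N = (n ^ i) ^ m
      i+d≡n : i + d ≡ n
      i+d≡n = m+[n∸m]≡n (≤-trans (≤-trans (m≤m+n i j) (m≤m+n m (m + 0))) 2m≤n)

-- From hash functions to words of hash values.

module HashFunctions where

  open import Defs using (module Probing; hashFunctions)
  open Counting
  open Clusters
  open import Data.Bool using (true; false)
  open import Data.Fin using (Fin; zero; suc; toℕ; finToFun; funToFin; combine)
  import Data.Fin.Properties as Finₚ
  open import Data.Fin.Permutation using (Permutation′; _⟨$⟩ʳ_; _⟨$⟩ˡ_; inverseˡ)
  open import Data.List as List using (List; []; _∷_; length; filter; allFin; _ʳ++_)
  open import Data.List.Properties using (length-map; length-tabulate; map-∘) renaming (map-cong to List-map-cong)
  open import Data.List.Membership.Propositional using (_∈_; _∉_)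
  open import Data.List.Membership.Propositional.Properties using (∈-allFin; ∈-filter⁻)
  open import Data.List.Relation.Unary.All as All using (All; []; _∷_)
  open import Data.List.Relation.Unary.AllPairs using ([]; _∷_)
  open import Data.List.Relation.Unary.Any using (here; there)
  open import Data.List.Relation.Unary.Unique.Propositional using (Unique)
  import Data.List.Relation.Unary.Unique.Propositional.Properties as Uniqueₚ
  open import Data.Maybe as Maybe using (Maybe; just; nothing; maybe; is-nothing)
  open import Data.Nat as ℕ using (ℕ; zero; suc; _+_; _*_; _∸_; _^_; _≤_; _<_; z≤n; s≤s; NonZero)
  open import Data.Nat.Properties hiding (_≟_)
  open import Data.Product using (Σ; ∃; _×_; _,_; proj₁; proj₂)
  open import Data.Vec as Vec using (Vec; []; _∷_; lookup; _[_]≔_; replicate; toList; foldl′)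
  import Data.Vec.Properties as Vecₚ
  open import Function using (_∘_; id)
  open import Relation.Binary.PropositionalEquality
  open import Relation.Nullary using (yes; no; contradiction)
  open import Relation.Unary using (Decidable)

  InBox : ∀ {n u} → Vec (List (Fin n)) u → Vec (Fin n) u → Set
  InBox A g = ∀ j → lookup g j ∈ lookup A j

  volume : ∀ {n u} → Vec (List (Fin n)) u → ℕ
  volume []      = 1
  volume (L ∷ A) = length L * volume A

  atMost-box : ∀ {n u} (A : Vec (List (Fin n)) u) → AtMost (InBox A) (volume A)
  atMost-box []      = atMost-⊆ {P = _∈ [] ∷ []} (λ { {[]} _ → here refl }) (atMost-∈ ([] ∷ []))
  atMost-box (L ∷ A) = atMost-image (λ (x , g) → x ∷ g)
    (λ { {x ∷ g} in-box → (x , g) , (in-box zero , in-box ∘ suc) , refl })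
    (atMost-Σ (atMost-∈ L) (λ _ → atMost-box A))

  volume-replicate : ∀ {n} u → volume (replicate u (allFin n)) ≡ n ^ u
  volume-replicate zero        = refl
  volume-replicate {n} (suc u) = cong₂ _*_ (length-tabulate {n = n} id) (volume-replicate u)

  volume-update : ∀ {n u} (A : Vec (List (Fin n)) u) y v →
                  volume (A [ y ]≔ (v ∷ [])) * length (lookup A y) ≡ volume A
  volume-update (L ∷ A) zero    v = trans (cong (_* length L) (+-identityʳ (volume A))) (*-comm (volume A) (length L))
  volume-update (L ∷ A) (suc y) v = trans (*-assoc (length L) _ _) (cong (length L *_) (volume-update A y v))

  -- Prescribing the value at a key replaces one side of the box, of length `n`, by a singleton;
  -- distinct keys use distinct sides.
  constrain : ∀ {n u} ys w (A : Vec (List (Fin n)) u) → Unique ys →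
    All (λ y → length (lookup A y) ≡ n) ys → length w ≡ length ys →
    ∃ λ A′ → (∀ g → List.map (lookup g) ys ≡ w → InBox A g → InBox A′ g) ×
             volume A′ * n ^ length ys ≡ volume A
  constrain         []       []      A _               _            _   = A , (λ _ _ b → b) , *-identityʳ (volume A)
  constrain {n} {u} (y ∷ ys) (v ∷ w) A (y∉ys ∷ unique) (|Ay| ∷ |A|) len =
    let A₁ = A [ y ]≔ (v ∷ [])
        |A₁| = All.zipWith (λ {z} (y≢z , |Az|) → trans (cong length (Vecₚ.lookup∘update′ (y≢z ∘ sym) A (v ∷ []))) |Az|) (y∉ys , |A|)
        A′ , box , vol = constrain ys w A₁ unique |A₁| (suc-injective len)
    in A′ ,
       (λ { g refl b → box g refl (inUpdate g b) }) ,
       (begin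
         volume A′ * (n * n ^ length ys)   ≡⟨ cong (volume A′ *_) (*-comm n (n ^ length ys)) ⟩
         volume A′ * (n ^ length ys * n)   ≡⟨ sym (*-assoc (volume A′) _ n) ⟩
         volume A′ * n ^ length ys * n     ≡⟨ cong₂ _*_ vol (sym |Ay|) ⟩
         volume A₁ * length (lookup A y)   ≡⟨ volume-update A y v ⟩
         volume A                          ∎)
    where
    open ≡-Reasoning
    inUpdate : ∀ g → InBox A g → InBox (A [ y ]≔ (lookup g y ∷ [])) g
    inUpdate g b j with j Finₚ.≟ y
    ... | yes refl = subst (lookup g j ∈_) (sym (Vecₚ.lookup∘update j A (lookup g j ∷ []))) (here refl)
    ... | no j≢y   = subst (lookup g j ∈_) (sym (Vecₚ.lookup∘update′ j≢y A (lookup g y ∷ []))) (b j)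

  funToFin-cong : ∀ {u n} {f g : Fin u → Fin n} → (∀ i → f i ≡ g i) → funToFin f ≡ funToFin g
  funToFin-cong {zero}  eq = refl
  funToFin-cong {suc u} eq = cong₂ combine (eq zero) (funToFin-cong (eq ∘ suc))

  ^-unique-keys : ∀ n {u} {ys : List (Fin u)} → Unique ys → n ^ (u ∸ length ys) * n ^ length ys ≡ n ^ u
  ^-unique-keys n {u} {ys} unique = trans (sym (^-distribˡ-+-* n (u ∸ length ys) (length ys))) (cong (n ^_) (m∸n+n≡m |ys|≤u))
    where
    |ys|≤u : length ys ≤ u
    |ys|≤u = subst (length ys ≤_) (length-tabulate {n = u} id) (unique-⊆-length unique (λ {y} _ → ∈-allFin y))

  -- Codes are counted instead of functions: a vector of values determines its code, by
  -- `funToFin-cong`, so the box of admissible vectors covers all admissible codes.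
  atMost-codes : ∀ {n u} .{{_ : NonZero n}} (ys : List (Fin u)) → Unique ys → ∀ w →
                 AtMost (λ (k : Fin (n ^ u)) → List.map (finToFun k) ys ≡ w) (n ^ (u ∸ length ys))
  atMost-codes {n} {u} ys unique w = atMost-⊆ (λ {k} eq → trans (sym (length-map (finToFun k) ys)) (cong length eq) , eq)
    (atMost-guard (length ys ℕ.≟ length w) λ len →
      let A , box , vol = constrain ys w (replicate u (allFin n)) unique
                            (All.universal (λ y → trans (cong length (Vecₚ.lookup-replicate y (allFin n))) (length-tabulate {n = n} id)) ys)
                            (sym len)
      in atMost-image (funToFin ∘ lookup)
           (λ {k} eq → let g = Vec.tabulate (finToFun k)
                           g≗ = Vecₚ.lookup∘tabulate (finToFun k) in
             g , box g (trans (List-map-cong g≗ ys) eq) (λ j → subst (lookup g j ∈_) (sym (Vecₚ.lookup-replicate j (allFin n))) (∈-allFin _)) ,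
             trans (funToFin-cong g≗) (Finₚ.funToFin-finToFin {u} {n} k))
           (atMost-≤ (*-cancelʳ-≤ (volume A) _ (n ^ length ys) {{m^n≢0 n (length ys)}}
             (≤-reflexive (trans vol (trans (volume-replicate u) (sym (^-unique-keys n unique)))))) (atMost-box A)))

  length-filter-map : ∀ {A B : Set} {P : B → Set} (P? : Decidable P) (f : A → B) xs →
                      length (filter P? (List.map f xs)) ≡ length (filter (P? ∘ f) xs)
  length-filter-map P? f []       = refl
  length-filter-map P? f (x ∷ xs) with P? (f x)
  ... | yes _ = cong suc (length-filter-map P? f xs)
  ... | no  _ = length-filter-map P? f xs

  -- Uniformity and independence in counting form: each word of values on the distinct keys `ys`
  -- comes from at most n^(u - `length ys`) hash functions.
  count-hashFunctions : ∀ {n u} .{{_ : NonZero n}} {P : (Fin u → Fin n) → Set} (P? : Decidable P)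
    (ys : List (Fin u)) → Unique ys → ∀ {C : List (Fin n) → Set} {c} → AtMost C c →
    (∀ h → P h → C (List.map h ys)) →
    length (filter P? (hashFunctions u n)) * n ^ length ys ≤ c * n ^ u
  count-hashFunctions {n} {u} {P} P? ys unique {c = c} A P⇒C = begin
    length (filter P? (hashFunctions u n)) * n ^ length ys
      ≡⟨ cong (_* n ^ length ys) (length-filter-map P? finToFun (allFin (n ^ u))) ⟩
    length (filter (P? ∘ finToFun) (allFin (n ^ u))) * n ^ length ys
      ≤⟨ *-monoˡ-≤ (n ^ length ys) (≤-trans
           (unique-⊆-length (Uniqueₚ.filter⁺ _ (Uniqueₚ.allFin⁺ (n ^ u)))
             (λ {k} k∈ → cov (proj₂ (∈-filter⁻ (P? ∘ finToFun) {xs = allFin (n ^ u)} k∈)))) len) ⟩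
    c * n ^ (u ∸ length ys) * n ^ length ys
      ≡⟨ trans (*-assoc c _ _) (cong (c *_) (^-unique-keys n unique)) ⟩
    c * n ^ u ∎
    where
    open ≤-Reasoning
    codes : AtMost (P ∘ finToFun) (c * n ^ (u ∸ length ys))
    codes = atMost-image proj₂ (λ {k} Pk → (List.map (finToFun k) ys , k) , (P⇒C (finToFun k) Pk , refl) , refl)
              (atMost-Σ A (λ w → atMost-codes ys unique w))
    cov = proj₁ (proj₂ codes)
    len = proj₂ (proj₂ codes)

  -- Agreement of the table with the word model.

  module Table {k u : ℕ} (r : Permutation′ (suc k)) where

    private
      n = suc k

    perm-injective : ∀ {i j} → r ⟨$⟩ʳ i ≡ r ⟨$⟩ʳ j → i ≡ j
    perm-injective {i} {j} eq = trans (sym (inverseˡ r)) (trans (cong (r ⟨$⟩ˡ_) eq) (inverseˡ r))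

    -- `allFin (suc k)` unfolds to `zero` followed by `tabulate suc`, so these two arguments
    -- together are the offset sequence in order.
    open Words {n} (r ⟨$⟩ʳ zero) (List.map (r ⟨$⟩ʳ_) (List.tabulate suc))
      (Uniqueₚ.map⁺ perm-injective (Uniqueₚ.allFin⁺ n))
      (trans (length-map (r ⟨$⟩ʳ_) (allFin n)) (length-tabulate {n = n} id)) public
    open import Data.List.Membership.DecPropositional (Finₚ._≟_ {n}) using (_∈?_)

    length-keys : ∀ {m} (xs : Vec (Fin u) m) ys → length (toList xs ʳ++ ys) ≡ m + length ys
    length-keys []       ys = refl
    length-keys {suc m} (x ∷ xs) ys = trans (length-keys xs (x ∷ ys)) (+-suc m (length ys))

    module _ (h : Fin u → Fin n) where

      open Probing r h

      Represents : List Pos → Table → Set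
      Represents X A = ∀ s → (s ∈ X → is-nothing (lookup A s) ≡ false) ×
                             (s ∉ X → is-nothing (lookup A s) ≡ true)

      firstEmpty-firstFree : ∀ X A → Represents X A → ∀ x →
        firstFree X (path (h x)) ≡ Maybe.map (slot x) (firstEmpty A x)
      firstEmpty-firstFree X A R x = trans (cong (firstFree X) (sym (map-∘ (allFin n)))) (search (allFin n))
        where
        search : ∀ is → firstFree X (List.map (slot x) is) ≡
                 Maybe.map (slot x) (List.findᵇ (λ i → is-nothing (lookup A (slot x i))) is)
        search []       = refl
        search (i ∷ is) with slot x i ∈? X
        ... | yes s∈ rewrite proj₁ (R (slot x i)) s∈ = search is
        ... | no  s∉ rewrite proj₂ (R (slot x i)) s∉ = refl

      represents-insert : ∀ w A x → Represents (run w) A → Represents (run (h x ∷ w)) (insert A x)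
      represents-insert w A x R rewrite firstEmpty-firstFree (run w) A R x with firstEmpty A x
      ... | nothing = R
      ... | just i  = λ s → occupied s , vacant s
        where
        A′ = A [ slot x i ]≔ just x
        occupied : ∀ s → s ∈ slot x i ∷ run w → is-nothing (lookup A′ s) ≡ false
        occupied s s∈ with s Finₚ.≟ slot x i
        occupied s s∈         | yes refl = cong is-nothing (Vecₚ.lookup∘update s A (just x))
        occupied s (here eq)  | no s≢    = contradiction eq s≢
        occupied s (there s∈) | no s≢    = trans (cong is-nothing (Vecₚ.lookup∘update′ s≢ A (just x))) (proj₁ (R s) s∈)
        vacant : ∀ s → s ∉ slot x i ∷ run w → is-nothing (lookup A′ s) ≡ true
        vacant s s∉ = trans (cong is-nothing (Vecₚ.lookup∘update′ (s∉ ∘ here) A (just x))) (proj₂ (R s) (s∉ ∘ there))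

      represents-tableAfter : ∀ {m} (xs : Vec (Fin u) m) →
        Represents (run (List.map h (toList xs ʳ++ []))) (tableAfter xs)
      represents-tableAfter xs = inserts (replicate n nothing) xs [] λ s → (λ ()) , λ _ → cong is-nothing (Vecₚ.lookup-replicate s nothing)
        where
        inserts : ∀ {m} A (xs : Vec (Fin u) m) ys → Represents (run (List.map h ys)) A →
                  Represents (run (List.map h (toList xs ʳ++ ys))) (foldl′ insert A xs)
        inserts A []       ys R = R
        inserts A (x ∷ xs) ys R = inserts (insert A x) xs (x ∷ ys) (represents-insert (List.map h ys) A x R)

      -- The search for an empty slot stops at `s` at the latest. `X` is left arbitrary because the
      -- depth is measured once in the whole table and once in the clusters alone.
      cost≤depth : ∀ A x {X s} → is-nothing (lookup A s) ≡ true → (f : FirstFree X (path (h x)) s) →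
                   cost A x ≤ suc (depth f)
      cost≤depth A x {X} {s} empty f =
        let f′ , depth≡ = relist (sym (map-∘ (allFin n))) f
            i , found , i≤ = search id f′
        in subst (_≤ suc (depth f)) (cong (maybe (suc ∘ toℕ) (suc n)) (sym found))
             (s≤s (subst (toℕ i ≤_) depth≡ i≤))
        where
        relist : ∀ {σ τ} → σ ≡ τ → (f : FirstFree X σ s) → Σ (FirstFree X τ s) λ f′ → depth f′ ≡ depth f
        relist refl f = f , refl
        search : ∀ {l} (g : Fin l → Fin n) (f : FirstFree X (List.map (slot x) (List.tabulate g)) s) →
          ∃ λ i → List.findᵇ (λ i → is-nothing (lookup A (slot x i))) (List.tabulate g) ≡ just (g i) × toℕ i ≤ depth f
        search {suc l} g (here _) rewrite empty = zero , refl , z≤n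
        search {suc l} g (there _ f) with is-nothing (lookup A (slot x (g zero)))
        ... | true  = zero , refl , z≤n
        ... | false = let i , found , i≤ = search (g ∘ suc) f in suc i , found , s≤s i≤

      cost-cluster : ∀ {m} (xs : Vec (Fin u) m) x → m < n →
        let w = List.map h (toList xs ʳ++ []) in
        ∃ λ w₁ → Cluster (h x) w₁ w × cost (tableAfter xs) x ≤ suc (length w₁)
      cost-cluster {m} xs x m<n =
        let w₁ , C , s , s∉ , f , d≤ = cluster (h x) w (subst (_< n) (sym |w|≡m) m<n)
        in w₁ , C , ≤-trans (cost≤depth (tableAfter xs) x (proj₂ (represents-tableAfter xs s) s∉) f) (s≤s d≤)
        where
        w = List.map h (toList xs ʳ++ [])
        |w|≡m : length w ≡ m
        |w|≡m = trans (length-map h (toList xs ʳ++ [])) (trans (length-keys xs []) (+-identityʳ m))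

-- Counting the hash functions that make an insertion expensive.

module UnluckyHashFunctions where

  open import Defs using (module Probing; hashFunctions; insertionCost)
  open Counting
  open Clusters
  open HashFunctions
  open import Data.Empty using (⊥)
  open import Data.Fin using (Fin)
  open import Data.Fin.Permutation using (Permutation′)
  open import Data.List as List using (List; []; _∷_; length; filter; allFin; _ʳ++_)
  open import Data.List.Properties using (length-map; length-tabulate)
  open import Data.List.Membership.Propositional using (_∈_)
  open import Data.List.Membership.Propositional.Properties using (∈-allFin)
  open import Data.List.Relation.Unary.All as All using (All; []; _∷_)
  open import Data.List.Relation.Unary.AllPairs using ([]; _∷_)
  import Data.List.Relation.Unary.Unique.Propositional as ListU
  open import Data.Nat as ℕ using (ℕ; suc; _+_; _*_; _∸_; _^_; _≤_; _<_; s≤s; _<?_)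
  open import Data.Nat.Properties hiding (_≟_; _<?_)
  open import Data.Product using (_×_; _,_; proj₂)
  open import Data.Unit using (⊤; tt)
  open import Data.Vec as Vec using (Vec; []; _∷_; toList; _∷ʳ_)
  import Data.Vec.Relation.Unary.All as VecAll
  import Data.Vec.Relation.Unary.AllPairs as VecAllPairs
  open import Data.Vec.Relation.Unary.Unique.Propositional using (Unique)
  open import Function using (_∘_; id)
  open import Relation.Binary.PropositionalEquality
  open import Relation.Nullary using (contradiction)

  atMost-Fin : ∀ n → AtMost {Fin n} (λ _ → ⊤) n
  atMost-Fin n = atMost-≤ (≤-reflexive (length-tabulate {n = n} id))
    (atMost-⊆ (λ {v} _ → ∈-allFin v) (atMost-∈ (allFin n)))

  all-∷ʳ⁻ : ∀ {A : Set} {P : A → Set} {m} (xs : Vec A m) {x} → VecAll.All P (xs ∷ʳ x) → VecAll.All P xs × P x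
  all-∷ʳ⁻ []       (px VecAll.∷ VecAll.[]) = VecAll.[] , px
  all-∷ʳ⁻ (_ ∷ xs) (py VecAll.∷ pxs)       = let ps , px = all-∷ʳ⁻ xs pxs in py VecAll.∷ ps , px

  unique-keys : ∀ {A : Set} {m} (xs : Vec A m) {x} → Unique (xs ∷ʳ x) → ListU.Unique (x ∷ (toList xs ʳ++ []))
  unique-keys xs {x} unique = collect xs [] unique [] []
    where
    collect : ∀ {m} (xs : Vec _ m) ys → Unique (xs ∷ʳ x) → ListU.Unique ys →
              All (λ y → VecAll.All (_≢ y) (xs ∷ʳ x)) ys → ListU.Unique (x ∷ (toList xs ʳ++ ys))
    collect []       ys _ u apart = All.map (λ { (x≢y VecAll.∷ _) → x≢y }) apart ∷ u
    collect (z ∷ xs) ys (z∉ VecAllPairs.∷ unique) u apart = collect xs (z ∷ ys) unique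
      (All.map (λ { (z≢y VecAll.∷ _) → z≢y }) apart ∷ u)
      (VecAll.map (_∘ sym) z∉ ∷ All.map (λ { (_ VecAll.∷ ≢y) → ≢y }) apart)

  module _ {l u m : ℕ} (r : Permutation′ (suc l)) (xs : Vec (Fin u) m) (x : Fin u)
           (unique : Unique (xs ∷ʳ x)) (m<n : m < suc l) where

    private
      n = suc l
      keys : List (Fin u)
      keys = x ∷ (toList xs ʳ++ [])

    open Table {l} {u} r

    length-word : ∀ h → length (List.map {B = Fin n} h (toList xs ʳ++ [])) ≡ m
    length-word h = trans (length-map h (toList xs ʳ++ [])) (trans (length-keys xs []) (+-identityʳ m))

    badCount : ℕ → ℕ
    badCount k = length (filter (λ h → k <? insertionCost r xs x h) (hashFunctions u n))

    count-keys : ∀ {c} k {C : List (Fin n) → Set} → AtMost C c →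
      (∀ h → k < insertionCost r xs x h → C (List.map h keys)) → badCount k * n ^ suc m ≤ c * n ^ u
    count-keys {c} k A bad⇒C = subst (λ z → badCount k * n ^ suc z ≤ c * n ^ u) (trans (length-keys xs []) (+-identityʳ m))
      (count-hashFunctions (λ h → k <? insertionCost r xs x h) keys (unique-keys xs unique) A bad⇒C)

    badCount-large : ∀ k → m < k → badCount k ≡ 0
    badCount-large k m<k = m*n≡0⇒m≡0 (badCount k) (n ^ suc m) {{m^n≢0 n (suc m)}} (n≤0⇒n≡0
      (count-keys {0} k {C = λ _ → ⊥} (atMost-∅ id) λ h k<cost →
        let w₁ , C , cost≤ = cost-cluster h xs x m<n
            open Cluster C
            w₁≤m = subst (length w₁ ≤_) (trans (sym (length-interleaving splits)) (length-word h)) (m≤m+n (length w₁) (length rest))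
        in <-irrefl refl (<-≤-trans k<cost (≤-trans cost≤ (≤-trans (s≤s w₁≤m) m<k)))))

    -- The cost is at most one more than the number of keys in the clusters met, so exceeding `k`
    -- forces at least `k` such keys. The leading factor `n` is the choice of the hash value of `x`.
    badCount-clusters : ∀ k m′ → k + m′ ≡ m →
      badCount k * n ^ suc m ≤ n * splitSum (λ i j → clusterBound n (k + i) j) m′ * n ^ u
    badCount-clusters k m′ k+m′≡m = count-keys k
      (atMost-image (λ (v , w) → v ∷ w) id (atMost-Σ (atMost-Fin n) (λ v → atMost-cluster v k m′)))
      λ h k<cost →
        let w₁ , C , cost≤ = cost-cluster h xs x m<n
        in (h x , _) , (tt , trans (length-word h) (sym k+m′≡m) , w₁ , C , ≤-pred (≤-trans k<cost cost≤)) , refl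

    -- A cost above 1 means an occupied home slot, and at most `m` slots are occupied whatever the
    -- earlier hash values are.
    badCount-home : ∀ k → 1 ≤ k → badCount k * n ^ suc m ≤ n ^ m * m * n ^ u
    badCount-home k 1≤k = count-keys k
      (atMost-image (λ (w , v) → v ∷ w) id
        (atMost-Σ (atMost-words (atMost-Fin n) m) (λ w → atMost-guard (length w ℕ.≟ m) (λ len →
          atMost-≤ (subst (length (run w) ≤_) len (length-run w)) (atMost-home∈ (run w))))))
      λ h k<cost → let w = List.map h (toList xs ʳ++ []) in
        (w , h x) ,
        ((length-word h , All.universal (λ _ → tt) w) , length-word h , occupied h k<cost) , refl
      where
      occupied : ∀ h → k < insertionCost r xs x h → home (h x) ∈ run (List.map h (toList xs ʳ++ []))
      occupied h k<cost with firstFree-exists (run w) (h x) (≤-<-trans (length-run w) (subst (_< n) (sym (length-word h)) m<n))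
        where w = List.map h (toList xs ʳ++ [])
      ... | s , f with f | cost≤depth h (Probing.tableAfter r h xs) x (proj₂ (represents-tableAfter h xs s) (firstFree-∉ f)) f
      ... | here _     | cost≤ = contradiction (≤-trans (s≤s 1≤k) (≤-trans k<cost cost≤)) (λ { (s≤s ()) })
      ... | there h∈ _ | _     = h∈

-- Partial sums of the exponential series over the rationals.

module RationalExponential where

  open RationalLemmas
  open ExpLemmas
  open import Data.Nat as ℕ using (ℕ; zero; suc)
  import Data.Nat.Properties as ℕₚ
  open import Data.Integer using (+_)
  open import Data.Rational
    using (ℚ; 0ℚ; 1ℚ; _+_; _*_; _-_; -_; _≤_; _<_; nonNegative; positive)
  open import Data.Rational.Properties
  open import Data.Rational.Solver using (module +-*-Solver)
  open import Algebra.Bundles using (CommutativeRing)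
  open import Algebra.Properties.CommutativeSemiring.Exp (CommutativeRing.commutativeSemiring +-*-commutativeRing)
    using (_^_; ^-distrib-*)
  open import Function using (_∘_)
  open import Relation.Binary.PropositionalEquality
  open +-*-Solver

  0≤q-p : ∀ {p q} → p ≤ q → 0ℚ ≤ q - p
  0≤q-p {p} {q} p≤q = subst (_≤ q - p) (+-inverseʳ p) (+-monoˡ-≤ (- p) p≤q)

  ≤-by : ∀ {p q} d → 0ℚ ≤ d → p + d ≡ q → p ≤ q
  ≤-by {p} d 0≤d eq = subst (p ≤_) eq (p≤p+q p 0≤d)

  ≤-+-cancel : ∀ {p q} r → p + r ≤ q + r → p ≤ q
  ≤-+-cancel {p} {q} r le = ≤-by (q + r - (p + r)) (0≤q-p le)
    (solve 3 (λ p q r → p :+ (q :+ r :- (p :+ r)) := q) refl p q r)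

  *-monoˡ : ∀ {a p q} → 0ℚ ≤ a → p ≤ q → a * p ≤ a * q
  *-monoˡ {a} 0≤a = *-monoˡ-≤-nonNeg a {{nonNegative 0≤a}}

  *-monoʳ : ∀ {a p q} → 0ℚ ≤ a → p ≤ q → p * a ≤ q * a
  *-monoʳ {a} 0≤a = *-monoʳ-≤-nonNeg a {{nonNegative 0≤a}}

  *-cancelˡ : ∀ {a p q} → 0ℚ < a → a * p ≤ a * q → p ≤ q
  *-cancelˡ {a} 0<a = *-cancelˡ-≤-pos a {{positive 0<a}}

  *-cancelʳ : ∀ {a p q} → 0ℚ < a → p * a ≤ q * a → p ≤ q
  *-cancelʳ {a} 0<a = *-cancelʳ-≤-pos a {{positive 0<a}}

  0≤^ : ∀ {p} k → 0ℚ ≤ p → 0ℚ ≤ p ^ k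
  0≤^ zero    0≤p = 0≤1
  0≤^ (suc k) 0≤p = 0≤* 0≤p (0≤^ k 0≤p)

  ^-mono : ∀ {p q} k → 0ℚ ≤ p → p ≤ q → p ^ k ≤ q ^ k
  ^-mono zero    0≤p p≤q = ≤-refl
  ^-mono (suc k) 0≤p p≤q = *-mono (≤-trans 0≤p p≤q) (0≤^ k 0≤p) p≤q (^-mono k 0≤p p≤q)

  1^ : ∀ k → 1ℚ ^ k ≡ 1ℚ
  1^ zero    = refl
  1^ (suc k) = trans (*-identityˡ (1ℚ ^ k)) (1^ k)

  ν-+ : ∀ a b → ν (a ℕ.+ b) ≡ ν a + ν b
  ν-+ zero    b = sym (+-identityˡ (ν b))
  ν-+ (suc a) b = trans (ν-suc (a ℕ.+ b)) (trans (cong (_+_ 1ℚ) (ν-+ a b))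
    (trans (sym (+-assoc 1ℚ (ν a) (ν b))) (cong (_+ ν b) (sym (ν-suc a)))))

  ν-* : ∀ a b → ν (a ℕ.* b) ≡ ν a * ν b
  ν-* zero    b = sym (*-zeroˡ (ν b))
  ν-* (suc a) b = trans (ν-+ b (a ℕ.* b)) (trans (cong (_+_ (ν b)) (ν-* a b))
    (trans (solve 2 (λ a b → b :+ a :* b := (con 1ℚ :+ a) :* b) refl (ν a) (ν b)) (cong (_* ν b) (sym (ν-suc a)))))

  ν-^ : ∀ a k → ν (a ℕ.^ k) ≡ ν a ^ k
  ν-^ a zero    = refl
  ν-^ a (suc k) = trans (ν-* a (a ℕ.^ k)) (cong (ν a *_) (ν-^ a k))

  ν-cancel : ∀ {a b} l k → a ℕ.* suc l ℕ.^ k ℕ.≤ b → ν a ≤ ν b * c l ^ k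
  ν-cancel {a} {b} l k le = subst (_≤ ν b * c l ^ k) eq (*-monoʳ (0≤^ k (0≤c l)) (ν-mono (a ℕ.* suc l ℕ.^ k) le))
    where
    eq : ν (a ℕ.* suc l ℕ.^ k) * c l ^ k ≡ ν a
    eq = trans (cong (_* c l ^ k) (trans (ν-* a (suc l ℕ.^ k)) (cong (ν a *_) (ν-^ (suc l) k))))
      (trans (*-assoc (ν a) (ν (suc l) ^ k) (c l ^ k))
        (trans (cong (ν a *_) (trans (sym (^-distrib-* (ν (suc l)) (c l) k)) (trans (cong (_^ k) (ν*c l)) (1^ k))))
          (*-identityʳ (ν a))))

  diagonal : (ℕ → ℕ → ℚ) → ℕ → ℚ
  diagonal F zero    = F 0 0
  diagonal F (suc k) = F 0 (suc k) + diagonal (F ∘ suc) k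

  diagonal-cong : ∀ k {F G : ℕ → ℕ → ℚ} → (∀ i j → i ℕ.+ j ≡ k → F i j ≡ G i j) → diagonal F k ≡ diagonal G k
  diagonal-cong zero    eq = eq 0 0 refl
  diagonal-cong (suc k) eq = cong₂ _+_ (eq 0 (suc k) refl) (diagonal-cong k (λ i j e → eq (suc i) j (cong suc e)))

  diagonal-+ : ∀ k F G → diagonal (λ i j → F i j + G i j) k ≡ diagonal F k + diagonal G k
  diagonal-+ zero    F G = refl
  diagonal-+ (suc k) F G = trans
    (cong (_+_ (F 0 (suc k) + G 0 (suc k))) (diagonal-+ k (F ∘ suc) (G ∘ suc)))
    (solve 4 (λ a b s t → (a :+ b) :+ (s :+ t) := (a :+ s) :+ (b :+ t)) refl
      (F 0 (suc k)) (G 0 (suc k)) (diagonal (F ∘ suc) k) (diagonal (G ∘ suc) k))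

  diagonal-*ˡ : ∀ k a F → diagonal (λ i j → a * F i j) k ≡ a * diagonal F k
  diagonal-*ˡ zero    a F = refl
  diagonal-*ˡ (suc k) a F = trans (cong (_+_ (a * F 0 (suc k))) (diagonal-*ˡ k a (F ∘ suc)))
    (sym (*-distribˡ-+ a (F 0 (suc k)) (diagonal (F ∘ suc) k)))

  ν-expTerm : ∀ k x → ν (suc k) * expTerm (suc k) x ≡ x * expTerm k x
  ν-expTerm k x = trans
    (solve 4 (λ n u x c → n :* (u :* x :* c) := (x :* u) :* (n :* c)) refl (ν (suc k)) (expTerm k x) x (c k))
    (trans (cong (x * expTerm k x *_) (ν*c k)) (*-identityʳ (x * expTerm k x)))

  diagonal-left : ∀ k x (g : ℕ → ℚ) →
    diagonal (λ i j → ν i * (expTerm i x * g j)) (suc k) ≡ x * diagonal (λ i j → expTerm i x * g j) k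
  diagonal-left k x g = trans
    (cong₂ _+_ (*-zeroˡ (expTerm 0 x * g (suc k)))
      (trans (diagonal-cong k λ i j _ → trans (sym (*-assoc (ν (suc i)) (expTerm (suc i) x) (g j)))
               (trans (cong (_* g j) (ν-expTerm i x)) (*-assoc x (expTerm i x) (g j))))
             (diagonal-*ˡ k x (λ i j → expTerm i x * g j))))
    (+-identityˡ (x * diagonal (λ i j → expTerm i x * g j) k))

  diagonal-right : ∀ k y (f : ℕ → ℚ) →
    diagonal (λ i j → ν j * (f i * expTerm j y)) (suc k) ≡ y * diagonal (λ i j → f i * expTerm j y) k
  diagonal-right k y f = trans (cong (_+ diagonal (λ i j → ν j * (f (suc i) * expTerm j y)) k) (first k)) (rest k)
    where
    first : ∀ k → ν (suc k) * (f 0 * expTerm (suc k) y) ≡ y * (f 0 * expTerm k y)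
    first k = trans (solve 3 (λ n f t → n :* (f :* t) := f :* (n :* t)) refl (ν (suc k)) (f 0) (expTerm (suc k) y))
      (trans (cong (f 0 *_) (ν-expTerm k y)) (solve 3 (λ f y t → f :* (y :* t) := y :* (f :* t)) refl (f 0) y (expTerm k y)))
    rest : ∀ k → y * (f 0 * expTerm k y) + diagonal (λ i j → ν j * (f (suc i) * expTerm j y)) k ≡
           y * diagonal (λ i j → f i * expTerm j y) k
    rest zero    = trans (cong (_+_ (y * (f 0 * 1ℚ))) (*-zeroˡ (f 1 * 1ℚ))) (+-identityʳ (y * (f 0 * 1ℚ)))
    rest (suc k) = trans (cong (_+_ (y * (f 0 * expTerm (suc k) y))) (diagonal-right k y (f ∘ suc)))
      (sym (*-distribˡ-+ y (f 0 * expTerm (suc k) y) (diagonal (λ i j → f (suc i) * expTerm j y) k)))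

  -- The binomial theorem, by a Leibniz argument: `suc k` times the next term at z is z times the
  -- current one, and on the diagonal the weight `suc k` splits as i + j, whose two shares produce
  -- the factors `x` and `y`.
  expTerm-+ : ∀ k x y → expTerm k (x + y) ≡ diagonal (λ i j → expTerm i x * expTerm j y) k
  expTerm-+ zero    x y = refl
  expTerm-+ (suc k) x y = ≤-antisym (*-cancelˡ 0<ν (≤-reflexive eq)) (*-cancelˡ 0<ν (≤-reflexive (sym eq)))
    where
    T : ℕ → ℕ → ℚ
    T i j = expTerm i x * expTerm j y
    D = diagonal T
    0<ν : 0ℚ < ν (suc k)
    0<ν = positive⁻¹ (ν (suc k)) {{normalize-pos (suc k) 1}}
    eq : ν (suc k) * expTerm (suc k) (x + y) ≡ ν (suc k) * D (suc k)
    eq = begin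
      ν (suc k) * expTerm (suc k) (x + y)  ≡⟨ ν-expTerm k (x + y) ⟩
      (x + y) * expTerm k (x + y)          ≡⟨ cong ((x + y) *_) (expTerm-+ k x y) ⟩
      (x + y) * D k                        ≡⟨ *-distribʳ-+ (D k) x y ⟩
      x * D k + y * D k                    ≡⟨ sym (cong₂ _+_ (diagonal-left k x (λ j → expTerm j y)) (diagonal-right k y (λ i → expTerm i x))) ⟩
      diagonal (λ i j → ν i * T i j) (suc k) + diagonal (λ i j → ν j * T i j) (suc k)
                                           ≡⟨ sym (diagonal-+ (suc k) (λ i j → ν i * T i j) (λ i j → ν j * T i j)) ⟩
      diagonal (λ i j → ν i * T i j + ν j * T i j) (suc k)
                                           ≡⟨ diagonal-cong (suc k) (λ i j i+j≡ → trans (sym (*-distribʳ-+ (T i j) (ν i) (ν j)))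
                                                (cong (_* T i j) (trans (sym (ν-+ i j)) (cong ν i+j≡)))) ⟩
      diagonal (λ i j → ν (suc k) * T i j) (suc k)
                                           ≡⟨ diagonal-*ˡ (suc k) (ν (suc k)) T ⟩
      ν (suc k) * D (suc k)                ∎
      where open ≡-Reasoning

  partialSum : (ℕ → ℚ) → ℕ → ℚ
  partialSum f zero    = f 0
  partialSum f (suc M) = partialSum f M + f (suc M)

  partialSum-suc : ∀ f M → partialSum f (suc M) ≡ f 0 + partialSum (f ∘ suc) M
  partialSum-suc f zero    = refl
  partialSum-suc f (suc M) = trans (cong (_+ f (suc (suc M))) (partialSum-suc f M))
    (+-assoc (f 0) (partialSum (f ∘ suc) M) (f (suc (suc M))))

  partialSum-cong : ∀ {f g : ℕ → ℚ} → (∀ k → f k ≡ g k) → ∀ M → partialSum f M ≡ partialSum g M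
  partialSum-cong eq zero    = eq 0
  partialSum-cong eq (suc M) = cong₂ _+_ (partialSum-cong eq M) (eq (suc M))

  partialSum-+ : ∀ a f g M → partialSum (λ k → a * f k + g k) M ≡ a * partialSum f M + partialSum g M
  partialSum-+ a f g zero    = refl
  partialSum-+ a f g (suc M) = trans (cong (_+ (a * f (suc M) + g (suc M))) (partialSum-+ a f g M))
    (solve 5 (λ a s t x y → (a :* s :+ t) :+ (a :* x :+ y) := a :* (s :+ x) :+ (t :+ y)) refl
      a (partialSum f M) (partialSum g M) (f (suc M)) (g (suc M)))

  0≤partialSum : ∀ {f : ℕ → ℚ} → (∀ k → 0ℚ ≤ f k) → ∀ M → 0ℚ ≤ partialSum f M
  0≤partialSum 0≤f zero    = 0≤f 0
  0≤partialSum 0≤f (suc M) = 0≤+ (0≤partialSum 0≤f M) (0≤f (suc M))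

  -- The triangle i + j ≤ M lies inside the square i, j ≤ M, and all terms are nonnegative.
  cauchy-product : ∀ {f g : ℕ → ℚ} → (∀ k → 0ℚ ≤ f k) → (∀ k → 0ℚ ≤ g k) → ∀ M →
    partialSum (diagonal (λ i j → f i * g j)) M ≤ partialSum f M * partialSum g M
  cauchy-product         0≤f 0≤g zero    = ≤-refl
  cauchy-product {f} {g} 0≤f 0≤g (suc M) = begin
    partialSum (diagonal (λ i j → f i * g j)) (suc M)
      ≡⟨ partialSum-suc (diagonal (λ i j → f i * g j)) M ⟩
    f 0 * g 0 + partialSum (λ k → f 0 * g (suc k) + diagonal (λ i j → f (suc i) * g j) k) M
      ≡⟨ cong (_+_ (f 0 * g 0)) (partialSum-+ (f 0) (g ∘ suc) (diagonal (λ i j → f (suc i) * g j)) M) ⟩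
    f 0 * g 0 + (f 0 * G′ + partialSum (diagonal (λ i j → f (suc i) * g j)) M)
      ≤⟨ +-monoʳ-≤ (f 0 * g 0) (+-monoʳ-≤ (f 0 * G′) (≤-trans (cauchy-product {f ∘ suc} (0≤f ∘ suc) 0≤g M)
           (*-monoˡ (0≤partialSum (0≤f ∘ suc) M) (p≤p+q (partialSum g M) (0≤g (suc M)))))) ⟩
    f 0 * g 0 + (f 0 * G′ + F′ * partialSum g (suc M))
      ≡⟨ solve 5 (λ a b s t u → a :* b :+ (a :* s :+ t :* u) := a :* (b :+ s) :+ t :* u) refl (f 0) (g 0) G′ F′ (partialSum g (suc M)) ⟩
    f 0 * (g 0 + G′) + F′ * partialSum g (suc M)
      ≡⟨ cong (λ z → f 0 * z + F′ * partialSum g (suc M)) (sym (partialSum-suc g M)) ⟩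
    f 0 * partialSum g (suc M) + F′ * partialSum g (suc M)
      ≡⟨ sym (*-distribʳ-+ (partialSum g (suc M)) (f 0) F′) ⟩
    (f 0 + F′) * partialSum g (suc M)
      ≡⟨ cong (_* partialSum g (suc M)) (sym (partialSum-suc f M)) ⟩
    partialSum f (suc M) * partialSum g (suc M) ∎
    where
    open ≤-Reasoning
    G′ = partialSum (g ∘ suc) M
    F′ = partialSum (f ∘ suc) M

  expSum-partialSum : ∀ x M → expSum M x ≡ partialSum (λ k → expTerm k x) M
  expSum-partialSum x zero    = refl
  expSum-partialSum x (suc M) = cong (_+ expTerm (suc M) x) (expSum-partialSum x M)

  0≤expTerm : ∀ {x} → 0ℚ ≤ x → ∀ k → 0ℚ ≤ expTerm k x
  0≤expTerm {x} 0≤x = Estimates.0≤t x 0≤x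

  -- The half of e^(x+y) = e^x e^y that survives truncation.
  expSum-+-≤ : ∀ M {x y} → 0ℚ ≤ x → 0ℚ ≤ y → expSum M (x + y) ≤ expSum M x * expSum M y
  expSum-+-≤ M {x} {y} 0≤x 0≤y = subst₂ _≤_
    (sym (trans (expSum-partialSum (x + y) M) (partialSum-cong (λ k → expTerm-+ k x y) M)))
    (sym (cong₂ _*_ (expSum-partialSum x M) (expSum-partialSum y M)))
    (cauchy-product (0≤expTerm 0≤x) (0≤expTerm 0≤y) M)

  1≤expSum : ∀ M {x} → 0ℚ ≤ x → 1ℚ ≤ expSum M x
  1≤expSum zero    0≤x = ≤-refl
  1≤expSum (suc M) {x} 0≤x = ≤-trans (1≤expSum M 0≤x) (p≤p+q (expSum M x) (0≤expTerm 0≤x (suc M)))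

  0≤expSum : ∀ M {x} → 0ℚ ≤ x → 0ℚ ≤ expSum M x
  0≤expSum M 0≤x = ≤-trans 0≤1 (1≤expSum M 0≤x)

  expSum-0 : ∀ M → expSum M 0ℚ ≡ 1ℚ
  expSum-0 zero    = refl
  expSum-0 (suc M) = trans (cong₂ _+_ (expSum-0 M) (trans (cong (_* c M) (*-zeroʳ (expTerm M 0ℚ))) (*-zeroˡ (c M)))) (+-identityʳ 1ℚ)

  c≤1 : ∀ k → c k ≤ 1ℚ
  c≤1 k = subst₂ _≤_ (*-identityˡ (c k)) (ν*c k) (*-monoʳ (0≤c k) (ν-mono 1 {suc k} (ℕ.s≤s ℕ.z≤n)))

  -- Σ xᵏ/k! ≤ Σ xᵏ = 1/(1 - x)
  expSum-geometric : ∀ M {x} → 0ℚ ≤ x → expSum M x * (1ℚ - x) ≤ 1ℚ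
  expSum-geometric M {x} 0≤x = ≤-trans (p≤p+q (expSum M x * (1ℚ - x)) (0≤* 0≤x (0≤expTerm 0≤x M))) (telescope M)
    where
    -- The added summand pays for the next term of the sum, since `c M` ≤ 1.
    telescope : ∀ M → expSum M x * (1ℚ - x) + x * expTerm M x ≤ 1ℚ
    telescope zero    = ≤-reflexive (solve 1 (λ x → con 1ℚ :* (con 1ℚ :- x) :+ x :* con 1ℚ := con 1ℚ) refl x)
    telescope (suc M) = begin
      (expSum M x + t′) * (1ℚ - x) + x * t′
        ≡⟨ solve 3 (λ s t x → (s :+ t) :* (con 1ℚ :- x) :+ x :* t := s :* (con 1ℚ :- x) :+ t) refl (expSum M x) t′ x ⟩
      expSum M x * (1ℚ - x) + t′
        ≤⟨ +-monoʳ-≤ (expSum M x * (1ℚ - x)) (subst (t′ ≤_) (*-identityʳ (expTerm M x * x)) (*-monoˡ (0≤* (0≤expTerm 0≤x M) 0≤x) (c≤1 M))) ⟩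
      expSum M x * (1ℚ - x) + expTerm M x * x
        ≡⟨ cong (_+_ (expSum M x * (1ℚ - x))) (*-comm (expTerm M x) x) ⟩
      expSum M x * (1ℚ - x) + x * expTerm M x
        ≤⟨ telescope M ⟩
      1ℚ ∎
      where
      open ≤-Reasoning
      t′ = expTerm (suc M) x

  1-c : ∀ l → ν l * c l ≡ 1ℚ - c l
  1-c l = trans (solve 2 (λ n c → n :* c := (con 1ℚ :+ n) :* c :- c) refl (ν l) (c l))
    (cong (_- c l) (trans (cong (_* c l) (sym (ν-suc l))) (ν*c l)))

  -- e^(m/n) (1 - 1/n)^m ≤ 1, with n = l + 1
  expSum-decay : ∀ M l m → expSum M (ν m * c l) * (ν l * c l) ^ m ≤ 1ℚ
  expSum-decay M l zero    = ≤-reflexive (trans (*-identityʳ (expSum M (0ℚ * c l))) (trans (cong (expSum M) (*-zeroˡ (c l))) (expSum-0 M)))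
  expSum-decay M l (suc m) = begin
    expSum M (ν (suc m) * c l) * (y * y ^ m)
      ≡⟨ cong (λ z → expSum M z * (y * y ^ m)) (trans (cong (_* c l) (ν-suc m))
           (solve 2 (λ m c → (con 1ℚ :+ m) :* c := c :+ m :* c) refl (ν m) (c l))) ⟩
    expSum M (c l + ν m * c l) * (y * y ^ m)
      ≤⟨ *-monoʳ (0≤* 0≤y (0≤^ m 0≤y)) (expSum-+-≤ M (0≤c l) (0≤* (0≤ν m) (0≤c l))) ⟩
    expSum M (c l) * expSum M (ν m * c l) * (y * y ^ m)
      ≡⟨ solve 4 (λ a b y z → a :* b :* (y :* z) := (a :* y) :* (b :* z)) refl (expSum M (c l)) (expSum M (ν m * c l)) y (y ^ m) ⟩
    expSum M (c l) * y * (expSum M (ν m * c l) * y ^ m)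
      ≤⟨ *-mono 0≤1 (0≤* (0≤expSum M (0≤* (0≤ν m) (0≤c l))) (0≤^ m 0≤y))
           (subst (λ z → expSum M (c l) * z ≤ 1ℚ) (sym (1-c l)) (expSum-geometric M (0≤c l)))
           (expSum-decay M l m) ⟩
    1ℚ * 1ℚ ≡⟨⟩
    1ℚ ∎
    where
    open ≤-Reasoning
    y = ν l * c l
    0≤y = 0≤* (0≤ν l) (0≤c l)

-- From the critical load to a rational margin.

module Criticality where

  open RationalLemmas
  open ExpLemmas
  open RationalExponential
  open import Data.Nat as ℕ using (ℕ; zero; suc; s≤s; z≤n)
  import Data.Nat.Properties as ℕₚ
  open import Data.Integer using (+_)
  open import Data.Empty using (⊥-elim)
  open import Data.Product using (∃; _×_; _,_; proj₁; proj₂)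
  open import Data.Sum using (inj₁; inj₂)
  open import Data.Rational
    using (ℚ; 0ℚ; 1ℚ; ½; _+_; _*_; _-_; -_; ∣_∣; _≤_; _<_; _/_; _⊓_; _≤?_)
  open import Data.Rational.Properties hiding (_≤?_)
  open import Data.Rational.Solver using (module +-*-Solver)
  open import Algebra.Bundles using (CommutativeRing)
  open import Algebra.Properties.CommutativeSemiring.Exp (CommutativeRing.commutativeSemiring +-*-commutativeRing)
    using (_^_)
  open import Relation.Binary.PropositionalEquality
  open import Relation.Nullary.Decidable using (from-yes; from-no)
  open +-*-Solver

  p≤∣p∣ : ∀ p → p ≤ ∣ p ∣
  p≤∣p∣ p with ≤-total 0ℚ p
  ... | inj₁ 0≤p = ≤-reflexive (sym (0≤p⇒∣p∣≡p 0≤p))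
  ... | inj₂ p≤0 = ≤-trans p≤0 (0≤∣p∣ p)

  module E₁ = Estimates 1ℚ 0≤1

  -- The sum up to 4 is 65/24, and the tail is at most the term 1/24.
  expSum-1≤ : ∀ M → 4 ℕ.≤ M → expSum M 1ℚ ≤ + 11 / 4
  expSum-1≤ M 4≤M = ≤-by (+ 11 / 4 - expSum M 1ℚ)
    (subst (0ℚ ≤_) (solve 1 (λ x → con (+ 1 / 24) :- (x :- con (+ 65 / 24)) := con (+ 11 / 4) :- x) refl (expSum M 1ℚ))
      (0≤q-p (≤-trans (p≤∣p∣ (expSum M 1ℚ - expSum 4 1ℚ)) (E₁.tail′ 1ℚ ≤-refl 4 (s≤s (s≤s z≤n)) M 4≤M))))
    (solve 2 (λ x y → x :+ (y :- x) := y) refl (expSum M 1ℚ) (+ 11 / 4))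

  1+x≤expSum : ∀ M {x} → 0ℚ ≤ x → 1ℚ + x ≤ expSum (suc M) x
  1+x≤expSum zero    {x} 0≤x = ≤-reflexive (solve 1 (λ x → con 1ℚ :+ x := con 1ℚ :+ con 1ℚ :* x :* con 1ℚ) refl x)
  1+x≤expSum (suc M) {x} 0≤x = ≤-trans (1+x≤expSum M 0≤x) (p≤p+q (expSum (suc M) x) (0≤expTerm 0≤x (suc (suc M))))

  module _ (M′ : ℕ) (4≤M′ : 4 ℕ.≤ M′) where

    private
      M = suc M′
      E : ℚ → ℚ
      E = expSum M

    -- The constant 3 exceeds e; that it is smaller than 4 is exploited in `4ρ+κ≤`.
    expSum-lipschitz : ∀ {x y} → ∣ x ∣ ≤ 1ℚ → ∣ y ∣ ≤ 1ℚ → x ≤ y → E y ≤ E x + (y - x) * (+ 3 / 1)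
    expSum-lipschitz {x} {y} bx by x≤y = ≤-trans
      (≤-reflexive (solve 2 (λ a b → b := a :+ (b :- a)) refl (E x) (E y)))
      (+-monoʳ-≤ (E x) (≤-trans (p≤∣p∣ (E y - E x))
        (≤-trans (E₁.sum-lipschitz y x by bx M′)
          (subst (λ z → z * expSum M′ 1ℚ ≤ (y - x) * (+ 3 / 1)) (sym (0≤p⇒∣p∣≡p (0≤q-p x≤y)))
            (*-monoˡ (0≤q-p x≤y) (≤-trans (expSum-1≤ M′ 4≤M′) (from-yes (+ 11 / 4 ≤? + 3 / 1))))))))

    -- `a` will be a rational approximation of the critical load, so a ≤ 1 and the critical equation
    -- hold only up to errors, here 1/20 and `κ`.
    module _ (a κ : ℚ) (κ≤⅛ : κ ≤ + 1 / 8) (0≤κ : 0ℚ ≤ κ) (a≤ : a ≤ + 21 / 20)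
             (critical : ν 4 * a * E (1ℚ - a) ≤ E 1ℚ + κ) where

      critical-≤ : ν 4 * a * E (1ℚ - a) ≤ + 23 / 8
      critical-≤ = ≤-trans critical (+-mono-≤ (expSum-1≤ M (ℕₚ.m≤n⇒m≤1+n 4≤M′)) κ≤⅛)

      -- On [½, 1], e^(1-a) ≥ 2 - a gives 4a e^(1-a) ≥ 4a(2-a) ≥ 3. On [1, 21/20] the Lipschitz
      -- bound gives at least 4 · 17/20. Both values exceed 23/8.
      load≤½ : a ≤ ½
      load≤½ with ≤-total a ½
      ... | inj₁ a≤½ = a≤½
      ... | inj₂ ½≤a with ≤-total a 1ℚ
      ...   | inj₁ a≤1 = ⊥-elim (from-no (+ 3 / 1 ≤? + 23 / 8) (≤-trans 3≤ critical-≤))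
        where
        0≤4a = 0≤* (0≤ν 4) (≤-trans (from-yes (0ℚ ≤? ½)) ½≤a)
        3≤ : + 3 / 1 ≤ ν 4 * a * E (1ℚ - a)
        3≤ = ≤-trans
          (≤-by ((+ 4 / 1) * ((a - ½) * ((1ℚ - a) + ½))) (0≤* (0≤ν 4) (0≤* (0≤q-p ½≤a) (0≤+ (0≤q-p a≤1) (from-yes (0ℚ ≤? ½)))))
            (solve 1 (λ a → con (+ 3 / 1) :+ con (+ 4 / 1) :* ((a :- con ½) :* ((con 1ℚ :- a) :+ con ½)) :=
                            con (+ 4 / 1) :* a :* (con 1ℚ :+ (con 1ℚ :- a))) refl a))
          (*-monoˡ 0≤4a (1+x≤expSum M′ (0≤q-p a≤1)))
      ...   | inj₂ 1≤a = ⊥-elim (from-no (+ 17 / 5 ≤? + 23 / 8) (≤-trans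
                (*-mono {a = + 4 / 1} {c = + 17 / 20} (0≤* (0≤ν 4) (≤-trans 0≤1 1≤a)) (from-yes (0ℚ ≤? + 17 / 20))
                  (*-monoˡ (0≤ν 4) 1≤a) 17/20≤) critical-≤))
        where
        a-1≤ : a - 1ℚ ≤ + 1 / 20
        a-1≤ = +-monoˡ-≤ (- 1ℚ) a≤
        17/20≤ : + 17 / 20 ≤ E (1ℚ - a)
        17/20≤ = ≤-+-cancel (+ 3 / 20) (≤-trans (≤-reflexive (sym (expSum-0 M)))
          (≤-trans (expSum-lipschitz
              (subst (_≤ 1ℚ) (trans (sym (0≤p⇒∣p∣≡p (0≤q-p 1≤a))) (∣-∣-swap a 1ℚ)) (≤-trans a-1≤ (from-yes (+ 1 / 20 ≤? 1ℚ))))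
              (from-yes (∣ 0ℚ ∣ ≤? 1ℚ))
              (≤-by (a - 1ℚ) (0≤q-p 1≤a) (solve 1 (λ a → con 1ℚ :- a :+ (a :- con 1ℚ) := con 0ℚ) refl a)))
            (+-monoʳ-≤ (E (1ℚ - a)) (*-monoʳ (0≤ν 3)
              (subst (_≤ + 1 / 20) (solve 1 (λ a → a :- con 1ℚ := con 0ℚ :- (con 1ℚ :- a)) refl a) a-1≤)))))

      module _ (ρ : ℚ) (0≤ρ : 0ℚ ≤ ρ) (ρ≤ : ρ + (κ + κ) ≤ a) where

        ρ≤a : ρ ≤ a
        ρ≤a = ≤-trans (p≤p+q ρ (0≤+ 0≤κ 0≤κ)) ρ≤

        0≤a : 0ℚ ≤ a
        0≤a = ≤-trans 0≤ρ ρ≤a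

        ∣∣≤1 : ∀ {x} → 0ℚ ≤ x → x ≤ ½ → ∣ x ∣ ≤ 1ℚ
        ∣∣≤1 0≤x x≤½ = subst (_≤ 1ℚ) (sym (0≤p⇒∣p∣≡p 0≤x)) (≤-trans x≤½ (from-yes (½ ≤? 1ℚ)))

        0≤1-a : 0ℚ ≤ 1ℚ - a
        0≤1-a = 0≤q-p (≤-trans load≤½ (from-yes (½ ≤? 1ℚ)))

        -- From 4 a e^(1-a) = e ≤ e^a e^(1-a), up to the error κ.
        4a≤ : ν 4 * a ≤ E a + κ
        4a≤ = *-cancelˡ (<-≤-trans 0<1 (1≤expSum M 0≤1-a)) (begin
          w * (ν 4 * a)     ≡⟨ *-comm w (ν 4 * a) ⟩
          ν 4 * a * w       ≤⟨ critical ⟩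
          E 1ℚ + κ          ≡⟨ cong (λ z → E z + κ) (solve 1 (λ a → con 1ℚ := a :+ (con 1ℚ :- a)) refl a) ⟩
          E (a + (1ℚ - a)) + κ ≤⟨ +-mono-≤ (expSum-+-≤ M 0≤a 0≤1-a) κ≤ ⟩
          E a * w + w * κ   ≡⟨ solve 3 (λ e w k → e :* w :+ w :* k := w :* (e :+ k)) refl (E a) w κ ⟩
          w * (E a + κ)     ∎)
          where
          open ≤-Reasoning
          w = E (1ℚ - a)
          κ≤ : κ ≤ w * κ
          κ≤ = subst (_≤ w * κ) (*-identityˡ κ) (*-monoʳ 0≤κ (1≤expSum M 0≤1-a))

        -- Going from `a` down to `ρ`, 4x falls at rate 4 and `E` at rate at most 3. A distance of
        -- at least 2κ thus turns the error κ in `4a≤` into a margin κ.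
        4ρ+κ≤ : ν 4 * ρ + κ ≤ E ρ
        4ρ+κ≤ = ≤-by ((E ρ + (a - ρ) * (+ 3 / 1) - E a) + (E a + κ - ν 4 * a) + (a - (ρ + (κ + κ))))
          (0≤+ (0≤+ (0≤q-p (expSum-lipschitz (∣∣≤1 0≤ρ (≤-trans ρ≤a load≤½)) (∣∣≤1 0≤a load≤½) ρ≤a)) (0≤q-p 4a≤)) (0≤q-p ρ≤))
          (solve 5 (λ r k x y a →
            con (+ 4 / 1) :* r :+ k :+ ((x :+ (a :- r) :* con (+ 3 / 1) :- y) :+ (y :+ k :- con (+ 4 / 1) :* a) :+ (a :- (r :+ (k :+ k))))
            := x) refl ρ κ (E ρ) (E a) a)

        ρ+ρ≤1 : ρ + ρ ≤ 1ℚ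
        ρ+ρ≤1 = +-mono-≤ {ρ} {½} {ρ} {½} (≤-trans ρ≤a load≤½) (≤-trans ρ≤a load≤½)

        Eρ≤4 : E ρ ≤ ν 4
        Eρ≤4 = ≤-trans (expSum-lipschitz {0ℚ} (from-yes (∣ 0ℚ ∣ ≤? 1ℚ)) (∣∣≤1 0≤ρ ρ≤½) 0≤ρ)
          (≤-trans (+-mono-≤ (≤-reflexive (expSum-0 M))
              (*-monoʳ (0≤ν 3) (subst (_≤ ½) (solve 1 (λ r → r := r :- con 0ℚ) refl ρ) ρ≤½)))
            (from-yes (1ℚ + ½ * (+ 3 / 1) ≤? ν 4)))
          where ρ≤½ = ≤-trans ρ≤a load≤½

        -- Since `E ρ` ≤ 4, the additive margin κ is at least the fraction κ/4 of `E ρ`; hence the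
        -- choice θ = κ/4.
        4ρ≤ : ν 4 * ρ ≤ (1ℚ - κ * (+ 1 / 4)) * E ρ
        4ρ≤ = ≤-by ((E ρ - (ν 4 * ρ + κ)) + κ * (+ 1 / 4) * (ν 4 - E ρ))
          (0≤+ (0≤q-p 4ρ+κ≤) (0≤* (0≤* 0≤κ (from-yes (0ℚ ≤? + 1 / 4))) (0≤q-p Eρ≤4)))
          (solve 3 (λ r k x → con (+ 4 / 1) :* r :+ ((x :- (con (+ 4 / 1) :* r :+ k)) :+ k :* con (+ 1 / 4) :* (con (+ 4 / 1) :- x)) :=
            (con 1ℚ :- k :* con (+ 1 / 4)) :* x) refl ρ κ (E ρ))

  -- The rational facts to which the hypothesis on the real load is reduced, with n = `suc l`; the
  -- second bounds the ratio of the geometric tail.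
  Subcritical : ℚ → ℕ → ℕ → Set
  Subcritical θ l m = ν m * c l + ν m * c l ≤ 1ℚ × ν 4 * (ν m * c l) * (ν l * c l) ^ m ≤ 1ℚ - θ

  -- The margin must be uniform in the table size. It is therefore fixed from `α` and `α*` alone, at
  -- one index `M`, before `l` and `m` are given.
  subcritical : (α* : ℝ) → IsCriticalLoad α* → (α : ℝ) → α <ℝ α* →
    ∃ λ θ → 0ℚ < θ × θ ≤ ½ × (∀ l m → fromℕ m ≈ α *ℝ fromℕ (suc l) → Subcritical θ l m)
  subcritical α* (_ , α*≤1 , root) α (δ , 0<δ , N₁ , gap) = θ , 0<θ , θ≤½ , bound
    where
    -- The gap δ has to pay for 4κ: one κ for the load equation, one for the Cauchy property of `α`,
    -- and the distance 2κ between `ρ` and `a`. The bound 1/8 keeps 11/4 + κ below 3.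
    κ = (δ * (+ 1 / 4)) ⊓ (+ 1 / 8)
    0<κ : 0ℚ < κ
    0<κ with ⊓-sel (δ * (+ 1 / 4)) (+ 1 / 8)
    ... | inj₁ eq = subst (0ℚ <_) (sym eq) (0<* 0<δ (positive⁻¹ (+ 1 / 4)))
    ... | inj₂ eq = subst (0ℚ <_) (sym eq) (positive⁻¹ (+ 1 / 8))
    0≤κ = <⇒≤ 0<κ
    κ≤⅛ : κ ≤ + 1 / 8
    κ≤⅛ = p⊓q≤q (δ * (+ 1 / 4)) (+ 1 / 8)
    κ≤δ/4 : κ ≤ δ * (+ 1 / 4)
    κ≤δ/4 = p⊓q≤p (δ * (+ 1 / 4)) (+ 1 / 8)
    θ = κ * (+ 1 / 4)
    0<θ : 0ℚ < θ
    0<θ = 0<* 0<κ (positive⁻¹ (+ 1 / 4))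
    θ≤½ : θ ≤ ½
    θ≤½ = ≤-trans (*-monoʳ (from-yes (0ℚ ≤? + 1 / 4)) κ≤⅛) (from-yes (+ 1 / 8 * (+ 1 / 4) ≤? ½))
    near-1 = α*≤1 (+ 1 / 20) (positive⁻¹ (+ 1 / 20))
    near-α = cauchy α κ 0<κ
    -- Clearing 1/e multiplies the error by `E 1ℚ` ≤ 3.
    ε = κ * (+ 1 / 3)
    near-root = root ε (0<* 0<κ (positive⁻¹ (+ 1 / 3)))
    N₂ = proj₁ near-1
    N₃ = proj₁ near-α
    N₄ = proj₁ near-root
    M′ = (N₁ ℕ.⊔ N₂) ℕ.⊔ (N₃ ℕ.⊔ N₄) ℕ.⊔ 4
    M = suc M′
    N≤M′ : (N₁ ℕ.⊔ N₂) ℕ.⊔ (N₃ ℕ.⊔ N₄) ℕ.≤ M′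
    N≤M′ = ℕₚ.m≤m⊔n _ 4
    4≤M′ : 4 ℕ.≤ M′
    4≤M′ = ℕₚ.m≤n⊔m _ 4
    N≤M : (N₁ ℕ.⊔ N₂) ℕ.⊔ (N₃ ℕ.⊔ N₄) ℕ.≤ M
    N≤M = ℕₚ.m≤n⇒m≤1+n N≤M′
    N₁≤M : N₁ ℕ.≤ M
    N₁≤M = ⊔-l N₁ N₂ (⊔-l (N₁ ℕ.⊔ N₂) (N₃ ℕ.⊔ N₄) N≤M)
    N₂≤M : N₂ ℕ.≤ M
    N₂≤M = ⊔-r N₁ N₂ (⊔-l (N₁ ℕ.⊔ N₂) (N₃ ℕ.⊔ N₄) N≤M)
    N₃≤M : N₃ ℕ.≤ M
    N₃≤M = ⊔-l N₃ N₄ (⊔-r (N₁ ℕ.⊔ N₂) (N₃ ℕ.⊔ N₄) N≤M)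
    N₄≤M : N₄ ℕ.≤ M
    N₄≤M = ⊔-r N₃ N₄ (⊔-r (N₁ ℕ.⊔ N₂) (N₃ ℕ.⊔ N₄) N≤M)
    a = seq α* M
    b = seq α M
    E = expSum M
    w = E (1ℚ - a)
    s = seq (recip e 0<e) M
    1≤E1 : 1ℚ ≤ E 1ℚ
    1≤E1 = 1≤expSum M 0≤1
    -- `recip` shifts the index by the bound stored in `0<e`, which is 0, so `s` inverts this very
    -- partial sum.
    sE1 : E 1ℚ * s ≡ 1ℚ
    sE1 = inv-r (<-≤-trans 0<1 1≤E1)
    critical : ν 4 * a * w ≤ E 1ℚ + κ
    critical = ≤-by ((+ 3 / 1 - E 1ℚ) * ε + E 1ℚ * (1ℚ + ε - ν 4 * s * a * w))
      (0≤+ (0≤* (0≤q-p (≤-trans (expSum-1≤ M (ℕₚ.m≤n⇒m≤1+n 4≤M′)) (from-yes (+ 11 / 4 ≤? + 3 / 1))))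
                (0≤* 0≤κ (from-yes (0ℚ ≤? + 1 / 3))))
           (0≤* (≤-trans 0≤1 1≤E1) (0≤q-p upper)))
      (trans (solve 5 (λ x s a w k →
          con (+ 4 / 1) :* a :* w :+ ((con (+ 3 / 1) :- x) :* (k :* con (+ 1 / 3)) :+ x :* (con 1ℚ :+ k :* con (+ 1 / 3) :- con (+ 4 / 1) :* s :* a :* w)) :=
          x :+ k :+ con (+ 4 / 1) :* a :* w :* (con 1ℚ :- x :* s)) refl (E 1ℚ) s a w κ)
        (trans (cong (λ z → E 1ℚ + κ + ν 4 * a * w * (1ℚ - z)) sE1)
          (solve 2 (λ x y → x :+ y :* (con 1ℚ :- con 1ℚ) := x) refl (E 1ℚ + κ) (ν 4 * a * w))))
      where
      upper : ν 4 * s * a * w ≤ 1ℚ + ε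
      upper = ≤-trans (≤-reflexive (solve 1 (λ x → x := con 1ℚ :+ (x :- con 1ℚ)) refl (ν 4 * s * a * w)))
        (+-monoʳ-≤ 1ℚ (≤-trans (p≤∣p∣ (ν 4 * s * a * w - 1ℚ)) (proj₂ near-root M N₄≤M)))
    bound : ∀ l m → fromℕ m ≈ α *ℝ fromℕ (suc l) → Subcritical θ l m
    bound l m load = ρ+ρ≤1 M′ 4≤M′ a κ κ≤⅛ 0≤κ a≤ critical ρ 0≤ρ ρ≤ , (begin
      ν 4 * ρ * Y                ≤⟨ *-monoʳ (0≤^ m (0≤* (0≤ν l) (0≤c l))) (4ρ≤ M′ 4≤M′ a κ κ≤⅛ 0≤κ a≤ critical ρ 0≤ρ ρ≤) ⟩
      (1ℚ - θ) * E ρ * Y         ≡⟨ *-assoc (1ℚ - θ) (E ρ) Y ⟩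
      (1ℚ - θ) * (E ρ * Y)       ≤⟨ *-monoˡ (0≤q-p (≤-trans θ≤½ (from-yes (½ ≤? 1ℚ)))) (expSum-decay M l m) ⟩
      (1ℚ - θ) * 1ℚ              ≡⟨ *-identityʳ (1ℚ - θ) ⟩
      1ℚ - θ                     ∎)
      where
      open ≤-Reasoning
      ρ = ν m * c l
      Y = (ν l * c l) ^ m
      0≤ρ = 0≤* (0≤ν m) (0≤c l)
      a≤ : a ≤ + 21 / 20
      a≤ = proj₂ near-1 M N₂≤M
      -- The load equation is accurate only from an index that depends on `l` and `m`; the Cauchy
      -- property of `α` leads back to the fixed index `M`.
      i = proj₁ (load κ 0<κ) ℕ.⊔ M
      bᵢ = seq α i
      ρ≤bᵢ+κ : ρ ≤ bᵢ + κ
      ρ≤bᵢ+κ = begin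
        ν m * c l                              ≡⟨ solve 2 (λ x y → x := y :+ (x :- y)) refl (ν m * c l) (bᵢ * (ν (suc l) * c l)) ⟩
        bᵢ * (ν (suc l) * c l) + (ν m * c l - bᵢ * (ν (suc l) * c l))
          ≡⟨ cong₂ _+_ (trans (cong (bᵢ *_) (ν*c l)) (*-identityʳ bᵢ))
               (solve 4 (λ m c b n → m :* c :- b :* (n :* c) := (m :- b :* n) :* c) refl (ν m) (c l) bᵢ (ν (suc l))) ⟩
        bᵢ + (ν m - bᵢ * ν (suc l)) * c l      ≤⟨ +-monoʳ-≤ bᵢ (*-monoʳ (0≤c l) (≤-trans (p≤∣p∣ (ν m - bᵢ * ν (suc l)))
                                                    (proj₂ (load κ 0<κ) i (ℕₚ.m≤m⊔n _ M)))) ⟩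
        bᵢ + κ * c l                           ≤⟨ +-monoʳ-≤ bᵢ (subst (κ * c l ≤_) (*-identityʳ κ) (*-monoˡ 0≤κ (c≤1 l))) ⟩
        bᵢ + κ                                 ∎
      bᵢ≤b+κ : bᵢ - b ≤ κ
      bᵢ≤b+κ = ≤-trans (p≤∣p∣ (bᵢ - b)) (proj₂ near-α i M (ℕₚ.≤-trans N₃≤M (ℕₚ.m≤n⊔m _ M)) N₃≤M)
      ρ≤ : ρ + (κ + κ) ≤ a
      ρ≤ = ≤-by ((bᵢ + κ - ρ) + (κ - (bᵢ - b)) + (+ 4 / 1) * (δ * (+ 1 / 4) - κ) + (a - (b + δ)))
        (0≤+ (0≤+ (0≤+ (0≤q-p ρ≤bᵢ+κ) (0≤q-p bᵢ≤b+κ)) (0≤* (0≤ν 4) (0≤q-p κ≤δ/4))) (0≤q-p (gap M N₁≤M)))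
        (solve 6 (λ r k x b d a → r :+ (k :+ k) :+ ((x :+ k :- r) :+ (k :- (x :- b)) :+ con (+ 4 / 1) :* (d :* con (+ 1 / 4) :- k) :+ (a :- (b :+ d)))
          := a) refl ρ κ bᵢ b δ a)

-- Geometric domination over the rationals.

open RationalLemmas
open ExpLemmas
open Counting
open Clusters
open UnluckyHashFunctions
open ClusterDensity
open RationalExponential
open Criticality
open import Data.Empty using (⊥-elim)
open import Data.Fin using (Fin; finToFun)
open import Data.Fin.Permutation using (Permutation′)
open import Data.Integer as ℤ using (+_)
import Data.Integer.Properties as ℤₚ
open import Data.List using (allFin)
open import Data.List.Properties using (length-filter; length-map; length-tabulate)
open import Data.Nat as ℕ using (ℕ; zero; suc; NonZero; s≤s; z≤n; _<?_; _∸_)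
import Data.Nat.Properties as ℕₚ
open import Data.Product using (∃; ∃-syntax; _×_; _,_; proj₁)
open import Data.Sum using (inj₁; inj₂; [_,_]′)
open import Data.Rational
  using (ℚ; 0ℚ; 1ℚ; ½; _+_; _*_; _-_; -_; _≤_; _<_; _/_; _≤?_)
open import Data.Rational.Properties hiding (_≤?_; _<?_)
import Data.Rational.Unnormalised as ℚᵘ
import Data.Rational.Unnormalised.Properties as ℚᵘₚ
open import Data.Rational.Solver using (module +-*-Solver)
open import Data.Vec using (Vec; _∷ʳ_)
open import Data.Vec.Relation.Unary.Unique.Propositional using (Unique)
open import Algebra.Bundles using (CommutativeRing)
open import Algebra.Properties.CommutativeSemiring.Exp (CommutativeRing.commutativeSemiring +-*-commutativeRing)
  using (_^_; ^-homo-*; ^-assocʳ; ^-distrib-*)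
open import Function using (_∘_; id)
open import Relation.Binary.PropositionalEquality
open import Relation.Nullary using (yes; no)
open import Relation.Nullary.Decidable using (from-yes; from-no)
open +-*-Solver

ν-cancel-≤ : ∀ {a b} → ν a ≤ ν b → a ℕ.≤ b
ν-cancel-≤ {a} {b} le with a ℕₚ.≤? b
... | yes a≤b = a≤b
... | no  a≰b = ⊥-elim (<-irrefl refl (<-≤-trans b<1+b (≤-trans (ν-mono (suc b) {a} (ℕₚ.≰⇒> a≰b)) le)))
  where
  b<1+b : ν b < ν (suc b)
  b<1+b = subst₂ _<_ (+-identityˡ (ν b)) (sym (ν-suc b)) (+-monoˡ-< (ν b) 0<1)

0<ν : ∀ n .{{_ : NonZero n}} → 0ℚ < ν n
0<ν n = positive⁻¹ (ν n) {{normalize-pos n 1}}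

/-* : ∀ b n .{{_ : NonZero n}} → (+ b / n) * ν n ≡ ν b
/-* b (suc d) = toℚᵘ-injective (ℚᵘₚ.≃-trans (toℚᵘ-homo-* (+ b / suc d) (ν (suc d)))
  (ℚᵘₚ.≃-trans
    (ℚᵘₚ.*-cong (toℚᵘ-fromℚᵘ (ℚᵘ.mkℚᵘ (+ b) d)) (toℚᵘ-fromℚᵘ (ℚᵘ.mkℚᵘ (+ suc d) 0)))
    (ℚᵘₚ.≃-trans
      (ℚᵘ.*≡* (trans (ℤₚ.*-identityʳ (+ b ℤ.* + suc d)) (cong (+ b ℤ.*_) (sym (ℤₚ.*-identityʳ (+ suc d))))))
      (ℚᵘₚ.≃-sym (toℚᵘ-fromℚᵘ (ℚᵘ.mkℚᵘ (+ b) 0))))))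

-- The geometric series with ratio 1 - θ sums to 1/θ.
splitSum-geometric : ∀ {θ} → 0ℚ ≤ θ → θ ≤ 1ℚ → ∀ t {F : ℕ → ℕ → ℕ} K → 0ℚ ≤ K →
  (∀ i j → i ℕ.+ j ≡ t → ν (F i j) ≤ K * (1ℚ - θ) ^ i) → θ * ν (splitSum F t) ≤ K
splitSum-geometric {θ} 0≤θ θ≤1 zero {F} K 0≤K le = begin
  θ * ν (F 0 0)  ≤⟨ *-mono {b = 1ℚ} 0≤1 (0≤ν (F 0 0)) θ≤1 (le 0 0 refl) ⟩
  1ℚ * (K * 1ℚ)  ≡⟨ trans (*-identityˡ (K * 1ℚ)) (*-identityʳ K) ⟩
  K              ∎
  where open ≤-Reasoning
splitSum-geometric {θ} 0≤θ θ≤1 (suc t) {F} K 0≤K le = begin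
  θ * ν (F 0 (suc t) ℕ.+ S)           ≡⟨ trans (cong (θ *_) (ν-+ (F 0 (suc t)) S)) (*-distribˡ-+ θ (ν (F 0 (suc t))) (ν S)) ⟩
  θ * ν (F 0 (suc t)) + θ * ν S       ≤⟨ +-mono-≤ (*-monoˡ 0≤θ (le 0 (suc t) refl))
                                           (splitSum-geometric 0≤θ θ≤1 t (K * (1ℚ - θ)) (0≤* 0≤K (0≤q-p θ≤1)) shifted) ⟩
  θ * (K * 1ℚ) + K * (1ℚ - θ)         ≡⟨ solve 2 (λ θ K → θ :* (K :* con 1ℚ) :+ K :* (con 1ℚ :- θ) := K) refl θ K ⟩
  K                                   ∎
  where
  open ≤-Reasoning
  S = splitSum (F ∘ suc) t
  shifted : ∀ i j → i ℕ.+ j ≡ t → ν (F (suc i) j) ≤ K * (1ℚ - θ) * (1ℚ - θ) ^ i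
  shifted i j eq = subst (ν (F (suc i) j) ≤_) (sym (*-assoc K (1ℚ - θ) ((1ℚ - θ) ^ i))) (le (suc i) j (cong suc eq))

bernoulli-≤ : ∀ k {x} → 0ℚ ≤ x → x ≤ 1ℚ → 1ℚ - ν k * x ≤ (1ℚ - x) ^ k
bernoulli-≤ zero    {x} 0≤x x≤1 = ≤-reflexive (solve 1 (λ x → con 1ℚ :- con 0ℚ :* x := con 1ℚ) refl x)
bernoulli-≤ (suc k) {x} 0≤x x≤1 = begin
  1ℚ - ν (suc k) * x                ≡⟨ cong (λ z → 1ℚ - z * x) (ν-suc k) ⟩
  1ℚ - (1ℚ + ν k) * x               ≤⟨ ≤-by (ν k * (x * x)) (0≤* (0≤ν k) (0≤* 0≤x 0≤x))
                                         (solve 2 (λ n x → con 1ℚ :- (con 1ℚ :+ n) :* x :+ n :* (x :* x) := (con 1ℚ :- x) :* (con 1ℚ :- n :* x)) refl (ν k) x) ⟩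
  (1ℚ - x) * (1ℚ - ν k * x)         ≤⟨ *-monoˡ (0≤q-p x≤1) (bernoulli-≤ k 0≤x x≤1) ⟩
  (1ℚ - x) * (1ℚ - x) ^ k           ∎
  where open ≤-Reasoning

-- (1 - x)^k ≤ (1 + x)^(-k) ≤ 1/(1 + kx)
^-decay : ∀ k {x} → 0ℚ ≤ x → x ≤ 1ℚ → (1ℚ + ν k * x) * (1ℚ - x) ^ k ≤ 1ℚ
^-decay zero    {x} 0≤x x≤1 = ≤-reflexive (solve 1 (λ x → (con 1ℚ :+ con 0ℚ :* x) :* con 1ℚ := con 1ℚ) refl x)
^-decay (suc k) {x} 0≤x x≤1 = begin
  (1ℚ + ν (suc k) * x) * ((1ℚ - x) * P)       ≡⟨ cong (λ z → (1ℚ + z * x) * ((1ℚ - x) * P)) (ν-suc k) ⟩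
  (1ℚ + (1ℚ + ν k) * x) * ((1ℚ - x) * P)      ≤⟨ ≤-by ((x * x + ν k * (x * x)) * P) (0≤* (0≤+ (0≤* 0≤x 0≤x) (0≤* (0≤ν k) (0≤* 0≤x 0≤x))) (0≤^ k (0≤q-p x≤1)))
                                                   (solve 3 (λ n x P → (con 1ℚ :+ (con 1ℚ :+ n) :* x) :* ((con 1ℚ :- x) :* P) :+ (x :* x :+ n :* (x :* x)) :* P :=
                                                     (con 1ℚ :+ n :* x) :* P) refl (ν k) x P) ⟩
  (1ℚ + ν k * x) * P                          ≤⟨ ^-decay k 0≤x x≤1 ⟩
  1ℚ                                          ∎
  where
  open ≤-Reasoning
  P = (1ℚ - x) ^ k

-- A bound P ≤ ½ for small k and 4 (1 - θ)^k / θ for large k is turned into (1 - p)^k.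
module Domination (θ : ℚ) (0<θ : 0ℚ < θ) (θ≤½ : θ ≤ ½)
                  (θ⁻¹ : ℚ) (θθ⁻¹ : θ * θ⁻¹ ≡ 1ℚ) (L : ℕ) (L≥ : + 8 / 1 * (θ⁻¹ * θ⁻¹) ≤ ν L) where

  private
    0≤θ = <⇒≤ 0<θ
    -- Half of θ, since (1-x)² ≥ 1-θ: one factor (1-x)^k becomes the bound, and the other absorbs
    -- the constant 4/θ.
    x = θ * ½
    0≤x = 0≤* 0≤θ (from-yes (0ℚ ≤? ½))
    x≤½ : x ≤ ½
    x≤½ = ≤-trans (*-monoʳ (from-yes (0ℚ ≤? ½)) θ≤½) (from-yes (½ * ½ ≤? ½))
    x≤1 = ≤-trans x≤½ (from-yes (½ ≤? 1ℚ))

  -- Dividing by L + 1 keeps k p ≤ x ≤ ½ for all k ≤ L, so (1-p)^k ≥ 1 - kp ≥ ½ there.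
  p : ℚ
  p = x * c L

  0<p : 0ℚ < p
  0<p = 0<* (0<* 0<θ (positive⁻¹ ½)) (positive⁻¹ (c L) {{normalize-pos 1 (suc L)}})

  p≤x : p ≤ x
  p≤x = subst (p ≤_) (*-identityʳ x) (*-monoˡ 0≤x (c≤1 L))

  p≤1 : p ≤ 1ℚ
  p≤1 = ≤-trans p≤x x≤1

  small : ∀ k {P} → k ℕ.≤ L → P ≤ ½ → P ≤ (1ℚ - p) ^ k
  small k k≤L P≤½ = ≤-trans P≤½ (≤-trans ½≤ (bernoulli-≤ k (<⇒≤ 0<p) p≤1))
    where
    kp≤½ : ν k * p ≤ ½
    kp≤½ = begin
      ν k * (x * c L)       ≤⟨ *-monoʳ (0≤* 0≤x (0≤c L)) (ν-mono k {suc L} (ℕₚ.m≤n⇒m≤1+n k≤L)) ⟩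
      ν (suc L) * (x * c L) ≡⟨ solve 3 (λ n x c → n :* (x :* c) := x :* (n :* c)) refl (ν (suc L)) x (c L) ⟩
      x * (ν (suc L) * c L) ≡⟨ trans (cong (x *_) (ν*c L)) (*-identityʳ x) ⟩
      x                     ≤⟨ x≤½ ⟩
      ½                     ∎
      where open ≤-Reasoning
    ½≤ : ½ ≤ 1ℚ - ν k * p
    ½≤ = ≤-by (½ - ν k * p) (0≤q-p kp≤½) (solve 1 (λ z → con ½ :+ (con ½ :- z) := con 1ℚ :- z) refl (ν k * p))

  -- For k ≥ L ≥ 8/θ² one has kx ≥ 4/θ, hence (1-x)^k ≤ 1/(kx) ≤ θ/4 by `^-decay`.
  large : ∀ k {P} → L ℕ.≤ k → θ * P ≤ ν 4 * (1ℚ - θ) ^ k → P ≤ (1ℚ - p) ^ k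
  large k {P} L≤k le = *-cancelˡ 0<θ (begin
    θ * P                             ≤⟨ le ⟩
    ν 4 * (1ℚ - θ) ^ k                ≤⟨ *-monoˡ (0≤ν 4) (^-mono k (0≤q-p (≤-trans θ≤½ (from-yes (½ ≤? 1ℚ)))) square) ⟩
    ν 4 * ((1ℚ - x) * (1ℚ - x)) ^ k   ≡⟨ cong (ν 4 *_) (^-distrib-* (1ℚ - x) (1ℚ - x) k) ⟩
    ν 4 * (D * D)                     ≡⟨ sym (*-assoc (ν 4) D D) ⟩
    ν 4 * D * D                       ≤⟨ *-monoʳ 0≤D 4D≤θ ⟩
    θ * D                             ≤⟨ *-monoˡ 0≤θ (^-mono k (0≤q-p x≤1) (+-monoʳ-≤ 1ℚ (neg-antimono-≤ p≤x))) ⟩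
    θ * (1ℚ - p) ^ k                  ∎)
    where
    open ≤-Reasoning
    D = (1ℚ - x) ^ k
    0≤D = 0≤^ k (0≤q-p x≤1)
    square : 1ℚ - θ ≤ (1ℚ - x) * (1ℚ - x)
    square = ≤-by (x * x) (0≤* 0≤x 0≤x)
      (solve 1 (λ θ → con 1ℚ :- θ :+ θ :* con ½ :* (θ :* con ½) := (con 1ℚ :- θ :* con ½) :* (con 1ℚ :- θ :* con ½)) refl θ)
    4≤ : ν 4 ≤ θ * (ν k * x)
    4≤ = begin
      ν 4                                           ≡⟨⟩
      + 8 / 1 * ½ * (1ℚ * 1ℚ)                       ≡⟨ cong (λ z → + 8 / 1 * ½ * (z * z)) (sym θθ⁻¹) ⟩
      + 8 / 1 * ½ * (θ * θ⁻¹ * (θ * θ⁻¹))           ≡⟨ solve 2 (λ t i → con (+ 8 / 1) :* con ½ :* (t :* i :* (t :* i)) := con (+ 8 / 1) :* (i :* i) :* (t :* (t :* con ½))) refl θ θ⁻¹ ⟩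
      + 8 / 1 * (θ⁻¹ * θ⁻¹) * (θ * x)               ≤⟨ *-monoʳ (0≤* 0≤θ 0≤x) (≤-trans L≥ (ν-mono L {k} L≤k)) ⟩
      ν k * (θ * x)                                 ≡⟨ solve 3 (λ n t x → n :* (t :* x) := t :* (n :* x)) refl (ν k) θ x ⟩
      θ * (ν k * x)                                 ∎
    4D≤θ : ν 4 * D ≤ θ
    4D≤θ = begin
      ν 4 * D                          ≤⟨ *-monoʳ 0≤D 4≤ ⟩
      θ * (ν k * x) * D                ≡⟨ *-assoc θ (ν k * x) D ⟩
      θ * (ν k * x * D)                ≤⟨ *-monoˡ 0≤θ (≤-trans (*-monoʳ 0≤D (≤-by {ν k * x} 1ℚ 0≤1 (+-comm (ν k * x) 1ℚ))) (^-decay k 0≤x x≤1)) ⟩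
      θ * 1ℚ                           ≡⟨ *-identityʳ θ ⟩
      θ                                ∎

  dominated : ∀ k {P} → P ≤ 1ℚ → (1 ℕ.≤ k → P ≤ ½) → θ * P ≤ ν 4 * (1ℚ - θ) ^ k → P ≤ (1ℚ - p) ^ k
  dominated zero    P≤1 _   _  = P≤1
  dominated (suc k) _   P≤½ le with ℕₚ.≤-total (suc k) L
  ... | inj₁ k≤L = small (suc k) k≤L (P≤½ (s≤s z≤n))
  ... | inj₂ L≤k = large (suc k) L≤k le

domination : ∀ θ → 0ℚ < θ → θ ≤ ½ → ∃ λ p → 0ℚ < p × p ≤ 1ℚ ×
  (∀ k {P} → P ≤ 1ℚ → (1 ℕ.≤ k → P ≤ ½) → θ * P ≤ ν 4 * (1ℚ - θ) ^ k → P ≤ (1ℚ - p) ^ k)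
domination θ 0<θ θ≤½ with archimedean (+ 8 / 1 * (inv 0<θ * inv 0<θ))
... | L , L≥ = p , 0<p , p≤1 , dominated
  where open Domination θ 0<θ θ≤½ (inv 0<θ) (inv-r 0<θ) L L≥

-- Division of `cluster-density` by n^(i+im) turns its right-hand side into an i-th power of the
-- ratio bounded in `Subcritical`.
clusterBound-density : ∀ l {θ} i j → θ ≤ 1ℚ → Subcritical θ l (i ℕ.+ j) →
  ν (clusterBound (suc l) i j) ≤
  ν 4 * ν (suc l ℕ.^ (i ℕ.+ j)) * (1ℚ - θ) ^ i
clusterBound-density l {θ} i j θ≤1 (half , sub) = begin
  ν CB
    ≤⟨ ν-cancel {CB} {R} l (i ℕ.+ i ℕ.* m) (subst (λ z → CB ℕ.* z ℕ.≤ R) exponent (cluster-density l i j 2m≤n)) ⟩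
  ν R * c l ^ (i ℕ.+ i ℕ.* m)
    ≡⟨ cong₂ _*_ νR (trans (^-homo-* (c l) i (i ℕ.* m)) (cong (c l ^ i *_) (power (c l)))) ⟩
  ν 4 * ν 4 ^ i * ν m ^ i * (ν l ^ m) ^ i * ν N * (c l ^ i * (c l ^ m) ^ i)
    ≡⟨ solve 7 (λ a b x y z u v → a :* b :* x :* y :* z :* (u :* v) := a :* z :* (b :* (x :* u) :* (y :* v))) refl
         (ν 4) (ν 4 ^ i) (ν m ^ i) ((ν l ^ m) ^ i) (ν N) (c l ^ i) ((c l ^ m) ^ i) ⟩
  ν 4 * ν N * (ν 4 ^ i * (ν m ^ i * c l ^ i) * ((ν l ^ m) ^ i * (c l ^ m) ^ i))
    ≡⟨ cong (ν 4 * ν N *_) (sym collect) ⟩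
  ν 4 * ν N * (ν 4 * (ν m * c l) * (ν l * c l) ^ m) ^ i
    ≤⟨ *-monoˡ (0≤* (0≤ν 4) (0≤ν N)) (^-mono i
         (0≤* (0≤* (0≤ν 4) (0≤* (0≤ν m) (0≤c l))) (0≤^ m (0≤* (0≤ν l) (0≤c l)))) sub) ⟩
  ν 4 * ν N * (1ℚ - θ) ^ i ∎
  where
  open ≤-Reasoning
  m = i ℕ.+ j
  N = suc l ℕ.^ m
  CB = clusterBound (suc l) i j
  R = 4 ℕ.* 4 ℕ.^ i ℕ.* m ℕ.^ i ℕ.* (l ℕ.^ i) ℕ.^ m ℕ.* N
  power : ∀ x → x ^ (i ℕ.* m) ≡ (x ^ m) ^ i
  power x = trans (cong (x ^_) (ℕₚ.*-comm i m)) (sym (^-assocʳ x m i))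
  exponent : suc l ℕ.^ i ℕ.* (suc l ℕ.^ i) ℕ.^ m ≡ suc l ℕ.^ (i ℕ.+ i ℕ.* m)
  exponent = trans (cong (suc l ℕ.^ i ℕ.*_) (ℕₚ.^-*-assoc (suc l) i m)) (sym (ℕₚ.^-distribˡ-+-* (suc l) i (i ℕ.* m)))
  2m≤n : 2 ℕ.* m ℕ.≤ suc l
  2m≤n = ν-cancel-≤ {2 ℕ.* m} {suc l} (begin
    ν (2 ℕ.* m)                             ≡⟨ ν-* 2 m ⟩
    ν 2 * ν m                               ≡⟨ trans (sym (*-identityʳ (ν 2 * ν m))) (cong (ν 2 * ν m *_) (sym (ν*c l))) ⟩
    ν 2 * ν m * (ν (suc l) * c l)           ≡⟨ solve 3 (λ m n c → con (+ 2 / 1) :* m :* (n :* c) := n :* (m :* c :+ m :* c)) refl (ν m) (ν (suc l)) (c l) ⟩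
    ν (suc l) * (ν m * c l + ν m * c l)     ≤⟨ *-monoˡ (0≤ν (suc l)) half ⟩
    ν (suc l) * 1ℚ                          ≡⟨ *-identityʳ (ν (suc l)) ⟩
    ν (suc l)                               ∎)
  νR : ν R ≡ ν 4 * ν 4 ^ i * ν m ^ i * (ν l ^ m) ^ i * ν N
  νR = trans (ν-* (4 ℕ.* 4 ℕ.^ i ℕ.* m ℕ.^ i ℕ.* (l ℕ.^ i) ℕ.^ m) N) (cong (_* ν N)
    (trans (ν-* (4 ℕ.* 4 ℕ.^ i ℕ.* m ℕ.^ i) ((l ℕ.^ i) ℕ.^ m)) (cong₂ _*_
      (trans (ν-* (4 ℕ.* 4 ℕ.^ i) (m ℕ.^ i)) (cong₂ _*_ (trans (ν-* 4 (4 ℕ.^ i)) (cong (ν 4 *_) (ν-^ 4 i))) (ν-^ m i)))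
      (trans (cong ν (ℕₚ.^-*-assoc l i m)) (trans (ν-^ l (i ℕ.* m)) (power (ν l)))))))
  collect : (ν 4 * (ν m * c l) * (ν l * c l) ^ m) ^ i ≡ ν 4 ^ i * (ν m ^ i * c l ^ i) * ((ν l ^ m) ^ i * (c l ^ m) ^ i)
  collect = trans (^-distrib-* (ν 4 * (ν m * c l)) ((ν l * c l) ^ m) i) (cong₂ _*_
    (trans (^-distrib-* (ν 4) (ν m * c l) i) (cong (ν 4 ^ i *_) (^-distrib-* (ν m) (c l) i)))
    (trans (cong (_^ i) (^-distrib-* (ν l) (c l) m)) (^-distrib-* (ν l ^ m) (c l ^ m) i)))

-- Probability bounds for one insertion.

module _ (θ : ℚ) (0<θ : 0ℚ < θ) (θ≤½ : θ ≤ ½) {l u m : ℕ} (sub : Subcritical θ l m)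
         (r : Permutation′ (suc l)) (xs : Vec (Fin u) m) (x : Fin u) (unique : Unique (xs ∷ʳ x)) where

  private
    n = suc l
    0≤θ = <⇒≤ 0<θ
    θ≤1 = ≤-trans θ≤½ (from-yes (½ ≤? 1ℚ))
    ρ = ν m * c l

  Prob : ℕ → ℚ
  Prob k = Pr (λ (h : Fin u → Fin n) → k <? insertionCost r xs x h)

  ρ≤½ : ρ ≤ ½
  ρ≤½ = *-cancelˡ {a = ν 2} (positive⁻¹ (ν 2)) (subst (_≤ 1ℚ) (solve 1 (λ r → r :+ r := con (+ 2 / 1) :* r) refl ρ) (proj₁ sub))

  νm≡ : ν m ≡ ρ * ν n
  νm≡ = trans (sym (*-identityʳ (ν m))) (trans (cong (ν m *_) (sym (ν*c l)))
    (solve 3 (λ m n c → m :* (n :* c) := m :* c :* n) refl (ν m) (ν n) (c l)))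

  m<n : m ℕ.< n
  m<n = ℕₚ.≰⇒> λ n≤m → from-no (1ℚ ≤? ½) (≤-trans (subst (_≤ ρ) (ν*c l) (*-monoʳ (0≤c l) (ν-mono n {m} n≤m))) ρ≤½)

  bad : ℕ → ℕ
  bad = badCount r xs x unique m<n

  total : ℚ
  total = ν (n ℕ.^ suc m)

  0<total : 0ℚ < total
  0<total = 0<ν (n ℕ.^ suc m) {{ℕₚ.m^n≢0 n (suc m)}}

  Prob-count : ∀ k a → bad k ℕ.* n ℕ.^ suc m ℕ.≤ a ℕ.* n ℕ.^ u → Prob k * total ≤ ν a
  Prob-count k a count = *-cancelʳ (0<ν (n ℕ.^ u) {{ℕₚ.m^n≢0 n u}}) (begin
    Prob k * total * ν (n ℕ.^ u)   ≡⟨ solve 3 (λ p a b → p :* a :* b := p :* b :* a) refl (Prob k) total (ν (n ℕ.^ u)) ⟩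
    Prob k * ν (n ℕ.^ u) * total   ≡⟨ cong (_* total) (/-* (bad k) (n ℕ.^ u) {{ℕₚ.m^n≢0 n u}}) ⟩
    ν (bad k) * total              ≡⟨ sym (ν-* (bad k) (n ℕ.^ suc m)) ⟩
    ν (bad k ℕ.* n ℕ.^ suc m)      ≤⟨ ν-mono (bad k ℕ.* n ℕ.^ suc m) {a ℕ.* n ℕ.^ u} count ⟩
    ν (a ℕ.* n ℕ.^ u)              ≡⟨ ν-* a (n ℕ.^ u) ⟩
    ν a * ν (n ℕ.^ u)              ∎)
    where open ≤-Reasoning

  Prob≤1 : ∀ k → Prob k ≤ 1ℚ
  Prob≤1 k = *-cancelʳ 0<total (≤-trans (Prob-count k (n ℕ.^ suc m) count) (≤-reflexive (sym (*-identityˡ total))))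
    where
    bad≤ : bad k ℕ.≤ n ℕ.^ u
    bad≤ = ℕₚ.≤-trans (length-filter (λ h → k <? insertionCost r xs x h) (hashFunctions u n))
      (ℕₚ.≤-reflexive (trans (length-map (finToFun {n} {u}) (allFin (n ℕ.^ u))) (length-tabulate {n = n ℕ.^ u} id)))
    count : bad k ℕ.* n ℕ.^ suc m ℕ.≤ n ℕ.^ suc m ℕ.* n ℕ.^ u
    count = subst (bad k ℕ.* n ℕ.^ suc m ℕ.≤_) (ℕₚ.*-comm (n ℕ.^ u) (n ℕ.^ suc m)) (ℕₚ.*-monoˡ-≤ (n ℕ.^ suc m) bad≤)

  Prob≤½ : ∀ k → 1 ℕ.≤ k → Prob k ≤ ½
  Prob≤½ k 1≤k = ≤-trans (*-cancelʳ 0<total (begin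
    Prob k * total                  ≤⟨ Prob-count k (n ℕ.^ m ℕ.* m) (badCount-home r xs x unique m<n k 1≤k) ⟩
    ν (n ℕ.^ m ℕ.* m)               ≡⟨ ν-* (n ℕ.^ m) m ⟩
    ν (n ℕ.^ m) * ν m               ≡⟨ cong (ν (n ℕ.^ m) *_) νm≡ ⟩
    ν (n ℕ.^ m) * (ρ * ν n)         ≡⟨ solve 3 (λ a r b → a :* (r :* b) := r :* (b :* a)) refl (ν (n ℕ.^ m)) ρ (ν n) ⟩
    ρ * (ν n * ν (n ℕ.^ m))         ≡⟨ cong (ρ *_) (sym (ν-* n (n ℕ.^ m))) ⟩
    ρ * total                       ∎)) ρ≤½
    where open ≤-Reasoning

  -- Cluster sizes have the form `k + i`, so (1-θ)^k comes out of the sum; the geometric series over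
  -- `i` costs 1/θ, kept on the left as a factor. For k > m no hash function is bad.
  Prob-geometric : ∀ k → θ * Prob k ≤ ν 4 * (1ℚ - θ) ^ k
  Prob-geometric k = *-cancelʳ 0<total ([ few , many ]′ (ℕₚ.≤-<-connex k m))
    where
    open ≤-Reasoning
    many : m ℕ.< k → θ * Prob k * total ≤ ν 4 * (1ℚ - θ) ^ k * total
    many m<k = begin
      θ * Prob k * total            ≡⟨ *-assoc θ (Prob k) total ⟩
      θ * (Prob k * total)          ≤⟨ *-monoˡ 0≤θ (Prob-count k 0 (ℕₚ.≤-reflexive
                                         (cong (ℕ._* n ℕ.^ suc m) (badCount-large r xs x unique m<n k m<k)))) ⟩
      θ * 0ℚ                        ≡⟨ *-zeroʳ θ ⟩
      0ℚ                            ≤⟨ 0≤* (0≤* (0≤ν 4) (0≤^ k (0≤q-p θ≤1))) (<⇒≤ 0<total) ⟩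
      ν 4 * (1ℚ - θ) ^ k * total    ∎
    few : k ℕ.≤ m → θ * Prob k * total ≤ ν 4 * (1ℚ - θ) ^ k * total
    few k≤m = begin
      θ * Prob k * total                        ≡⟨ *-assoc θ (Prob k) total ⟩
      θ * (Prob k * total)                      ≤⟨ *-monoˡ 0≤θ (Prob-count k (n ℕ.* S)
                                                     (badCount-clusters r xs x unique m<n k (m ∸ k) (ℕₚ.m+[n∸m]≡n k≤m))) ⟩
      θ * ν (n ℕ.* S)                           ≡⟨ cong (θ *_) (ν-* n S) ⟩
      θ * (ν n * ν S)                           ≡⟨ solve 3 (λ t n s → t :* (n :* s) := n :* (t :* s)) refl θ (ν n) (ν S) ⟩
      ν n * (θ * ν S)                           ≤⟨ *-monoˡ (0≤ν n) (splitSum-geometric 0≤θ θ≤1 (m ∸ k) K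
                                                     (0≤* (0≤* (0≤ν 4) (0≤ν (n ℕ.^ m))) (0≤^ k (0≤q-p θ≤1))) term) ⟩
      ν n * K                                   ≡⟨ solve 4 (λ n a N q → n :* (a :* N :* q) := a :* q :* (n :* N)) refl
                                                     (ν n) (ν 4) (ν (n ℕ.^ m)) ((1ℚ - θ) ^ k) ⟩
      ν 4 * (1ℚ - θ) ^ k * (ν n * ν (n ℕ.^ m))  ≡⟨ cong (ν 4 * (1ℚ - θ) ^ k *_) (sym (ν-* n (n ℕ.^ m))) ⟩
      ν 4 * (1ℚ - θ) ^ k * total                ∎
      where
      S = splitSum (λ i j → clusterBound n (k ℕ.+ i) j) (m ∸ k)
      K = ν 4 * ν (n ℕ.^ m) * (1ℚ - θ) ^ k
      term : ∀ i j → i ℕ.+ j ≡ m ∸ k → ν (clusterBound n (k ℕ.+ i) j) ≤ K * (1ℚ - θ) ^ i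
      term i j i+j≡ = subst (ν (clusterBound n (k ℕ.+ i) j) ≤_) regroup
        (clusterBound-density l (k ℕ.+ i) j θ≤1 (subst (Subcritical θ l) (sym sum) sub))
        where
        sum : k ℕ.+ i ℕ.+ j ≡ m
        sum = trans (ℕₚ.+-assoc k i j) (trans (cong (k ℕ.+_) i+j≡) (ℕₚ.m+[n∸m]≡n k≤m))
        regroup : ν 4 * ν (n ℕ.^ (k ℕ.+ i ℕ.+ j)) * (1ℚ - θ) ^ (k ℕ.+ i) ≡ K * (1ℚ - θ) ^ i
        regroup = trans (cong₂ (λ a b → ν 4 * ν (n ℕ.^ a) * b) sum (^-homo-* (1ℚ - θ) k i))
          (sym (*-assoc (ν 4 * ν (n ℕ.^ m)) ((1ℚ - θ) ^ k) ((1ℚ - θ) ^ i)))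

seq-^ℝ : ∀ x k i → seq (x ^ℝ k) i ≡ seq x i ^ k
seq-^ℝ x zero    i = refl
seq-^ℝ x (suc k) i = cong (seq x i *_) (seq-^ℝ x k i)

theorem1p1 : (α* : ℝ) → IsCriticalLoad α* →
    (α : ℝ) → 0ℝ ≤ℝ α → α <ℝ α* →
    ∃[ p ] (0ℝ <ℝ p × p ≤ℝ 1ℝ ×
    ((n m : ℕ) .{{_ : NonZero n}} → fromℕ m ≈ α *ℝ fromℕ n →
    (r : Permutation′ n) (u : ℕ) (xs : Vec (Fin u) m) (x : Fin u) →
    Unique (xs ∷ʳ x) →
    (k : ℕ) →
    fromℚ (Pr (λ (h : Fin u → Fin n) → k <? insertionCost r xs x h)) ≤ℝ (1ℝ -ℝ p) ^ℝ k))
theorem1p1 α* critical α 0≤α α<α* =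
  let θ , 0<θ , θ≤½ , sub = subcritical α* critical α α<α*
      p , 0<p , p≤1 , dominated = domination θ 0<θ θ≤½
  -- `p` is a constant sequence fixed before `n` and `m`, so the required inequalities hold termwise
  -- from index 0.
  in fromℚ p ,
     (p , 0<p , 0 , λ _ _ → ≤-reflexive (+-identityˡ p)) ,
     (λ ε 0<ε → 0 , λ _ _ → ≤-trans p≤1 (p≤p+q 1ℚ (<⇒≤ 0<ε))) ,
     λ { (suc l) m load r u xs x unique k ε 0<ε → 0 , λ i _ →
         let sub′ = sub l m load in
         ≤-trans (dominated k (Prob≤1 θ 0<θ θ≤½ sub′ r xs x unique k) (Prob≤½ θ 0<θ θ≤½ sub′ r xs x unique k)
                              (Prob-geometric θ 0<θ θ≤½ sub′ r xs x unique k))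
           (≤-trans (≤-reflexive (sym (seq-^ℝ (1ℝ -ℝ fromℚ p) k i))) (p≤p+q (seq ((1ℝ -ℝ fromℚ p) ^ℝ k) i) (<⇒≤ 0<ε))) }
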